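{- Let $R$ be a finite local ring with maximal ideal $M$ of order $m$. (a) If $|R|/m\equiv 1 \pmod 4$, then the spectrum of $\mathcal{G}_R$ consists of the eigenvalue $\frac{|R|-m}{2}$ with multiplicity $1$, the eigenvalue $\frac{m(-1+\sqrt{|R|/m})}{2}$ with multiplicity $(|R|/m-1)/2$, the eigenvalue $\frac{m(-1-\sqrt{|R|/m})}{2}$ with multiplicity $(|R|/m-1)/2$, and the eigenvalue $0$ with multiplicity $|R|-|R|/m$. (b) If $|R|/m\equiv 3 \pmod 4$, then the spectrum of $\mathcal{G}_R$ consists of the eigenvalue $|R|-m$ with multiplicity $1$, the eigenvalue $-m$ with multiplicity $|R|/m-1$, and the eigenvalue $0$ with multiplicity $|R|-|R|/m$.
   Context: All rings are finite commutative rings with identity $1\neq 0$; a local ring is one with a unique maximal ideal. For such a ring $R$, $R^\times$ is its unit group, $Q_R=\{u^2:u\in R^\times\}$, $T_R=Q_R\cup(-Q_R)$, and the quadratic unitary Cayley graph $\mathcal{G}_R$ has vertex set $R$ with $x,y$ adjacent iff $x-y\in T_R$. The eigenvalues (spectrum) of a graph are those of its adjacency matrix, with multiplicities. -}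

module Defs where

open import Data.Nat as ℕ using (ℕ; zero; suc)
open import Data.Integer as ℤ using (ℤ; +_)
open import Data.Rational as ℚ using (ℚ; 0ℚ; 1ℚ)
open import Data.Fin using (Fin; zero; suc; toℕ; punchIn)
open import Data.Fin.Properties using (any?) renaming (_≟_ to _≟ᶠ_)
open import Data.Fin.Subset using (Subset; _∈_; _∉_; _⊆_; ∣_∣)
open import Data.List using (List; []; _∷_; foldr)
open import Data.Product using (Σ; ∃; _×_; _,_)
open import Data.Sum using (_⊎_)
open import Data.Bool using (Bool; true; false; if_then_else_)
open import Relation.Nullary using (¬_; Dec; yes; no)
open import Relation.Nullary.Decidable using (⌊_⌋; _×-dec_; _⊎-dec_)
open import Relation.Binary.PropositionalEquality using (_≡_; _≢_)
open import Algebra.Structures using (IsCommutativeRing)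

record FiniteCommRing : Set where
  field
    size       : ℕ
    _+_        : Fin size → Fin size → Fin size
    _*_        : Fin size → Fin size → Fin size
    -_         : Fin size → Fin size
    0#         : Fin size
    1#         : Fin size
    isCommRing : IsCommutativeRing _≡_ _+_ _*_ -_ 0# 1#
    1≢0        : 1# ≢ 0#

module _ (R : FiniteCommRing) where
  open FiniteCommRing R

  record IsIdeal (I : Subset size) : Set where
    field
      0∈    : 0# ∈ I
      +-cl  : ∀ {a b} → a ∈ I → b ∈ I → (a + b) ∈ I
      *-cl  : ∀ r {a} → a ∈ I → (r * a) ∈ I

  record IsMaximalIdeal (M : Subset size) : Set where
    field
      ideal   : IsIdeal M
      proper  : 1# ∉ M
      maximal : ∀ J → IsIdeal J → M ⊆ J → J ⊆ M ⊎ 1# ∈ J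

  IsLocalWith : Subset size → Set
  IsLocalWith M = IsMaximalIdeal M × (∀ J → IsMaximalIdeal J → J ≡ M)

  IsUnit : Fin size → Set
  IsUnit u = ∃ λ v → u * v ≡ 1#

  isUnit? : ∀ u → Dec (IsUnit u)
  isUnit? u = any? (λ v → (u * v) ≟ᶠ 1#)

  InT : Fin size → Set
  InT x = ∃ λ u → IsUnit u × (x ≡ u * u ⊎ x ≡ - (u * u))

  inT? : ∀ x → Dec (InT x)
  inT? x = any? (λ u → isUnit? u ×-dec (x ≟ᶠ (u * u) ⊎-dec x ≟ᶠ (- (u * u))))

  adjacent : Fin size → Fin size → Bool
  adjacent x y = ⌊ inT? (x + (- y)) ⌋

record RawCR (A : Set) : Set where
  field
    0# 1# : A
    _+_ _*_ : A → A → A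
    -_ : A → A

module Poly {A : Set} (K : RawCR A) where
  open RawCR K

  -- coefficient lists, lowest degree first
  Pol : Set
  Pol = List A

  _+P_ : Pol → Pol → Pol
  [] +P q = q
  (a ∷ p) +P [] = a ∷ p
  (a ∷ p) +P (b ∷ q) = (a + b) ∷ (p +P q)

  scale : A → Pol → Pol
  scale c [] = []
  scale c (a ∷ p) = (c * a) ∷ scale c p

  _*P_ : Pol → Pol → Pol
  [] *P q = []
  (a ∷ p) *P q = scale a q +P (0# ∷ (p *P q))

  negP : Pol → Pol
  negP = scale (- 1#)

  const : A → Pol
  const a = a ∷ []

  X : Pol
  X = 0# ∷ 1# ∷ []

  _^P_ : Pol → ℕ → Pol
  p ^P zero = const 1#
  p ^P suc k = p *P (p ^P k)

  coeff : Pol → ℕ → A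
  coeff [] _ = 0#
  coeff (a ∷ p) zero = a
  coeff (a ∷ p) (suc i) = coeff p i

  _≈P_ : Pol → Pol → Set
  p ≈P q = ∀ i → coeff p i ≡ coeff q i

  sumFin : ∀ {n} → (Fin n → Pol) → Pol
  sumFin {zero} f = []
  sumFin {suc n} f = f zero +P sumFin (λ i → f (suc i))

  det : ∀ n → (Fin n → Fin n → Pol) → Pol
  det zero M = const 1#
  det (suc n) M = sumFin (λ j → scale (sign (toℕ j)) (M zero j *P det n (λ i k → M (suc i) (punchIn j k))))
    where
      sign : ℕ → A
      sign zero = 1#
      sign (suc k) = - (sign k)

  charPoly : ∀ n → (Fin n → Fin n → A) → Pol
  charPoly n B = det n (λ i j → (if ⌊ i ≟ᶠ j ⌋ then X else []) +P negP (const (B i j)))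

  HasSpectrum : ∀ n → (Fin n → Fin n → A) → List (A × ℕ) → Set
  HasSpectrum n B L = charPoly n B ≈P foldr (λ { (λ₀ , k) p → ((X +P negP (const λ₀)) ^P k) *P p }) (const 1#) L

-- Scalar rings: ℚ, and ℚ(√d) = ℚ[s]/(s² - d) with elements a + b s

ℚ-raw : RawCR ℚ
ℚ-raw = record { 0# = 0ℚ ; 1# = 1ℚ ; _+_ = ℚ._+_ ; _*_ = ℚ._*_ ; -_ = ℚ.-_ }

record ℚ√ : Set where
  constructor _+_√
  field
    re : ℚ
    im : ℚ

ℚ√-raw : ℕ → RawCR ℚ√
ℚ√-raw d = record
  { 0# = 0ℚ + 0ℚ √
  ; 1# = 1ℚ + 0ℚ √
  ; _+_ = λ { (a + b √) (c + e √) → (a ℚ.+ c) + (b ℚ.+ e) √ }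
  ; _*_ = λ { (a + b √) (c + e √) →
              ((a ℚ.* c) ℚ.+ ((b ℚ.* e) ℚ.* (+ d ℚ./ 1))) + ((a ℚ.* e) ℚ.+ (b ℚ.* c)) √ }
  ; -_ = λ { (a + b √) → (ℚ.- a) + (ℚ.- b) √ }
  }

adjMatrix : ∀ {A : Set} → RawCR A → (R : FiniteCommRing) →
            Fin (FiniteCommRing.size R) → Fin (FiniteCommRing.size R) → A
adjMatrix K R x y = if adjacent R x y then RawCR.1# K else RawCR.0# K

{-# OPTIONS --safe #-}
-- Let m = |M|, q = |R| / m, and let N be the matrix of the relation "in distinct cosets of M".
-- With U the |R| × q incidence matrix of the cosets, N = U (J - I) Uᵀ, so that Sylvester's identity,
-- applied twice, evaluates det (α I + β N) for all polynomials α and β.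
--
-- Squaring is two-to-one on the units, as 2 ∉ M, so there are as many squares as nonsquares among the
-- units, and counting the fixed points of negation and inversion on the squares shows that - 1 is a
-- square exactly for q ≡ 1 (mod 4). If q ≡ 3 every unit is a square up to sign and N is the adjacency
-- matrix. If q ≡ 1 let A and A′ be the matrices of "x - y is a square" and "x - y is a nonsquare unit".
-- Then A + A′ = N, and A A′ = κ N with 4 κ = |R| - m, because the number of ways to write a unit as a
-- square plus a nonsquare does not depend on the unit. Multiplication by a nonsquare carries A to A′,
-- so det (X - A) = det (X - A′) and
--   det (X - A)² = det ((X - A) (X - A′)) = det (X² I + (κ - X) N).
-- Monic polynomials with equal squares coincide, so no multiplicity ever has to be computed.

module Submission where

-- Nothing is diagonalised: the scalars are ℚ or ℚ[s]/(s² - q), and the latter has zero divisors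
-- when q is a perfect square. Hence determinants are compared in identities multiplied out by their
-- denominators, and every cancellation of polynomials rests on a leading coefficient, 1 or 2, that
-- is a nonzerodivisor. The polynomials α and β are what unites the two cases: α = X, β = - 1 for q
-- ≡ 3 and α = X², β = κ - X for q ≡ 1. The determinants live over polynomials compared
-- coefficientwise, so they are developed over an arbitrary commutative ring, from the fact that an
-- alternating map of the rows is determined by its value at the identity matrix. The residue field
-- is never formed: squares are counted among the units of R itself, and a finite form of Hensel's
-- lemma shows that being a square depends only on the coset modulo M. This is why the entries of A
-- A′ vanish inside a coset, so that A A′ can be a multiple of N.

open import Defs
open import Algebra.Bundles using (CommutativeRing; CommutativeSemiring; RawRing)
import Algebra.Properties.Ring
import Algebra.Properties.Semiring.Exp
import Algebra.Properties.Semiring.Mult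
import Algebra.Properties.Semiring.Sum
import Algebra.Solver.Ring as RingSolver
import Algebra.Solver.Ring.AlmostCommutativeRing as ACR
import Algebra.Solver.Ring.NaturalCoefficients.Default as NaturalCoefficients
open import Algebra.Structures using (IsCommutativeRing)
open import Data.Bool using (true; false; if_then_else_)
open import Data.Fin as Fin using (Fin; zero; suc; inject₁; punchIn; punchOut; splitAt; _↑ʳ_; _↑ˡ_)
open import Data.Fin.Induction using (<-weakInduction)
open import Data.Fin.Permutation using (Permutation; permutation; _⟨$⟩ʳ_)
open import Data.Fin.Properties
  using (any?; injective⇒≤; punchOut-injective; suc-injective; toℕ-inject₁; <-cmp; _<?_) renaming (_≟_ to _≟ᶠ_)
open import Data.Fin.Subset using (Subset; _∈_; _∉_; _⊆_; _⊃_; ∣_∣)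
open import Data.Fin.Subset.Induction using (⊃-wellFounded)
open import Data.Fin.Subset.Properties using (_∈?_; drop-there)
open import Data.List using ([]; _∷_; length)
open import Data.Maybe using (Maybe; just; nothing)
open import Data.Nat as ℕ using (ℕ; zero; suc; z≤n; s≤s)
import Data.Nat.Properties as ℕₚ
open import Data.Nat.DivMod using (m≡m%n+[m/n]*n; m*n/n≡m)
open import Data.Nat.Tactic.RingSolver using (solve-∀)
open import Data.Product using (_×_; _,_; proj₁; proj₂; ∃)
open import Data.Product.Properties using (≡-dec)
open import Data.Sum using (_⊎_; inj₁; inj₂; [_,_]′)
open import Data.Unit using (tt)
open import Data.Unit.Polymorphic using () renaming (⊤ to ⊤ₚ; tt to ttₚ)
open import Data.Vec using (Vec; []; _∷_; map; tabulate; lookup; _++_; there)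
open import Data.Vec.Functional using (insertAt; removeAt)
open import Data.Vec.Properties
  using (map-∘; map-++; tabulate-∘; lookup-map; lookup∘tabulate; lookup-++ʳ; []=⇒lookup; lookup⇒[]=)
open import Data.Vec.Relation.Binary.Pointwise.Inductive as Pointwise using (Pointwise; []; _∷_)
open import Function using (_∘_)
open import Induction.WellFounded using (Acc; acc)
open import Level using (0ℓ; _⊔_)
open import Relation.Binary using (tri<; tri≈; tri>)
open import Relation.Binary.PropositionalEquality as ≡ using (_≡_; _≢_)
import Relation.Binary.Reasoning.Setoid
open import Relation.Nullary using (Dec; yes; no; ¬_; contradiction)
open import Relation.Nullary.Decidable using (⌊_⌋; _×-dec_; ¬?; decidable-stable)

-- The stdlib solver over an abstract ring does not see that x - x cancels, so
-- it is run with coefficients in ℕ × ℕ, the pair (a , b) standing for a - b.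
module Solver {c ℓ} (R : CommutativeRing c ℓ) where
  open CommutativeRing R
  open Algebra.Properties.Semiring.Mult semiring renaming (_×_ to _·_)
  open Relation.Binary.Reasoning.Setoid setoid

  private
    open Algebra.Properties.Ring ring
    open NaturalCoefficients commutativeSemiring
      using () renaming (solve to semisolve; _:=_ to _:≡_; _:+_ to _⊕_; _:*_ to _⊗_)

    +-rearrange : ∀ a b x y → (a + x) - (b + y) ≈ (a - b) + (x - y)
    +-rearrange a b x y = trans (+-congˡ (sym (-‿+-comm b y)))
      (semisolve 4 (λ a b x y → (a ⊕ x) ⊕ (b ⊕ y) :≡ (a ⊕ b) ⊕ (x ⊕ y)) refl a (- b) x (- y))

    *-rearrange : ∀ a b x y → (a * x + b * y) - (a * y + b * x) ≈ (a - b) * (x - y)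
    *-rearrange a b x y = begin
      (a * x + b * y) - (a * y + b * x)
        ≈⟨ +-congˡ (sym (-‿+-comm _ _)) ⟩
      (a * x + b * y) + (- (a * y) + - (b * x))
        ≈⟨ +-cong (+-congˡ by) (+-cong (-‿distribʳ-* a y) (-‿distribˡ-* b x)) ⟩
      (a * x + - b * - y) + (a * - y + - b * x)
        ≈⟨ semisolve 4 (λ a b x y → (a ⊗ x ⊕ b ⊗ y) ⊕ (a ⊗ y ⊕ b ⊗ x) :≡ (a ⊕ b) ⊗ (x ⊕ y))
             refl a (- b) x (- y) ⟩
      (a - b) * (x - y)  ∎
      where
      by : b * y ≈ - b * - y
      by = trans (sym (-‿involutive _)) (trans (-‿cong (-‿distribʳ-* b y)) (-‿distribˡ-* b (- y)))

    diff : ℕ × ℕ → Carrier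
    diff (a , b) = a · 1# - b · 1#

    -- 0# and 1# are singled out so that the constants of the solver denote them.
    ⟦_⟧ : ℕ × ℕ → Carrier
    ⟦ 0 , 0 ⟧ = 0#
    ⟦ 1 , 0 ⟧ = 1#
    ⟦ p ⟧     = diff p

    ⟦⟧-diff : ∀ p → ⟦ p ⟧ ≈ diff p
    ⟦⟧-diff (0 , 0)           = sym (-‿inverseʳ 0#)
    ⟦⟧-diff (1 , 0)           = sym (trans (+-cong (+-identityʳ 1#) -0#≈0#) (+-identityʳ 1#))
    ⟦⟧-diff (0 , suc b)       = refl
    ⟦⟧-diff (1 , suc b)       = refl
    ⟦⟧-diff (suc (suc a) , b) = refl

    -- A normal form with one component 0: `equal?` compares coefficients as pairs, so equal
    -- differences have to become equal pairs.
    reduce : ℕ → ℕ → ℕ × ℕ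
    reduce (suc a) (suc b) = reduce a b
    reduce a       b       = a , b

    ⟦⟧-reduce : ∀ a b → ⟦ reduce a b ⟧ ≈ diff (a , b)
    ⟦⟧-reduce zero    b       = ⟦⟧-diff (0 , b)
    ⟦⟧-reduce (suc a) zero    = ⟦⟧-diff (suc a , 0)
    ⟦⟧-reduce (suc a) (suc b) = begin
      ⟦ reduce a b ⟧              ≈⟨ ⟦⟧-reduce a b ⟩
      a · 1# - b · 1#             ≈⟨ +-identityˡ _ ⟨
      0# + (a · 1# - b · 1#)      ≈⟨ +-congʳ (-‿inverseʳ 1#) ⟨
      (1# - 1#) + (a · 1# - b · 1#) ≈⟨ +-rearrange _ _ _ _ ⟨
      diff (suc a , suc b)        ∎

    coeffs : RawRing _ _
    coeffs = record
      { Carrier = ℕ × ℕ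
      ; _≈_ = _≡_
      ; _+_ = λ { (a , b) (x , y) → reduce (a ℕ.+ x) (b ℕ.+ y) }
      ; _*_ = λ { (a , b) (x , y) → reduce (a ℕ.* x ℕ.+ b ℕ.* y) (a ℕ.* y ℕ.+ b ℕ.* x) }
      ; -_  = λ { (a , b) → b , a }
      ; 0#  = 0 , 0
      ; 1#  = 1 , 0
      }

    almostRing : ACR.AlmostCommutativeRing c ℓ
    almostRing = ACR.fromCommutativeRing R

    sum-of-products : ∀ a x b y →
      (a ℕ.* x ℕ.+ b ℕ.* y) · 1# ≈ (a · 1#) * (x · 1#) + (b · 1#) * (y · 1#)
    sum-of-products a x b y =
      trans (×-homo-+ 1# (a ℕ.* x) _) (+-cong (×1-homo-* a x) (×1-homo-* b y))

    morphism : coeffs ACR.-Raw-AlmostCommutative⟶ almostRing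
    morphism = record
      { ⟦_⟧ = ⟦_⟧
      ; +-homo = λ { p@(a , b) q@(x , y) → begin
          ⟦ reduce (a ℕ.+ x) (b ℕ.+ y) ⟧                  ≈⟨ ⟦⟧-reduce (a ℕ.+ x) (b ℕ.+ y) ⟩
          (a ℕ.+ x) · 1# - (b ℕ.+ y) · 1#
            ≈⟨ +-cong (×-homo-+ 1# a x) (-‿cong (×-homo-+ 1# b y)) ⟩
          (a · 1# + x · 1#) - (b · 1# + y · 1#)           ≈⟨ +-rearrange _ _ _ _ ⟩
          diff p + diff q                                 ≈⟨ +-cong (⟦⟧-diff p) (⟦⟧-diff q) ⟨
          ⟦ p ⟧ + ⟦ q ⟧                                   ∎ }
      ; *-homo = λ { p@(a , b) q@(x , y) → begin
          ⟦ reduce (a ℕ.* x ℕ.+ b ℕ.* y) (a ℕ.* y ℕ.+ b ℕ.* x) ⟧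
            ≈⟨ ⟦⟧-reduce (a ℕ.* x ℕ.+ b ℕ.* y) (a ℕ.* y ℕ.+ b ℕ.* x) ⟩
          (a ℕ.* x ℕ.+ b ℕ.* y) · 1# - (a ℕ.* y ℕ.+ b ℕ.* x) · 1#
            ≈⟨ +-cong (sum-of-products a x b y) (-‿cong (sum-of-products a y b x)) ⟩
          _                                               ≈⟨ *-rearrange _ _ _ _ ⟩
          diff p * diff q                                 ≈⟨ *-cong (⟦⟧-diff p) (⟦⟧-diff q) ⟨
          ⟦ p ⟧ * ⟦ q ⟧                                   ∎ }
      ; -‿homo = λ { p@(a , b) → begin
          ⟦ b , a ⟧                   ≈⟨ ⟦⟧-diff (b , a) ⟩
          b · 1# - a · 1#             ≈⟨ +-congʳ (-‿involutive _) ⟨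
          - - (b · 1#) - a · 1#       ≈⟨ +-comm _ _ ⟩
          - (a · 1#) - - (b · 1#)     ≈⟨ -‿+-comm _ _ ⟩
          - diff p                    ≈⟨ -‿cong (⟦⟧-diff p) ⟨
          - ⟦ p ⟧                     ∎ }
      ; 0-homo = refl
      ; 1-homo = refl
      }

    equal? : ∀ p q → Maybe (⟦ p ⟧ ≈ ⟦ q ⟧)
    equal? p q with ≡-dec ℕ._≟_ ℕ._≟_ p q
    ... | yes ≡.refl = just refl
    ... | no  _      = nothing

  open RingSolver coeffs almostRing morphism equal? public
    using (solve; _:=_; _:+_; _:*_; _:-_; :-_; con; Polynomial)

  :0 :1 : ∀ {n} → Polynomial n
  :0 = con (0 , 0)
  :1 = con (1 , 0)

-- The sums of the stdlib, made opaque so that summands can be inferred.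
module FiniteSum {c ℓ} (S : CommutativeSemiring c ℓ) where
  open CommutativeSemiring S hiding (zero)
  open Algebra.Properties.Semiring.Mult semiring using () renaming (_×_ to _·_)
  private module Sum = Algebra.Properties.Semiring.Sum semiring

  opaque
    ∑ : ∀ {n} → (Fin n → Carrier) → Carrier
    ∑ = Sum.sum

    ∑-empty : ∀ {f : Fin 0 → Carrier} → ∑ f ≈ 0#
    ∑-empty = refl

    ∑-suc : ∀ {n} {f : Fin (suc n) → Carrier} → ∑ f ≈ f zero + ∑ (f ∘ suc)
    ∑-suc = refl

    ∑-cong : ∀ {n} {f g : Fin n → Carrier} → (∀ i → f i ≈ g i) → ∑ f ≈ ∑ g
    ∑-cong = Sum.sum-cong-≋

    ∑-+ : ∀ {n} (f g : Fin n → Carrier) → ∑ (λ i → f i + g i) ≈ ∑ f + ∑ g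
    ∑-+ = Sum.∑-distrib-+

    ∑-comm : ∀ {m n} (f : Fin m → Fin n → Carrier) →
      ∑ (λ i → ∑ (λ j → f i j)) ≈ ∑ (λ j → ∑ (λ i → f i j))
    ∑-comm = Sum.∑-comm

    ∑-permute : ∀ {m n} (f : Fin n → Carrier) (π : Permutation m n) → ∑ f ≈ ∑ (λ i → f (π ⟨$⟩ʳ i))
    ∑-permute = Sum.∑-permute

    ∑-const : ∀ n x → ∑ {n} (λ _ → x) ≈ n · x
    ∑-const n x = Sum.sum-replicate n

    *-∑ : ∀ {n} x (f : Fin n → Carrier) → x * ∑ f ≈ ∑ (λ i → x * f i)
    *-∑ = Sum.*-distribˡ-sum

    ∑-* : ∀ {n} x (f : Fin n → Carrier) → ∑ f * x ≈ ∑ (λ i → f i * x)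
    ∑-* = Sum.*-distribʳ-sum

    ∑≈0 : ∀ {n} {f : Fin n → Carrier} → (∀ i → f i ≈ 0#) → ∑ f ≈ 0#
    ∑≈0 {n} h = trans (∑-cong h) (Sum.sum-replicate-zero n)

-- Alternating maps and determinants

module Determinant {c ℓ} (R : CommutativeRing c ℓ) where
  open CommutativeRing R hiding (zero)
  open Algebra.Properties.Ring ring
  open FiniteSum commutativeSemiring
  open Algebra.Properties.Semiring.Exp semiring
  open Relation.Binary.Reasoning.Setoid setoid
  open Solver R

  Row : Set → Set c
  Row I = I → Carrier

  infix 4 _≋_
  _≋_ : ∀ {I} → Row I → Row I → Set ℓ
  u ≋ v = ∀ i → u i ≈ v i

  ≋-refl : ∀ {I} {u : Row I} → u ≋ u
  ≋-refl i = refl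

  -- Given by recursion and not through decidable equality, so that `δ ∘ suc` computes and the
  -- identity matrix can be peeled row by row.
  δ : ∀ {n} → Fin n → Row (Fin n)
  δ zero    zero    = 1#
  δ zero    (suc j) = 0#
  δ (suc i) zero    = 0#
  δ (suc i) (suc j) = δ i j

  δ-refl : ∀ {n} (i : Fin n) → δ i i ≈ 1#
  δ-refl zero    = refl
  δ-refl (suc i) = δ-refl i

  δ-≢ : ∀ {n} {i j : Fin n} → i ≢ j → δ i j ≈ 0#
  δ-≢ {i = zero}  {zero}  i≢j = contradiction ≡.refl i≢j
  δ-≢ {i = zero}  {suc j} i≢j = refl
  δ-≢ {i = suc i} {zero}  i≢j = refl
  δ-≢ {i = suc i} {suc j} i≢j = δ-≢ (i≢j ∘ ≡.cong suc)

  δ-sym : ∀ {n} (i j : Fin n) → δ i j ≈ δ j i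
  δ-sym i j with i ≟ᶠ j
  ... | yes ≡.refl = refl
  ... | no  i≢j    = trans (δ-≢ i≢j) (sym (δ-≢ (i≢j ∘ ≡.sym)))

  δ-injective : ∀ {n k} (f : Fin n → Fin k) → (∀ {i j} → f i ≡ f j → i ≡ j) → ∀ i j → δ (f i) (f j) ≈ δ i j
  δ-injective f inj i j with i ≟ᶠ j
  ... | yes ≡.refl = trans (δ-refl (f i)) (sym (δ-refl i))
  ... | no  i≢j    = trans (δ-≢ (i≢j ∘ inj)) (sym (δ-≢ i≢j))

  sum-δ : ∀ {n} (i : Fin n) (a : Row (Fin n)) → ∑ (λ j → δ i j * a j) ≈ a i
  sum-δ zero a = begin
    ∑ (λ j → δ zero j * a j)               ≈⟨ ∑-suc ⟩
    1# * a zero + ∑ (λ j → 0# * a (suc j)) ≈⟨ +-cong (*-identityˡ _) (∑≈0 (λ _ → zeroˡ _)) ⟩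
    a zero + 0#                            ≈⟨ +-identityʳ _ ⟩
    a zero                                 ∎
  sum-δ (suc i) a = begin
    ∑ (λ j → δ (suc i) j * a j)               ≈⟨ ∑-suc ⟩
    0# * a zero + ∑ (λ j → δ i j * a (suc j)) ≈⟨ +-cong (zeroˡ _) (sum-δ i (a ∘ suc)) ⟩
    0# + a (suc i)                            ≈⟨ +-identityˡ _ ⟩
    a (suc i)                                 ∎

  -- `cong` is a field because rows are functions that are only ever compared pointwise.
  record Linear {I} (φ : Row I → Carrier) : Set (c ⊔ ℓ) where
    field
      cong  : ∀ {u v} → u ≋ v → φ u ≈ φ v
      add   : ∀ u v → φ (λ i → u i + v i) ≈ φ u + φ v
      scale : ∀ a u → φ (λ i → a * u i) ≈ a * φ u

    zero-row : φ (λ _ → 0#) ≈ 0#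
    zero-row = trans (cong (λ _ → sym (zeroˡ 0#))) (trans (scale 0# _) (zeroˡ _))

    combination : ∀ {k} (a : Fin k → Carrier) (v : Fin k → Row I) →
      φ (λ i → ∑ (λ j → a j * v j i)) ≈ ∑ (λ j → a j * φ (v j))
    combination {zero}  a v = trans (cong (λ _ → ∑-empty)) (trans zero-row (sym ∑-empty))
    combination {suc k} a v = begin
      φ (λ i → ∑ (λ j → a j * v j i))
        ≈⟨ cong (λ _ → ∑-suc) ⟩
      φ (λ i → a zero * v zero i + ∑ (λ j → a (suc j) * v (suc j) i))
        ≈⟨ add _ _ ⟩
      φ (λ i → a zero * v zero i) + φ (λ i → ∑ (λ j → a (suc j) * v (suc j) i))
        ≈⟨ +-cong (scale _ _) (combination (a ∘ suc) (v ∘ suc)) ⟩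
      a zero * φ (v zero) + ∑ (λ j → a (suc j) * φ (v (suc j)))
        ≈⟨ ∑-suc ⟨
      ∑ (λ j → a j * φ (v j)) ∎

    expand : ∀ {k} (a : Fin k → Carrier) (v : Fin k → Row I) {u} →
      (∀ i → u i ≈ ∑ (λ j → a j * v j i)) → φ u ≈ ∑ (λ j → a j * φ (v j))
    expand a v h = trans (cong h) (combination a v)

  LinearMap : ∀ {I J} → (Row I → Row J) → Set (c ⊔ ℓ)
  LinearMap L = ∀ j → Linear (λ u → L u j)

  linear-∘ : ∀ {I J} {φ : Row J → Carrier} {L : Row I → Row J} →
    Linear φ → LinearMap L → Linear (φ ∘ L)
  linear-∘ φ-lin L-lin = record
    { cong  = λ h → cong (λ j → Linear.cong (L-lin j) h)
    ; add   = λ u v → trans (cong (λ j → Linear.add (L-lin j) u v)) (add _ _)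
    ; scale = λ a u → trans (cong (λ j → Linear.scale (L-lin j) a u)) (scale _ _)
    }
    where open Linear φ-lin

  coordinate-linear : ∀ {I} (i : I) → Linear (λ u → u i)
  coordinate-linear i = record
    { cong = λ h → h i ; add = λ _ _ → refl ; scale = λ _ _ → refl }

  linear-scale : ∀ {I} {φ : Row I → Carrier} a → Linear φ → Linear (λ u → a * φ u)
  linear-scale {φ = φ} a φ-lin = record
    { cong  = λ h → *-congˡ (cong h)
    ; add   = λ u v → trans (*-congˡ (add u v)) (distribˡ a _ _)
    ; scale = λ b u → trans (*-congˡ (scale b u))
        (solve 3 (λ a b x → a :* (b :* x) := b :* (a :* x)) refl a b (φ u))
    }
    where open Linear φ-lin

  linear-sum : ∀ {I k} {φ : Fin k → Row I → Carrier} →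
    (∀ j → Linear (φ j)) → Linear (λ u → ∑ (λ j → φ j u))
  linear-sum φ-lin = record
    { cong  = λ h → ∑-cong (λ j → Linear.cong (φ-lin j) h)
    ; add   = λ u v → trans (∑-cong (λ j → Linear.add (φ-lin j) u v)) (∑-+ _ _)
    ; scale = λ a u → trans (∑-cong (λ j → Linear.scale (φ-lin j) a u))
        (sym (*-∑ a (λ j → _)))
    }

  linear-cong : ∀ {I} {φ ψ : Row I → Carrier} → (∀ u → φ u ≈ ψ u) → Linear φ → Linear ψ
  linear-cong h φ-lin = record
    { cong  = λ e → trans (sym (h _)) (trans (cong e) (h _))
    ; add   = λ u v → trans (sym (h _)) (trans (add u v) (+-cong (h u) (h v)))
    ; scale = λ a u → trans (sym (h _)) (trans (scale a u) (*-congˡ (h u)))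
    }
    where open Linear φ-lin

  -- Alternation is only required for the first two rows of each suffix of the
  -- argument list; vanishing on arbitrary repeated rows is kills-head.
  VanishesOnTwins : ∀ {I} n → (Vec (Row I) (suc n) → Carrier) → Set (c ⊔ ℓ)
  VanishesOnTwins zero    f = ⊤ₚ
  VanishesOnTwins (suc n) f = ∀ v w → f (v ∷ v ∷ w) ≈ 0#

  Alternating : ∀ {I} n → (Vec (Row I) n → Carrier) → Set (c ⊔ ℓ)
  Alternating zero    f = ⊤ₚ
  Alternating (suc n) f =
    (∀ w → Linear (λ v → f (v ∷ w))) ×
    (∀ v → Alternating n (λ w → f (v ∷ w))) ×
    VanishesOnTwins n f

  alternating-cong : ∀ {I} n {f : Vec (Row I) n → Carrier} → Alternating n f →
    ∀ {w w′} → Pointwise _≋_ w w′ → f w ≈ f w′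
  alternating-cong zero    alt [] = refl
  alternating-cong (suc n) (lin , alt , _) (h ∷ hs) =
    trans (Linear.cong (lin _) h) (alternating-cong n (alt _) hs)

  map-pointwise : ∀ {I J n} {L L′ : Row I → Row J} → (∀ u → L u ≋ L′ u) →
    (w : Vec (Row I) n) → Pointwise _≋_ (map L w) (map L′ w)
  map-pointwise h []      = []
  map-pointwise h (u ∷ w) = h u ∷ map-pointwise h w

  alternating-map : ∀ {I J} n {f : Vec (Row J) n → Carrier} {L : Row I → Row J} →
    LinearMap L → Alternating n f → Alternating n (f ∘ map L)
  alternating-map zero    L-lin alt = ttₚ
  alternating-map {I} {J} (suc n) {f} {L} L-lin (lin , alt , twins) =
    (λ w → linear-∘ (lin (map L w)) L-lin) ,
    (λ v → alternating-map n L-lin (alt (L v))) ,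
    twins′ n f twins
    where
    twins′ : ∀ n (f : Vec (Row J) (suc n) → Carrier) →
      VanishesOnTwins n f → VanishesOnTwins n (f ∘ map L)
    twins′ zero    f h     = ttₚ
    twins′ (suc n) f h v w = h (L v) (map L w)

  alternating-scale : ∀ {I} n {f : Vec (Row I) n → Carrier} a →
    Alternating n f → Alternating n (λ w → a * f w)
  alternating-scale zero    a alt = ttₚ
  alternating-scale {I} (suc n) {f} a (lin , alt , twins) =
    (λ w → linear-scale a (lin w)) , (λ v → alternating-scale n a (alt v)) , twins′ n f twins
    where
    twins′ : ∀ n (f : Vec (Row I) (suc n) → Carrier) →
      VanishesOnTwins n f → VanishesOnTwins n (λ w → a * f w)
    twins′ zero    f h     = ttₚ
    twins′ (suc n) f h v w = trans (*-congˡ (h v w)) (zeroʳ a)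

  alternating-sum : ∀ {I k} n {f : Fin k → Vec (Row I) n → Carrier} →
    (∀ j → Alternating n (f j)) → Alternating n (λ w → ∑ (λ j → f j w))
  alternating-sum zero    alt = ttₚ
  alternating-sum {I} {k} (suc n) {f} alt =
    (λ w → linear-sum (λ j → proj₁ (alt j) w)) ,
    (λ v → alternating-sum n (λ j → proj₁ (proj₂ (alt j)) v)) ,
    twins′ n f (λ j → proj₂ (proj₂ (alt j)))
    where
    twins′ : ∀ n (f : Fin k → Vec (Row I) (suc n) → Carrier) →
      (∀ j → VanishesOnTwins n (f j)) → VanishesOnTwins n (λ w → ∑ (λ j → f j w))
    twins′ zero    f h     = ttₚ
    twins′ (suc n) f h v w = ∑≈0 (λ j → h j v w)

  -- Polarisation: expand the value 0 on the repeated row u + v by linearity in both places; the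
  -- terms with u twice or v twice vanish.
  swap : ∀ {I} n {f : Vec (Row I) (suc (suc n)) → Carrier} → Alternating (suc (suc n)) f →
    ∀ u v w → f (u ∷ v ∷ w) ≈ - f (v ∷ u ∷ w)
  swap n {f} (lin , alt , twins) u v w = +-inverseˡ-unique _ _ (begin
    f (u ∷ v ∷ w) + f (v ∷ u ∷ w)
      ≈⟨ +-cong (+-identityˡ _) (+-identityʳ _) ⟨
    (0# + f (u ∷ v ∷ w)) + (f (v ∷ u ∷ w) + 0#)
      ≈⟨ +-cong (+-congʳ (twins u w)) (+-congˡ (twins v w)) ⟨
    (f (u ∷ u ∷ w) + f (u ∷ v ∷ w)) + (f (v ∷ u ∷ w) + f (v ∷ v ∷ w))
      ≈⟨ +-cong (Linear.add (proj₁ (alt u) w) u v) (Linear.add (proj₁ (alt v) w) u v) ⟨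
    f (u ∷ s ∷ w) + f (v ∷ s ∷ w)
      ≈⟨ Linear.add (lin (s ∷ w)) u v ⟨
    f (s ∷ s ∷ w)
      ≈⟨ twins s w ⟩
    0# ∎)
    where
    s : Row _
    s i = u i + v i

  -- In the applications g is an alternating map with v already placed in one of its other rows, so
  -- that multiples of v may be added to every remaining row without changing the value.
  Kills : ∀ {I n} → (Vec (Row I) n → Carrier) → Row I → Set (c ⊔ ℓ)
  Kills g v = ∀ w i → lookup w i ≡ v → g w ≈ 0#

  -- When the second copy of v lies deeper, a swap moves the leading v past u; then u is frozen as
  -- the first argument and the induction continues behind it.
  kills-head : ∀ {I} n {f : Vec (Row I) (suc n) → Carrier} → Alternating (suc n) f →
    ∀ v → Kills (λ w → f (v ∷ w)) v
  kills-head (suc n) (_ , _ , twins) v (.v ∷ w) zero ≡.refl = twins v w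
  kills-head (suc n) {f} all@(_ , alt , _) v (u ∷ w) (suc i) eq = begin
    f (v ∷ u ∷ w)   ≈⟨ swap n {f} all v u w ⟩
    - f (u ∷ v ∷ w) ≈⟨ -‿cong (kills-head n (alt u) v w i eq) ⟩
    - 0#            ≈⟨ -0#≈0# ⟩
    0#              ∎

  kills-map : ∀ {I} n {g : Vec (Row I) n → Carrier} → Alternating n g →
    ∀ {v} → Kills g v → ∀ (a : Row I → Carrier) w →
    g (map (λ u i → u i + a u * v i) w) ≈ g w
  kills-map zero    alt kills a [] = refl
  kills-map (suc n) {g} (lin , alt , _) {v} kills a (u ∷ w) = begin
    g ((λ i → u i + a u * v i) ∷ w′)
      ≈⟨ Linear.add (lin w′) _ _ ⟩
    g (u ∷ w′) + g ((λ i → a u * v i) ∷ w′)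
      ≈⟨ +-congˡ (trans (Linear.scale (lin w′) _ _) (trans (*-congˡ (kills _ zero ≡.refl)) (zeroʳ _))) ⟩
    g (u ∷ w′) + 0#
      ≈⟨ +-identityʳ _ ⟩
    g (u ∷ w′)
      ≈⟨ kills-map n (alt u) (λ w i → kills (u ∷ w) (suc i)) a w ⟩
    g (u ∷ w) ∎
    where w′ = map (λ u i → u i + a u * v i) w

  kills-add : ∀ {I k} n {g : Vec (Row I) n → Carrier} → Alternating n g →
    (v : Fin k → Row I) → (∀ j → Kills g (v j)) →
    (b : Fin n → Row I) (a : Fin n → Fin k → Carrier) →
    g (tabulate (λ i x → b i x + ∑ (λ j → a i j * v j x))) ≈ g (tabulate b)
  kills-add zero    alt v kills b a = refl
  kills-add {I} (suc n) {g} (lin , alt , _) v kills b a = begin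
    g ((λ x → b zero x + ∑ (λ j → a zero j * v j x)) ∷ w)
      ≈⟨ Linear.add (lin w) _ _ ⟩
    g (b zero ∷ w) + g ((λ x → ∑ (λ j → a zero j * v j x)) ∷ w)
      ≈⟨ +-congˡ (trans (Linear.combination (lin w) _ _)
           (∑≈0 (λ j → trans (*-congˡ (kills j _ zero ≡.refl)) (zeroʳ _)))) ⟩
    g (b zero ∷ w) + 0#
      ≈⟨ +-identityʳ _ ⟩
    g (b zero ∷ w)
      ≈⟨ kills-add n (alt (b zero)) v (λ j w i → kills j (b zero ∷ w) (suc i)) (b ∘ suc) (a ∘ suc) ⟩
    g (b zero ∷ tabulate (b ∘ suc)) ∎
    where
    w : Vec (Row I) n
    w = tabulate (λ i x → b (suc i) x + ∑ (λ j → a (suc i) j * v j x))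

  scale-rows : ∀ {I} n {g : Vec (Row I) n → Carrier} → Alternating n g →
    ∀ a (b : Fin n → Row I) → g (tabulate (λ i x → a * b i x)) ≈ a ^ n * g (tabulate b)
  scale-rows zero    alt a b = sym (*-identityˡ _)
  scale-rows (suc n) {g} (lin , alt , _) a b = begin
    _ ≈⟨ Linear.scale (lin _) a (b zero) ⟩
    a * g (b zero ∷ tabulate (λ i x → a * b (suc i) x)) ≈⟨ *-congˡ (scale-rows n (alt (b zero)) a (b ∘ suc)) ⟩
    a * (a ^ n * g (tabulate b))                        ≈⟨ *-assoc _ _ _ ⟨
    a ^ suc n * g (tabulate b)                          ∎

  -- The Laplace determinant as the universal alternating map

  sign : ∀ {n} → Fin n → Carrier
  sign zero    = 1#
  sign (suc j) = - sign j

  -- The rows form a vector, not a function, so that alternation can be treated one row at a time;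
  -- the row type is shortened by `removeAt` on columns.
  det : ∀ {n} → Vec (Row (Fin n)) n → Carrier
  det []      = 1#
  det (r ∷ w) = ∑ (λ j → sign j * (r j * det (map (λ v → removeAt v j) w)))

  private
    liftᶜ : ∀ {m n} → (Fin m → Fin n) → Fin (suc m) → Fin (suc n)
    liftᶜ h zero    = zero
    liftᶜ h (suc l) = suc (h l)

    -- The double Laplace expansion along two equal rows a, where F h stands for
    -- the minor on the columns in the image of h.
    double : ∀ n → (Fin (suc (suc n)) → Carrier) → ((Fin n → Fin (suc (suc n))) → Carrier) → Carrier
    double n a F = ∑ (λ j → sign j * (a j *
      ∑ (λ k → sign k * (a (punchIn j k) * F (punchIn j ∘ punchIn k)))))

    Extensional : ∀ {m n} → ((Fin m → Fin n) → Carrier) → Set ℓ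
    Extensional F = ∀ {h h′} → (∀ l → h l ≡ h′ l) → F h ≈ F h′

    -- The terms in which the first expanded column is 0 cancel against those in
    -- which the second is, and the others form a double expansion again.
    double≈0 : ∀ n a F → Extensional F → double n a F ≈ 0#
    others : ∀ n → (Fin (suc (suc n)) → Carrier) → ((Fin n → Fin (suc (suc n))) → Carrier) →
      Fin (suc n) → Carrier
    others n a F j = sign j * (a (suc j) *
      ∑ (λ k → sign k * (a (suc (punchIn j k)) * F (punchIn (suc j) ∘ punchIn (suc k)))))
    others≈0 : ∀ n a F → Extensional F → ∑ (others n a F) ≈ 0#

    others≈0 zero a F ext =
      ∑≈0 {1} (λ j → trans (*-congˡ (trans (*-congˡ ∑-empty) (zeroʳ _))) (zeroʳ _))
    others≈0 (suc n) a F ext = trans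
      -- Column 0 is never expanded in these terms, so the surviving columns are 0 followed by a
      -- doubly deleted selection of the others.
      (∑-cong (λ j → *-congˡ (*-congˡ (∑-cong (λ k → *-congˡ (*-congˡ
        (ext {punchIn (suc j) ∘ punchIn (suc k)} {liftᶜ (punchIn j ∘ punchIn k)}
             λ { zero → ≡.refl ; (suc l) → ≡.refl })))))))
      (double≈0 n (a ∘ suc) (F ∘ liftᶜ) (λ h≗h′ → ext λ { zero → ≡.refl ; (suc l) → ≡.cong suc (h≗h′ l) }))

    double≈0 n a F ext = begin
      double n a F
        ≈⟨ ∑-suc ⟩
      1# * (a zero * ∑ T) + ∑ (λ j → - sign j * (a (suc j) * ∑ (U j)))
        ≈⟨ +-cong (trans (*-identityˡ _) (*-∑ (a zero) T)) (∑-cong step) ⟩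
      ∑ (λ j → a zero * T j) + ∑ (λ j → - (a zero * T j) + others n a F j)
        ≈⟨ ∑-+ (λ j → a zero * T j) (λ j → - (a zero * T j) + others n a F j) ⟨
      ∑ (λ j → a zero * T j + (- (a zero * T j) + others n a F j))
        ≈⟨ ∑-cong (λ j → solve 2 (λ x y → x :+ (:- x :+ y) := y) refl (a zero * T j) (others n a F j)) ⟩
      ∑ (others n a F)
        ≈⟨ others≈0 n a F ext ⟩
      0# ∎
      where
      G T : Fin (suc n) → Carrier
      G j = F (suc ∘ punchIn j)
      T j = sign j * (a (suc j) * G j)
      U : Fin (suc n) → Fin (suc n) → Carrier
      U j k = sign k * (a (punchIn (suc j) k) * F (punchIn (suc j) ∘ punchIn k))
      S : Fin (suc n) → Fin n → Carrier
      S j k = sign k * (a (suc (punchIn j k)) * F (punchIn (suc j) ∘ punchIn (suc k)))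
      step : ∀ j → - sign j * (a (suc j) * ∑ (U j)) ≈ - (a zero * T j) + others n a F j
      step j = begin
        - sign j * (a (suc j) * ∑ (U j))
          ≈⟨ *-congˡ (*-congˡ ∑-suc) ⟩
        - sign j * (a (suc j) * (1# * (a zero * G j) + ∑ (λ k → U j (suc k))))
          ≈⟨ *-congˡ (*-congˡ (+-congˡ (∑-cong (λ k →
               trans (sym (-‿distribˡ-* _ _)) (sym (-1*x≈-x _)))))) ⟩
        - sign j * (a (suc j) * (1# * (a zero * G j) + ∑ (λ k → - 1# * S j k)))
          ≈⟨ *-congˡ (*-congˡ (+-congˡ (*-∑ (- 1#) (S j)))) ⟨
        - sign j * (a (suc j) * (1# * (a zero * G j) + - 1# * ∑ (S j)))
          -- The sign - `sign j` of column `suc j` survives in the term k = 0, which cancels an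
          -- expansion term with first column 0; in the terms `suc k` it meets the second minus, so
          -- that `others` carries no extra sign.
          ≈⟨ solve 5 (λ s b z g t → :- s :* (b :* (:1 :* (z :* g) :+ :- :1 :* t)) :=
               :- (z :* (s :* (b :* g))) :+ s :* (b :* t)) refl
               (sign j) (a (suc j)) (a zero) (G j) (∑ (S j)) ⟩
        - (a zero * T j) + others n a F j ∎

  removeAt-linear : ∀ {n} (j : Fin (suc n)) → LinearMap (λ v → removeAt v j)
  removeAt-linear j k = coordinate-linear (punchIn j k)

  det-alternating : ∀ n → Alternating n det
  det-alternating zero    = ttₚ
  det-alternating (suc n) =
    (λ w → linear-sum (λ j → linear-scale (sign j)
      (linear-cong (λ u → *-comm _ _) (linear-scale _ (coordinate-linear j))))) ,
    (λ v → alternating-sum n (λ j → alternating-scale n (sign j) (alternating-scale n (v j)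
      (alternating-map n (removeAt-linear j) (det-alternating n))))) ,
    twins n
    where
    twins : ∀ n → VanishesOnTwins n det
    twins zero        = ttₚ
    -- Deleting two columns is restriction along a composite of two `punchIn`, which brings the
    -- expansion into the shape of `double`.
    twins (suc n) v w = trans
      (∑-cong (λ j → *-congˡ (*-congˡ (∑-cong (λ k → *-congˡ (*-congˡ
        (reflexive (≡.cong det (≡.sym (map-∘ (λ v → removeAt v k) (λ v → removeAt v j) w))))))))))
      (double≈0 n v (λ h → det (map (λ u → u ∘ h) w))
        (λ h≗h′ → alternating-cong n (det-alternating n)
          (map-pointwise (λ u l → reflexive (≡.cong u (h≗h′ l))) w)))

  tabulate-pointwise : ∀ {I n} {A B : Fin n → Row I} → (∀ i → A i ≋ B i) →
    Pointwise _≋_ (tabulate A) (tabulate B)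
  tabulate-pointwise = Pointwise.tabulate⁺

  ident : ∀ n → Vec (Row (Fin n)) n
  ident n = tabulate δ

  insert0 : ∀ {n} → Fin (suc n) → Row (Fin n) → Row (Fin (suc n))
  insert0 j v = insertAt v j 0#

  insert0-linear : ∀ {n} (j : Fin (suc n)) → LinearMap (insert0 j)
  insert0-linear zero zero = record
    { cong = λ _ → refl ; add = λ _ _ → sym (+-identityˡ _) ; scale = λ a _ → sym (zeroʳ a) }
  insert0-linear zero (suc k) = coordinate-linear k
  insert0-linear {suc n} (suc j) zero    = coordinate-linear zero
  insert0-linear {suc n} (suc j) (suc k) =
    linear-∘ {L = _∘ suc} (insert0-linear j k) (λ l → coordinate-linear (suc l))

  -- Cofactors come from row operations: once δ j is a row, column j of every other row can be
  -- cleared, and a cleared row is determined by its part outside column j.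
  clear-column : ∀ {n} (j : Fin (suc n)) (u : Row (Fin (suc n))) k →
    insert0 j (removeAt u j) k ≈ u k + - u j * δ j k
  clear-column zero u zero    = solve 1 (λ x → :0 := x :+ :- x :* :1) refl (u zero)
  clear-column zero u (suc k) = solve 2 (λ x y → y := y :+ :- x :* :0) refl (u zero) (u (suc k))
  clear-column {suc n} (suc j) u zero =
    solve 2 (λ x y → y := y :+ :- x :* :0) refl (u (suc j)) (u zero)
  clear-column {suc n} (suc j) u (suc k) = clear-column j (u ∘ suc) k

  δ-expand : ∀ {n} {φ : Row (Fin n) → Carrier} → Linear φ → ∀ u → φ u ≈ ∑ (λ j → u j * φ (δ j))
  δ-expand φ-lin u = Linear.expand φ-lin u δ (λ i → sym (trans
    (∑-cong (λ j → trans (*-comm _ _) (*-congʳ (δ-sym j i)))) (sum-δ i u)))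

  sum-δʳ : ∀ {n} (i : Fin n) (a : Row (Fin n)) → ∑ (λ j → a j * δ j i) ≈ a i
  sum-δʳ i a = sym (δ-expand (coordinate-linear i) a)

  -- Moving the row δ j to the front of the identity matrix takes j adjacent swaps.
  front-row : ∀ n {f : Vec (Row (Fin (suc n))) (suc n) → Carrier} → Alternating (suc n) f →
    ∀ j → f (δ j ∷ map (insert0 j) (ident n)) ≈ sign j * f (ident (suc n))
  front-row n {f} alt zero = begin
    f (δ zero ∷ map (insert0 zero) (ident n))
      ≡⟨ ≡.cong (λ w → f (δ zero ∷ w)) (tabulate-∘ (insert0 zero) δ) ⟨
    f (δ zero ∷ tabulate (insert0 zero ∘ δ))
      ≈⟨ alternating-cong (suc n) alt (≋-refl ∷ tabulate-pointwise (λ { i zero → refl ; i (suc k) → refl })) ⟩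
    f (ident (suc n))
      ≈⟨ *-identityˡ _ ⟨
    1# * f (ident (suc n)) ∎
  front-row (suc n) {f} all@(_ , alt , _) (suc j) = begin
    f (δ (suc j) ∷ insert0 (suc j) (δ zero) ∷ map (insert0 (suc j)) (tabulate (δ ∘ suc)))
      ≈⟨ swap n {f} all _ _ _ ⟩
    - f (insert0 (suc j) (δ zero) ∷ δ (suc j) ∷ map (insert0 (suc j)) (tabulate (δ ∘ suc)))
      ≡⟨ ≡.cong (λ w → - f (insert0 (suc j) (δ zero) ∷ δ (suc j) ∷ w)) (tabulate-∘ (insert0 (suc j)) (δ ∘ suc)) ⟨
    - f (insert0 (suc j) (δ zero) ∷ δ (suc j) ∷ tabulate (insert0 (suc j) ∘ δ ∘ suc))
      ≈⟨ -‿cong (alternating-cong (suc (suc n)) {f} all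
           ((λ { zero → refl ; (suc k) → zero-row j k })
            ∷ (λ { zero → refl ; (suc k) → refl })
            ∷ tabulate-pointwise (λ { i zero → refl ; i (suc k) → refl }))) ⟩
    - f (δ zero ∷ insert0 zero (δ j) ∷ tabulate (insert0 zero ∘ insert0 j ∘ δ))
      ≡⟨ ≡.cong (λ w → - f (δ zero ∷ insert0 zero (δ j) ∷ w)) (≡.trans (tabulate-∘ (insert0 zero) (insert0 j ∘ δ))
           (≡.cong (map (insert0 zero)) (tabulate-∘ (insert0 j) δ))) ⟩
    - f (δ zero ∷ map (insert0 zero) (δ j ∷ map (insert0 j) (ident n)))
      ≈⟨ -‿cong (front-row n (alternating-map (suc n) (insert0-linear zero) (alt (δ zero))) j) ⟩
    - (sign j * f (δ zero ∷ map (insert0 zero) (ident (suc n))))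
      ≈⟨ -‿cong (*-congˡ (trans (front-row (suc n) {f} all zero) (*-identityˡ _))) ⟩
    - (sign j * f (ident (suc (suc n))))
      ≈⟨ -‿distribˡ-* _ _ ⟩
    sign (suc j) * f (ident (suc (suc n))) ∎
    where
    zero-row : ∀ {n} (j : Fin (suc n)) k → insertAt (λ _ → 0#) j 0# k ≈ 0#
    zero-row zero zero = refl
    zero-row zero (suc k) = refl
    zero-row {suc n} (suc j) zero = refl
    zero-row {suc n} (suc j) (suc k) = zero-row j k

  -- Expand the first row in the basis δ j and clear column j below it: what is left is an
  -- alternating map of n rows of length n, to which induction applies. The product rule and the
  -- factorisation of block determinants are both obtained by choosing f.
  det-unique : ∀ n {f : Vec (Row (Fin n)) n → Carrier} → Alternating n f →
    ∀ w → f w ≈ f (ident n) * det w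
  det-unique zero    alt [] = sym (*-identityʳ _)
  det-unique (suc n) {f} all@(lin , alt , _) (r ∷ w) = begin
    f (r ∷ w)
      ≈⟨ δ-expand (lin w) r ⟩
    ∑ (λ j → r j * f (δ j ∷ w))
      ≈⟨ ∑-cong (λ j → trans (*-congˡ (minor j)) (rearrange (r j) (sign j) (f (ident (suc n))) _)) ⟩
    ∑ (λ j → f (ident (suc n)) * (sign j * (r j * det (map (λ v → removeAt v j) w))))
      ≈⟨ *-∑ (f (ident (suc n))) (λ j → sign j * (r j * det (map (λ v → removeAt v j) w))) ⟨
    f (ident (suc n)) * det (r ∷ w) ∎
    where
    rearrange : ∀ x s a d → x * ((s * a) * d) ≈ a * (s * (x * d))
    rearrange = solve 4 (λ x s a d → x :* ((s :* a) :* d) := a :* (s :* (x :* d))) refl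

    minor : ∀ j → f (δ j ∷ w) ≈ (sign j * f (ident (suc n))) * det (map (λ v → removeAt v j) w)
    minor j = begin
      f (δ j ∷ w)
        ≈⟨ kills-map n (alt (δ j)) (kills-head n all (δ j)) (λ u → - u j) w ⟨
      f (δ j ∷ map (λ u k → u k + - u j * δ j k) w)
        ≈⟨ alternating-cong (suc n) all (≋-refl ∷ map-pointwise (clear-column j) w) ⟨
      f (δ j ∷ map (λ u → insert0 j (removeAt u j)) w)
        ≡⟨ ≡.cong (λ w → f (δ j ∷ w)) (map-∘ (insert0 j) (λ u → removeAt u j) w) ⟩
      f (δ j ∷ map (insert0 j) (map (λ u → removeAt u j) w))
        ≈⟨ det-unique n (alternating-map n (insert0-linear j) (alt (δ j))) _ ⟩
      f (δ j ∷ map (insert0 j) (ident n)) * det (map (λ u → removeAt u j) w)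
        ≈⟨ *-congʳ (front-row n all j) ⟩
      (sign j * f (ident (suc n))) * det (map (λ v → removeAt v j) w) ∎

  Matrix : ℕ → Set c
  Matrix n = Fin n → Row (Fin n)

  ⟦_⟧ : ∀ {n} → Matrix n → Carrier
  ⟦ A ⟧ = det (tabulate A)

  det-cong : ∀ {n} {A B : Matrix n} → (∀ i → A i ≋ B i) → ⟦ A ⟧ ≈ ⟦ B ⟧
  det-cong {n} h = alternating-cong n (det-alternating n) (tabulate-pointwise h)

  det-δ : ∀ n → ⟦ δ {n} ⟧ ≈ 1#
  det-δ zero    = refl
  det-δ (suc n) = begin
    det (ident (suc n))
      ≈⟨ ∑-suc ⟩
    1# * (1# * det (map first-removed (tabulate (δ ∘ suc)))) + _
      ≈⟨ +-cong (trans (*-identityˡ _) (*-identityˡ _)) (∑≈0 (λ j → trans (*-congˡ (zeroˡ _)) (zeroʳ _))) ⟩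
    det (map first-removed (tabulate (δ ∘ suc))) + 0#
      ≈⟨ +-identityʳ _ ⟩
    det (map first-removed (tabulate (δ ∘ suc)))
      ≡⟨ ≡.cong det (tabulate-∘ first-removed (δ ∘ suc)) ⟨
    ⟦ δ {n} ⟧
      ≈⟨ det-δ n ⟩
    1# ∎
    where
    first-removed : Row (Fin (suc n)) → Row (Fin n)
    first-removed v = removeAt v zero

  infixl 7 _⊡_
  _⊡_ : ∀ {I J : Set} {n} → (I → Row (Fin n)) → (Fin n → Row J) → I → Row J
  (A ⊡ B) i k = ∑ (λ j → A i j * B j k)

  -- For fixed B the determinant of A B is alternating in the rows of A, hence det A times its value
  -- at the identity matrix.
  det-* : ∀ {n} (A B : Matrix n) → ⟦ A ⊡ B ⟧ ≈ ⟦ A ⟧ * ⟦ B ⟧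
  det-* {n} A B = begin
    det (tabulate (λ i → row (A i)))
      ≡⟨ ≡.cong det (tabulate-∘ row A) ⟩
    det (map row (tabulate A))
      ≈⟨ det-unique n (alternating-map n
           (λ k → linear-sum (λ j → linear-cong (λ u → *-comm _ _) (linear-scale (B j k) (coordinate-linear j))))
           (det-alternating n)) (tabulate A) ⟩
    det (map row (ident n)) * ⟦ A ⟧
      ≡⟨ ≡.cong (λ w → det w * ⟦ A ⟧) (tabulate-∘ row δ) ⟨
    ⟦ δ ⊡ B ⟧ * ⟦ A ⟧
      ≈⟨ *-congʳ (det-cong (λ i k → sum-δ i (λ j → B j k))) ⟩
    ⟦ B ⟧ * ⟦ A ⟧
      ≈⟨ *-comm _ _ ⟩
    ⟦ A ⟧ * ⟦ B ⟧ ∎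
    where
    row : Row (Fin n) → Row (Fin n)
    row r k = ∑ (λ j → r j * B j k)

  -- The relabelled matrix is P A Q for the 0-1 matrices P and Q of f and its transpose; injectivity
  -- of f becomes P Q = I.
  det-relabel : ∀ {n} (A : Matrix n) (f : Fin n → Fin n) → (∀ {i j} → f i ≡ f j → i ≡ j) →
    ⟦ (λ i j → A (f i) (f j)) ⟧ ≈ ⟦ A ⟧
  det-relabel {n} A f inj = begin
    ⟦ (λ i j → A (f i) (f j)) ⟧
      ≈⟨ det-cong (λ i j → sym (trans (sum-δʳ (f j) (λ k → (P ⊡ A) i k)) (sum-δ (f i) (λ l → A l (f j))))) ⟩
    ⟦ (P ⊡ A) ⊡ Q ⟧
      ≈⟨ trans (det-* (P ⊡ A) Q) (*-congʳ (det-* P A)) ⟩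
    ⟦ P ⟧ * ⟦ A ⟧ * ⟦ Q ⟧
      ≈⟨ solve 3 (λ p a q → p :* a :* q := p :* q :* a) refl ⟦ P ⟧ ⟦ A ⟧ ⟦ Q ⟧ ⟩
    ⟦ P ⟧ * ⟦ Q ⟧ * ⟦ A ⟧
      ≈⟨ *-congʳ (sym (det-* P Q)) ⟩
    ⟦ P ⊡ Q ⟧ * ⟦ A ⟧
      ≈⟨ *-congʳ (trans (det-cong (λ i j → trans (sum-δ (f i) (λ l → δ l (f j))) (δ-injective f inj i j))) (det-δ n)) ⟩
    1# * ⟦ A ⟧
      ≈⟨ *-identityˡ _ ⟩
    ⟦ A ⟧ ∎
    where
    P Q : Matrix n
    P i l = δ (f i) l
    Q l j = δ l (f j)

  -- Block determinants and Sylvester's identity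

  alternating-prefix : ∀ {I} a {d} {f : Vec (Row I) (a ℕ.+ d) → Carrier} → Alternating (a ℕ.+ d) f →
    (T : Vec (Row I) a) → Alternating d (λ w → f (T ++ w))
  alternating-prefix zero    alt []                = alt
  alternating-prefix (suc a) (_ , alt , _) (t ∷ T) = alternating-prefix a (alt t) T

  alternating-suffix : ∀ {I} a {d} {f : Vec (Row I) (a ℕ.+ d) → Carrier} → Alternating (a ℕ.+ d) f →
    (B : Vec (Row I) d) → Alternating a (λ w → f (w ++ B))
  alternating-suffix zero    alt B = ttₚ
  alternating-suffix {I} (suc a) {d} {f} (lin , alt , twins) B =
    (λ w → lin (w ++ B)) , (λ v → alternating-suffix a (alt v) B) , twins′ a f twins
    where
    twins′ : ∀ a (f : Vec (Row I) (suc a ℕ.+ d) → Carrier) →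
      VanishesOnTwins (a ℕ.+ d) f → VanishesOnTwins a (λ w → f (w ++ B))
    twins′ zero    f h     = ttₚ
    twins′ (suc a) f h v w = h v (w ++ B)

  kills-prefix : ∀ {I} a {d} {f : Vec (Row I) (a ℕ.+ d) → Carrier} → Alternating (a ℕ.+ d) f →
    (τ : Fin a → Row I) → ∀ j → Kills (λ (w : Vec (Row I) d) → f (tabulate τ ++ w)) (τ j)
  kills-prefix (suc a) {d} {f} alt τ zero w i eq =
    kills-head (a ℕ.+ d) {f} alt (τ zero) (tabulate (τ ∘ suc) ++ w) (a ↑ʳ i)
      (≡.trans (lookup-++ʳ (tabulate (τ ∘ suc)) w i) eq)
  kills-prefix (suc a) (_ , alt , _) τ (suc j) = kills-prefix a (alt (τ zero)) (τ ∘ suc) j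

  add-suffix : ∀ {I} a {d} {f : Vec (Row I) (a ℕ.+ d) → Carrier} → Alternating (a ℕ.+ d) f →
    (τ : Fin a → Row I) (β : Fin d → Row I) (u : Fin a → Fin d → Carrier) →
    f (tabulate (λ x k → τ x k + ∑ (λ i → u x i * β i k)) ++ tabulate β) ≈ f (tabulate τ ++ tabulate β)
  add-suffix zero    alt τ β u = refl
  add-suffix {I} (suc a) {d} {f} all@(lin , alt , _) τ β u = begin
    f ((λ k → τ zero k + ∑ (λ i → u zero i * β i k)) ∷ w)
      ≈⟨ Linear.add (lin w) _ _ ⟩
    f (τ zero ∷ w) + f ((λ k → ∑ (λ i → u zero i * β i k)) ∷ w)
      ≈⟨ +-congˡ (trans (Linear.combination (lin w) _ _) (∑≈0 (λ i → trans (*-congˡ (killed i)) (zeroʳ _)))) ⟩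
    f (τ zero ∷ w) + 0#
      ≈⟨ +-identityʳ _ ⟩
    f (τ zero ∷ w)
      ≈⟨ add-suffix a (alt (τ zero)) (τ ∘ suc) β (u ∘ suc) ⟩
    f (tabulate τ ++ tabulate β) ∎
    where
    tops : Vec (Row I) a
    tops = tabulate (λ x k → τ (suc x) k + ∑ (λ i → u (suc x) i * β i k))
    w : Vec (Row I) (a ℕ.+ d)
    w = tops ++ tabulate β
    killed : ∀ i → f (β i ∷ w) ≈ 0#
    killed i = kills-head (a ℕ.+ d) {f} all (β i) w (a ↑ʳ i)
      (≡.trans (lookup-++ʳ tops (tabulate β) i) (lookup∘tabulate β i))

  -- Columns are indexed by a sum type, so that block rows are written by cases. Only `join` sees
  -- the flattening to `Fin (a ℕ.+ d)`.
  module Blocks (a d : ℕ) where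
    BlockRow : Set c
    BlockRow = Row (Fin a ⊎ Fin d)

    left : Row (Fin a) → BlockRow
    left u = [ u , (λ _ → 0#) ]′

    right : Row (Fin d) → BlockRow
    right u = [ (λ _ → 0#) , u ]′

    zero-linear : ∀ {I} → Linear {I} (λ _ → 0#)
    zero-linear = record
      { cong = λ _ → refl ; add = λ _ _ → sym (+-identityˡ _) ; scale = λ a _ → sym (zeroʳ a) }

    left-linear : LinearMap left
    left-linear (inj₁ x) = coordinate-linear x
    left-linear (inj₂ i) = zero-linear

    right-linear : LinearMap right
    right-linear (inj₁ x) = zero-linear
    right-linear (inj₂ i) = coordinate-linear i

    join : BlockRow → Row (Fin (a ℕ.+ d))
    join u = u ∘ splitAt a

    blockdet : (Fin a → BlockRow) → (Fin d → BlockRow) → Carrier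
    blockdet τ β = det (map join (tabulate τ ++ tabulate β))

    private
      D : Vec BlockRow (a ℕ.+ d) → Carrier
      D w = det (map join w)

      D-alternating : Alternating (a ℕ.+ d) D
      D-alternating = alternating-map (a ℕ.+ d) {det} (λ k → coordinate-linear (splitAt a k))
        (det-alternating (a ℕ.+ d))

    blockdet-cong : ∀ {τ τ′ β β′} → (∀ x → τ x ≋ τ′ x) → (∀ i → β i ≋ β′ i) →
      blockdet τ β ≈ blockdet τ′ β′
    blockdet-cong h k = alternating-cong (a ℕ.+ d) {D} D-alternating
      (Pointwise.++⁺ (tabulate-pointwise h) (tabulate-pointwise k))

    add-bottom : ∀ τ β (u : Fin a → Fin d → Carrier) →
      blockdet (λ x k → τ x k + ∑ (λ i → u x i * β i k)) β ≈ blockdet τ β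
    add-bottom = add-suffix a {d} {D} D-alternating

    add-top : ∀ τ β (u : Fin d → Fin a → Carrier) →
      blockdet τ (λ i k → β i k + ∑ (λ x → u i x * τ x k)) ≈ blockdet τ β
    add-top τ = kills-add d {λ w → D (tabulate τ ++ w)}
      (alternating-prefix a {d} {D} D-alternating (tabulate τ)) τ
      (kills-prefix a {d} {D} D-alternating τ)

    scale-top : ∀ t τ β → blockdet (λ x k → t * τ x k) β ≈ t ^ a * blockdet τ β
    scale-top t τ β = scale-rows a {λ w → D (w ++ tabulate β)}
      (alternating-suffix a {d} {D} D-alternating (tabulate β)) t τ

    scale-bottom : ∀ t τ β → blockdet τ (λ i k → t * β i k) ≈ t ^ d * blockdet τ β
    scale-bottom t τ β = scale-rows d {λ w → D (tabulate τ ++ w)}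
      (alternating-prefix a {d} {D} D-alternating (tabulate τ)) t β

    factor-left : ∀ A β → blockdet (left ∘ A) β ≈ blockdet (left ∘ δ) β * ⟦ A ⟧
    factor-left A β = begin
      D (tabulate (left ∘ A) ++ tabulate β)
        ≡⟨ ≡.cong (λ w → D (w ++ tabulate β)) (tabulate-∘ left A) ⟩
      D (map left (tabulate A) ++ tabulate β)
        ≈⟨ det-unique a {λ w → D (map left w ++ tabulate β)} (alternating-map a left-linear
             (alternating-suffix a {d} {D} D-alternating (tabulate β))) (tabulate A) ⟩
      D (map left (ident a) ++ tabulate β) * ⟦ A ⟧
        ≡⟨ ≡.cong (λ w → D (w ++ tabulate β) * ⟦ A ⟧) (tabulate-∘ left δ) ⟨
      blockdet (left ∘ δ) β * ⟦ A ⟧ ∎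

    factor-right : ∀ τ B → blockdet τ (right ∘ B) ≈ blockdet τ (right ∘ δ) * ⟦ B ⟧
    factor-right τ B = begin
      D (tabulate τ ++ tabulate (right ∘ B))
        ≡⟨ ≡.cong (λ w → D (tabulate τ ++ w)) (tabulate-∘ right B) ⟩
      D (tabulate τ ++ map right (tabulate B))
        ≈⟨ det-unique d {λ w → D (tabulate τ ++ map right w)} (alternating-map d right-linear
             (alternating-prefix a {d} {D} D-alternating (tabulate τ))) (tabulate B) ⟩
      D (tabulate τ ++ map right (ident d)) * ⟦ B ⟧
        ≡⟨ ≡.cong (λ w → D (tabulate τ ++ w) * ⟦ B ⟧) (tabulate-∘ right δ) ⟨
      blockdet τ (right ∘ δ) * ⟦ B ⟧ ∎

  module _ where
    open Blocks

    private
      left-δ : ∀ a {d} (x : Fin a) (k : Fin (a ℕ.+ d)) → left a d (δ x) (splitAt a k) ≈ δ (x ↑ˡ d) k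
      left-δ (suc a) zero    zero = refl
      left-δ (suc a) zero    (suc k) with splitAt a k
      ... | inj₁ _ = refl
      ... | inj₂ _ = refl
      left-δ (suc a) (suc x) zero = refl
      left-δ (suc a) (suc x) (suc k) with splitAt a k | left-δ a x k
      ... | inj₁ _ | eq = eq
      ... | inj₂ _ | eq = eq

      right-δ : ∀ a {d} (i : Fin d) (k : Fin (a ℕ.+ d)) → right a d (δ i) (splitAt a k) ≈ δ (a ↑ʳ i) k
      right-δ zero    i k    = refl
      right-δ (suc a) i zero = refl
      right-δ (suc a) i (suc k) with splitAt a k | right-δ a i k
      ... | inj₁ _ | eq = eq
      ... | inj₂ _ | eq = eq

      tabulate-++ : ∀ {A : Set c} a {d} (f : Fin (a ℕ.+ d) → A) →
        tabulate (λ x → f (x ↑ˡ d)) ++ tabulate (λ i → f (a ↑ʳ i)) ≡ tabulate f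
      tabulate-++ zero    f = ≡.refl
      tabulate-++ (suc a) f = ≡.cong (f zero ∷_) (tabulate-++ a (f ∘ suc))

    blockdet-δ : ∀ a d → blockdet a d (left a d ∘ δ) (right a d ∘ δ) ≈ 1#
    blockdet-δ a d = begin
      det (map (join a d) (tabulate (left a d ∘ δ) ++ tabulate (right a d ∘ δ)))
        ≡⟨ ≡.cong det (map-++ (join a d) (tabulate (left a d ∘ δ)) _) ⟩
      det (map (join a d) (tabulate (left a d ∘ δ)) ++ map (join a d) (tabulate (right a d ∘ δ)))
        ≡⟨ ≡.cong₂ (λ v w → det (v ++ w)) (tabulate-∘ (join a d) (left a d ∘ δ))
                                          (tabulate-∘ (join a d) (right a d ∘ δ)) ⟨
      det (tabulate (join a d ∘ left a d ∘ δ) ++ tabulate (join a d ∘ right a d ∘ δ))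
        ≈⟨ alternating-cong (a ℕ.+ d) {det} (det-alternating (a ℕ.+ d))
             (Pointwise.++⁺ (tabulate-pointwise {B = tops} (left-δ a))
                            (tabulate-pointwise {B = bottoms} (right-δ a))) ⟩
      det (tabulate tops ++ tabulate bottoms)
        ≡⟨ ≡.cong det (tabulate-++ a δ) ⟩
      ⟦ δ {a ℕ.+ d} ⟧
        ≈⟨ det-δ (a ℕ.+ d) ⟩
      1# ∎
      where
      tops : Fin a → Row (Fin (a ℕ.+ d))
      tops x = δ (x ↑ˡ d)
      bottoms : Fin d → Row (Fin (a ℕ.+ d))
      bottoms i = δ (a ↑ʳ i)

  -- Both sides are computed from the block matrix with rows (t I , - U) and
  -- (V , I), clearing one off-diagonal block or the other.
  sylvester : ∀ {a d} t (U : Fin a → Row (Fin d)) (V : Fin d → Row (Fin a)) →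
    t ^ d * ⟦ (λ x y → t * δ x y + (U ⊡ V) x y) ⟧ ≈ t ^ a * ⟦ (λ i j → t * δ i j + (V ⊡ U) i j) ⟧
  sylvester {a} {d} t U V = begin
    t ^ d * ⟦ P ⟧                      ≈⟨ *-congˡ clear-right ⟨
    t ^ d * blockdet top bottom        ≈⟨ scale-bottom t top bottom ⟨
    blockdet top (λ i k → t * bottom i k)
      -- The bottom rows carry the factor t because clearing V would otherwise divide by t: t (V ,
      -- I) = (0 , Q) + V (t I , - U) with Q = t I + V U.
      ≈⟨ blockdet-cong (λ x → ≋-refl) scaled-bottom ⟩
    blockdet top (λ i k → right (Q i) k + ∑ (λ y → V i y * top y k))
      ≈⟨ add-top top (right ∘ Q) V ⟩
    blockdet top (right ∘ Q)           ≈⟨ factor-right top Q ⟩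
    blockdet top (right ∘ δ) * ⟦ Q ⟧   ≈⟨ *-congʳ (add-bottom top (right ∘ δ) U) ⟨
    blockdet (λ x k → top x k + ∑ (λ i → U x i * right (δ i) k)) (right ∘ δ) * ⟦ Q ⟧
      ≈⟨ *-congʳ (blockdet-cong cleared-top (λ i → ≋-refl)) ⟩
    blockdet (λ x k → t * left (δ x) k) (right ∘ δ) * ⟦ Q ⟧
      ≈⟨ *-congʳ (scale-top t (left ∘ δ) (right ∘ δ)) ⟩
    t ^ a * blockdet (left ∘ δ) (right ∘ δ) * ⟦ Q ⟧
      ≈⟨ *-congʳ (trans (*-congˡ (blockdet-δ a d)) (*-identityʳ _)) ⟩
    t ^ a * ⟦ Q ⟧ ∎
    where
    open Blocks a d
    P : Matrix a
    P x y = t * δ x y + (U ⊡ V) x y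
    Q : Matrix d
    Q i j = t * δ i j + (V ⊡ U) i j
    top : Fin a → BlockRow
    top x = [ (λ y → t * δ x y) , (λ i → - U x i) ]′
    bottom : Fin d → BlockRow
    bottom i = [ V i , δ i ]′

    clear-right : blockdet top bottom ≈ ⟦ P ⟧
    clear-right = begin
      blockdet top bottom
        ≈⟨ add-bottom top bottom U ⟨
      blockdet (λ x k → top x k + ∑ (λ i → U x i * bottom i k)) bottom
        ≈⟨ blockdet-cong (λ { x (inj₁ y) → refl
                            ; x (inj₂ i) → trans (+-congˡ (sum-δʳ i (U x))) (-‿inverseˡ _) })
                         (λ i → ≋-refl) ⟩
      blockdet (left ∘ P) bottom
        ≈⟨ factor-left P bottom ⟩
      blockdet (left ∘ δ) bottom * ⟦ P ⟧
        ≈⟨ *-congʳ (blockdet-cong (λ x → ≋-refl)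
             (λ { i (inj₁ y) → sym (trans (+-identityˡ _) (sum-δʳ y (V i)))
                ; i (inj₂ j) → sym (trans (+-congˡ (∑≈0 (λ y → zeroʳ _))) (+-identityʳ _)) })) ⟩
      blockdet (left ∘ δ) (λ i k → right (δ i) k + ∑ (λ y → V i y * left (δ y) k)) * ⟦ P ⟧
        ≈⟨ *-congʳ (trans (add-top (left ∘ δ) (right ∘ δ) V) (blockdet-δ a d)) ⟩
      1# * ⟦ P ⟧
        ≈⟨ *-identityˡ _ ⟩
      ⟦ P ⟧ ∎

    scaled-bottom : ∀ i → (λ k → t * bottom i k) ≋ (λ k → right (Q i) k + ∑ (λ y → V i y * top y k))
    scaled-bottom i (inj₁ z) = begin
      t * V i z                             ≈⟨ *-congˡ (sum-δʳ z (V i)) ⟨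
      t * ∑ (λ y → V i y * δ y z)           ≈⟨ *-∑ t (λ y → V i y * δ y z) ⟩
      ∑ (λ y → t * (V i y * δ y z))
        ≈⟨ ∑-cong (λ y → solve 3 (λ t v e → t :* (v :* e) := v :* (t :* e)) refl t (V i y) (δ y z)) ⟩
      ∑ (λ y → V i y * (t * δ y z))         ≈⟨ +-identityˡ _ ⟨
      0# + ∑ (λ y → V i y * (t * δ y z))    ∎
    scaled-bottom i (inj₂ j) = begin
      t * δ i j
        ≈⟨ solve 2 (λ x y → x := (x :+ y) :+ :- :1 :* y) refl (t * δ i j) (∑ (λ y → V i y * U y j)) ⟩
      Q i j + - 1# * ∑ (λ y → V i y * U y j)
        ≈⟨ +-congˡ (*-∑ (- 1#) (λ y → V i y * U y j)) ⟩
      Q i j + ∑ (λ y → - 1# * (V i y * U y j))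
        ≈⟨ +-congˡ (∑-cong (λ y → solve 2 (λ v u → :- :1 :* (v :* u) := v :* :- u) refl (V i y) (U y j))) ⟩
      Q i j + ∑ (λ y → V i y * - U y j) ∎

    cleared-top : ∀ x → (λ k → top x k + ∑ (λ i → U x i * right (δ i) k)) ≋ (λ k → t * left (δ x) k)
    cleared-top x (inj₁ y) = trans (+-congˡ (∑≈0 (λ i → zeroʳ _))) (+-identityʳ _)
    cleared-top x (inj₂ i) = trans (+-congˡ (sum-δʳ i (U x))) (trans (-‿inverseˡ _) (sym (zeroʳ t)))

-- Counting on Fin n

module Counting where
  open import Data.Nat using (_+_; _*_)
  open ≡ using (refl; sym; trans; cong; cong₂; subst)
  open FiniteSum ℕₚ.+-*-commutativeSemiring public

  bit : ∀ {P : Set} → Dec P → ℕ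
  bit d = if ⌊ d ⌋ then 1 else 0

  bit-yes : ∀ {P : Set} (d : Dec P) → P → bit d ≡ 1
  bit-yes (yes _) p = refl
  bit-yes (no ¬p) p = contradiction p ¬p

  bit-no : ∀ {P : Set} (d : Dec P) → ¬ P → bit d ≡ 0
  bit-no (yes p) ¬p = contradiction p ¬p
  bit-no (no _)  ¬p = refl

  bit-cong : ∀ {P Q : Set} (d : Dec P) (e : Dec Q) → (P → Q) → (Q → P) → bit d ≡ bit e
  bit-cong (yes p) e f g = sym (bit-yes e (f p))
  bit-cong (no ¬p) e f g = sym (bit-no e (¬p ∘ g))

  bit-× : ∀ {P Q : Set} (d : Dec P) (e : Dec Q) → bit d * bit e ≡ bit (d ×-dec e)
  bit-× (yes p) (yes q) = refl
  bit-× (yes p) (no ¬q) = refl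
  bit-× (no ¬p) e       = refl

  count : ∀ {n} {P : Fin n → Set} → (∀ i → Dec (P i)) → ℕ
  count P? = ∑ (λ i → bit (P? i))

  count-cong : ∀ {n} {P Q : Fin n → Set} (P? : ∀ i → Dec (P i)) (Q? : ∀ i → Dec (Q i)) →
    (∀ i → P i → Q i) → (∀ i → Q i → P i) → count P? ≡ count Q?
  count-cong P? Q? f g = ∑-cong (λ i → bit-cong (P? i) (Q? i) (f i) (g i))

  count-bijection : ∀ {n} {P : Fin n → Set} (P? : ∀ i → Dec (P i)) (f g : Fin n → Fin n) →
    (∀ i → f (g i) ≡ i) → (∀ i → g (f i) ≡ i) → count (λ i → P? (f i)) ≡ count P?
  count-bijection P? f g fg gf = sym (∑-permute (λ i → bit (P? i)) (permutation f g fg gf))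

  count-none : ∀ {n} {P : Fin n → Set} (P? : ∀ i → Dec (P i)) → (∀ i → ¬ P i) → count P? ≡ 0
  count-none P? h = ∑≈0 (λ i → bit-no (P? i) (h i))

  ∑≡0⇒≡0 : ∀ {n} (f : Fin n → ℕ) → ∑ f ≡ 0 → ∀ i → f i ≡ 0
  ∑≡0⇒≡0 f h zero    = ℕₚ.m+n≡0⇒m≡0 (f zero) (trans (sym ∑-suc) h)
  ∑≡0⇒≡0 f h (suc i) = ∑≡0⇒≡0 (f ∘ suc) (ℕₚ.m+n≡0⇒n≡0 (f zero) (trans (sym ∑-suc) h)) i

  count≡0⇒none : ∀ {n} {P : Fin n → Set} (P? : ∀ i → Dec (P i)) → count P? ≡ 0 → ∀ i → ¬ P i
  count≡0⇒none P? h i p with () ← trans (sym (bit-yes (P? i) p)) (∑≡0⇒≡0 (λ i → bit (P? i)) h i)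

  count-split : ∀ {n} {P Q : Fin n → Set} (P? : ∀ i → Dec (P i)) (Q? : ∀ i → Dec (Q i)) →
    count P? ≡ count (λ i → P? i ×-dec Q? i) + count (λ i → P? i ×-dec ¬? (Q? i))
  count-split P? Q? = trans (∑-cong (λ i → split (P? i) (Q? i))) (∑-+ _ _)
    where
    split : ∀ {P Q : Set} (d : Dec P) (e : Dec Q) → bit d ≡ bit (d ×-dec e) + bit (d ×-dec ¬? e)
    split (yes p) (yes q) = refl
    split (yes p) (no ¬q) = refl
    split (no ¬p) e       = refl

  -- Splitting Q along P leaves a remainder of count 0. This is the pigeonhole step behind
  -- `nonsquare*nonsquare`.
  count-antisym : ∀ {n} {P Q : Fin n → Set} (P? : ∀ i → Dec (P i)) (Q? : ∀ i → Dec (Q i)) →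
    (∀ i → P i → Q i) → count P? ≡ count Q? → ∀ i → Q i → P i
  count-antisym P? Q? P⊆Q eq i q with P? i
  ... | yes p = p
  ... | no ¬p = contradiction (q , ¬p) (count≡0⇒none (λ i → Q? i ×-dec ¬? (P? i))
    (sym (ℕₚ.+-cancelˡ-≡ (count P?) 0 _ (begin
      count P? + 0   ≡⟨ ℕₚ.+-identityʳ _ ⟩
      count P?       ≡⟨ eq ⟩
      count Q?       ≡⟨ count-split Q? P? ⟩
      count (λ i → Q? i ×-dec P? i) + _
        ≡⟨ cong (_+ count (λ i → Q? i ×-dec ¬? (P? i)))
             (count-cong (λ i → Q? i ×-dec P? i) P? (λ i → proj₂) (λ i p → P⊆Q i p , p)) ⟩
      count P? + count (λ i → Q? i ×-dec ¬? (P? i)) ∎))) i)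
    where open ≡.≡-Reasoning

  count-≡ : ∀ {n} (i : Fin n) → count (λ j → i ≟ᶠ j) ≡ 1
  count-≡ zero    = trans ∑-suc (cong suc (∑≈0 (λ j → refl)))
  count-≡ (suc i) = trans ∑-suc (trans
    (∑-cong (λ j → bit-cong (suc i ≟ᶠ suc j) (i ≟ᶠ j) (λ { refl → refl }) (cong suc))) (count-≡ i))

  -- The points moved by an involution are paired up.
  count-involution : ∀ {n} {P : Fin n → Set} (P? : ∀ i → Dec (P i)) (σ : Fin n → Fin n) →
    (∀ i → σ (σ i) ≡ i) → (∀ i → P i → P (σ i)) →
    ∃ λ k → count P? ≡ count (λ i → P? i ×-dec (σ i ≟ᶠ i)) + (k + k)
  count-involution {P = P} P? σ σσ Pσ = count up? , (begin
    count P?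
      ≡⟨ ∑-cong trichotomy ⟩
    ∑ (λ i → bit (fixed? i) + (bit (up? i) + bit (down? i)))
      ≡⟨ ∑-+ (λ i → bit (fixed? i)) (λ i → bit (up? i) + bit (down? i)) ⟩
    count fixed? + ∑ (λ i → bit (up? i) + bit (down? i))
      ≡⟨ cong (count fixed? +_) (∑-+ (λ i → bit (up? i)) (λ i → bit (down? i))) ⟩
    count fixed? + (count up? + count down?)
      ≡⟨ cong (λ k → count fixed? + (count up? + k)) (begin
           count down?            ≡⟨ count-cong down? (λ i → up? (σ i))
             (λ i (p , l) → Pσ i p , subst (σ i Fin.<_) (sym (σσ i)) l)
             (λ i (p , l) → subst P (σσ i) (Pσ (σ i) p) , subst (σ i Fin.<_) (σσ i) l) ⟩
           count (λ i → up? (σ i)) ≡⟨ count-bijection up? σ σ σσ σσ ⟩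
           count up?               ∎) ⟩
    count fixed? + (count up? + count up?) ∎)
    where
    open ≡.≡-Reasoning
    fixed? = λ i → P? i ×-dec (σ i ≟ᶠ i)
    up?    = λ i → P? i ×-dec (i <? σ i)
    down?  = λ i → P? i ×-dec (σ i <? i)
    trichotomy : ∀ i → bit (P? i) ≡ bit (fixed? i) + (bit (up? i) + bit (down? i))
    trichotomy i with P? i
    ... | no  _ = refl
    ... | yes p with <-cmp (σ i) i
    ...   | tri< a b c = sym (cong₂ _+_ (bit-no (yes p ×-dec (σ i ≟ᶠ i)) (b ∘ proj₂))
              (cong₂ _+_ (bit-no (yes p ×-dec (i <? σ i)) (c ∘ proj₂)) (bit-yes (yes p ×-dec (σ i <? i)) (p , a))))
    ...   | tri≈ a b c = sym (cong₂ _+_ (bit-yes (yes p ×-dec (σ i ≟ᶠ i)) (p , b))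
              (cong₂ _+_ (bit-no (yes p ×-dec (i <? σ i)) (c ∘ proj₂)) (bit-no (yes p ×-dec (σ i <? i)) (a ∘ proj₂))))
    ...   | tri> a b c = sym (cong₂ _+_ (bit-no (yes p ×-dec (σ i ≟ᶠ i)) (b ∘ proj₂))
              (cong₂ _+_ (bit-yes (yes p ×-dec (i <? σ i)) (p , c)) (bit-no (yes p ×-dec (σ i <? i)) (a ∘ proj₂))))

  ∑-const-* : ∀ n x → ∑ {n} (λ _ → x) ≡ n * x
  ∑-const-* zero    x = ∑-empty
  ∑-const-* (suc n) x = trans ∑-suc (cong (x +_) (∑-const-* n x))

  -- Double counting: multiply each term by 1, written as the number of j equal to `c i`, and
  -- exchange the sums.
  count-fibres : ∀ {n k} {P : Fin n → Set} (P? : ∀ i → Dec (P i)) (c : Fin n → Fin k) →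
    count P? ≡ ∑ (λ j → count (λ i → P? i ×-dec (c i ≟ᶠ j)))
  count-fibres P? c = begin
    ∑ (λ i → bit (P? i))
      ≡⟨ ∑-cong (λ i → trans (sym (ℕₚ.*-identityʳ _)) (cong (bit (P? i) *_) (sym (count-≡ (c i))))) ⟩
    ∑ (λ i → bit (P? i) * count (λ j → c i ≟ᶠ j))
      ≡⟨ ∑-cong (λ i → trans (*-∑ (bit (P? i)) _) (∑-cong (λ j → bit-× (P? i) (c i ≟ᶠ j)))) ⟩
    ∑ (λ i → ∑ (λ j → bit (P? i ×-dec (c i ≟ᶠ j))))
      ≡⟨ ∑-comm _ ⟩
    ∑ (λ j → count (λ i → P? i ×-dec (c i ≟ᶠ j))) ∎
    where open ≡.≡-Reasoning

  -- The adjacency matrix of the complete multipartite graph whose parts are the fibres of `class`.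
  distinct : ∀ {n k} → (Fin n → Fin k) → Fin n → Fin n → ℕ
  distinct class x y = bit (¬? (class x ≟ᶠ class y))

-- Determinants attached to complete multipartite graphs

module Multipartite {c ℓ} (R : CommutativeRing c ℓ) where
  open CommutativeRing R hiding (zero)
  open Algebra.Properties.Ring ring
  open Algebra.Properties.Semiring.Exp semiring
  open Algebra.Properties.Semiring.Mult semiring renaming (_×_ to _·_)
  open FiniteSum commutativeSemiring
  open Determinant R
  open Solver R
  open Relation.Binary.Reasoning.Setoid setoid
  open Counting using (bit; count; distinct)
  private module ℕΣ = Counting

  ⟪_⟫ : ℕ → Carrier
  ⟪ n ⟫ = n · 1#

  ⟪⟫-∑ : ∀ {n} (a : Fin n → ℕ) → ⟪ ℕΣ.∑ a ⟫ ≈ ∑ (λ i → ⟪ a i ⟫)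
  ⟪⟫-∑ {zero}  a = trans (reflexive (≡.cong ⟪_⟫ ℕΣ.∑-empty)) (sym ∑-empty)
  ⟪⟫-∑ {suc n} a = begin
    ⟪ ℕΣ.∑ a ⟫                              ≡⟨ ≡.cong ⟪_⟫ ℕΣ.∑-suc ⟩
    ⟪ a zero ℕ.+ ℕΣ.∑ (a ∘ suc) ⟫           ≈⟨ ×-homo-+ 1# (a zero) _ ⟩
    ⟪ a zero ⟫ + ⟪ ℕΣ.∑ (a ∘ suc) ⟫         ≈⟨ +-congˡ (⟪⟫-∑ (a ∘ suc)) ⟩
    ⟪ a zero ⟫ + ∑ (λ i → ⟪ a (suc i) ⟫)    ≈⟨ ∑-suc ⟨
    ∑ (λ i → ⟪ a i ⟫)                       ∎

  bit-δ : ∀ {n} (i j : Fin n) → ⟪ bit (i ≟ᶠ j) ⟫ ≈ δ i j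
  bit-δ i j with i ≟ᶠ j
  ... | yes ≡.refl = trans (+-identityʳ 1#) (sym (δ-refl i))
  ... | no  i≢j    = sym (δ-≢ i≢j)

  det-1×1 : ∀ (A : Matrix 1) → ⟦ A ⟧ ≈ A zero zero
  det-1×1 A = trans ∑-suc (trans (+-congˡ ∑-empty)
    (solve 1 (λ x → :1 :* (x :* :1) :+ :0 := x) refl (A zero zero)))

  module _ {n k} (class : Fin n → Fin k) where
    distinct-δ : ∀ x y → ⟪ distinct class x y ⟫ ≈ 1# - δ (class x) (class y)
    distinct-δ x y with class x ≟ᶠ class y
    ... | yes eq = sym (trans (+-congˡ (-‿cong (trans (reflexive (≡.cong (δ (class x)) (≡.sym eq))) (δ-refl (class x)))))
                     (-‿inverseʳ 1#))
    ... | no  ne = +-congˡ (trans (sym -0#≈0#) (-‿cong (sym (δ-≢ ne))))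

    -- The first use of `sylvester` passes from n points to k classes, where V U = m β (J - I) and
    -- so α I + V U = γ I + m β J with γ = α - m β. The second passes from this rank-one
    -- perturbation to the 1 × 1 matrix γ + k m β. The prefactors γ and α^k are the powers that the
    -- two uses leave behind; neither α nor γ is assumed to be cancellable.
    multipartite-det : ∀ {m} → (∀ j → count (λ x → class x ≟ᶠ j) ≡ m) → ∀ α β →
      (α - ⟪ m ⟫ * β) * α ^ k * ⟦ (λ x y → α * δ x y + β * ⟪ distinct class x y ⟫) ⟧ ≈
      α ^ n * ((α - ⟪ m ⟫ * β) ^ k * (α - ⟪ m ⟫ * β + ⟪ k ⟫ * (⟪ m ⟫ * β)))
    multipartite-det {m} fibre α β = begin
      γ * α ^ k * ⟦ (λ x y → α * δ x y + β * ⟪ distinct class x y ⟫) ⟧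
        ≈⟨ *-assoc _ _ _ ⟩
      γ * (α ^ k * ⟦ (λ x y → α * δ x y + β * ⟪ distinct class x y ⟫) ⟧)
        ≈⟨ *-congˡ (*-congˡ (det-cong (λ x y → +-congˡ (sym (UV x y))))) ⟩
      γ * (α ^ k * ⟦ (λ x y → α * δ x y + (U ⊡ V) x y) ⟧)
        ≈⟨ *-congˡ (sylvester α U V) ⟩
      γ * (α ^ n * ⟦ (λ i j → α * δ i j + (V ⊡ U) i j) ⟧)
        ≈⟨ solve 3 (λ γ a d → γ :* (a :* d) := a :* (γ :* :1 :* d)) refl γ (α ^ n) _ ⟩
      α ^ n * (γ ^ 1 * ⟦ (λ i j → α * δ i j + (V ⊡ U) i j) ⟧)
        ≈⟨ *-congˡ (*-congˡ (det-cong rank-one)) ⟩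
      α ^ n * (γ ^ 1 * ⟦ (λ i j → γ * δ i j + (W ⊡ ones) i j) ⟧)
        ≈⟨ *-congˡ (sylvester γ W ones) ⟩
      α ^ n * (γ ^ k * ⟦ (λ i j → γ * δ i j + (ones ⊡ W) i j) ⟧)
        ≈⟨ *-congˡ (*-congˡ (trans (det-1×1 (λ i j → γ * δ i j + (ones ⊡ W) i j)) (+-cong (*-identityʳ γ) total))) ⟩
      α ^ n * (γ ^ k * (γ + ⟪ k ⟫ * (⟪ m ⟫ * β))) ∎
      where
      γ : Carrier
      γ = α - ⟪ m ⟫ * β
      U : Fin n → Row (Fin k)
      U x i = β * (1# - δ (class x) i)
      V : Fin k → Row (Fin n)
      V i y = δ (class y) i
      W : Fin k → Row (Fin 1)
      W i _ = ⟪ m ⟫ * β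
      ones : Fin 1 → Row (Fin k)
      ones _ j = 1#

      UV : ∀ x y → (U ⊡ V) x y ≈ β * ⟪ distinct class x y ⟫
      UV x y = begin
        ∑ (λ i → U x i * δ (class y) i)   ≈⟨ ∑-cong (λ i → *-comm _ _) ⟩
        ∑ (λ i → δ (class y) i * U x i)   ≈⟨ sum-δ (class y) (U x) ⟩
        β * (1# - δ (class x) (class y))  ≈⟨ *-congˡ (distinct-δ x y) ⟨
        β * ⟪ distinct class x y ⟫              ∎

      class-size : ∀ i → ∑ (λ x → δ (class x) i) ≈ ⟪ m ⟫
      class-size i = begin
        ∑ (λ x → δ (class x) i)                ≈⟨ ∑-cong (λ x → bit-δ (class x) i) ⟨
        ∑ (λ x → ⟪ bit (class x ≟ᶠ i) ⟫)       ≈⟨ ⟪⟫-∑ (λ x → bit (class x ≟ᶠ i)) ⟨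
        ⟪ count (λ x → class x ≟ᶠ i) ⟫         ≡⟨ ≡.cong ⟪_⟫ (fibre i) ⟩
        ⟪ m ⟫                                  ∎

      δ-substitute : ∀ (f : Fin k → Carrier) i j → δ i j * f i ≈ δ i j * f j
      δ-substitute f i j with i ≟ᶠ j
      ... | yes ≡.refl = refl
      ... | no  i≢j    = trans (trans (*-congʳ (δ-≢ i≢j)) (zeroˡ _)) (sym (trans (*-congʳ (δ-≢ i≢j)) (zeroˡ _)))

      VU : ∀ i j → (V ⊡ U) i j ≈ ⟪ m ⟫ * (β * (1# - δ i j))
      VU i j = begin
        ∑ (λ x → δ (class x) i * (β * (1# - δ (class x) j)))
          ≈⟨ ∑-cong (λ x → δ-substitute (λ l → β * (1# - δ l j)) (class x) i) ⟩
        ∑ (λ x → δ (class x) i * (β * (1# - δ i j)))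
          ≈⟨ ∑-* (β * (1# - δ i j)) (λ x → δ (class x) i) ⟨
        ∑ (λ x → δ (class x) i) * (β * (1# - δ i j))
          ≈⟨ *-congʳ (class-size i) ⟩
        ⟪ m ⟫ * (β * (1# - δ i j)) ∎

      rank-one : ∀ i j → α * δ i j + (V ⊡ U) i j ≈ γ * δ i j + (W ⊡ ones) i j
      rank-one i j = begin
        α * δ i j + (V ⊡ U) i j
          ≈⟨ +-congˡ (VU i j) ⟩
        α * δ i j + ⟪ m ⟫ * (β * (1# - δ i j))
          ≈⟨ solve 4 (λ a m b d → a :* d :+ m :* (b :* (:1 :- d)) := (a :- m :* b) :* d :+ (m :* b :* :1 :+ :0))
               refl α ⟪ m ⟫ β (δ i j) ⟩
        γ * δ i j + (⟪ m ⟫ * β * 1# + 0#)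
          ≈⟨ +-congˡ (trans ∑-suc (+-congˡ ∑-empty)) ⟨
        γ * δ i j + (W ⊡ ones) i j ∎

      total : (ones ⊡ W) zero zero ≈ ⟪ k ⟫ * (⟪ m ⟫ * β)
      total = begin
        ∑ {k} (λ i → 1# * (⟪ m ⟫ * β))   ≈⟨ ∑-* (⟪ m ⟫ * β) (λ i → 1#) ⟨
        ∑ {k} (λ i → 1#) * (⟪ m ⟫ * β)   ≈⟨ *-congʳ (∑-const k 1#) ⟩
        ⟪ k ⟫ * (⟪ m ⟫ * β)              ∎

-- Polynomials

module Polynomials {A : Set} (K : RawCR A)
  (K-isCommutativeRing : IsCommutativeRing _≡_ (RawCR._+_ K) (RawCR._*_ K) (RawCR.-_ K) (RawCR.0# K) (RawCR.1# K))
  where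

  open Poly K renaming (_+P_ to infixl 6 _+P_; _*P_ to infixl 7 _*P_; _^P_ to infixr 8 _^P_)

  scalars : CommutativeRing 0ℓ 0ℓ
  scalars = record { isCommutativeRing = K-isCommutativeRing }

  module 𝕂 where
    open CommutativeRing scalars public
    open Algebra.Properties.Ring ring public
    open FiniteSum commutativeSemiring public
    open Determinant scalars public
    open Multipartite scalars public
  open 𝕂 using (_+_; _*_; -_; 0#; 1#)
  private module 𝕂-Solver = Solver scalars
  open 𝕂-Solver

  -- A record, so that the two polynomials can be inferred from the type.
  infix 4 _≐_
  record _≐_ (p q : Pol) : Set where
    constructor coefficientwise
    field at : p ≈P q
  open _≐_ public

  coeff-+ : ∀ p q i → coeff (p +P q) i ≡ coeff p i + coeff q i
  coeff-+ []      q       i       = ≡.sym (𝕂.+-identityˡ _)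
  coeff-+ (a ∷ p) []      i       = ≡.sym (𝕂.+-identityʳ _)
  coeff-+ (a ∷ p) (b ∷ q) zero    = ≡.refl
  coeff-+ (a ∷ p) (b ∷ q) (suc i) = coeff-+ p q i

  coeff-scale : ∀ a p i → coeff (scale a p) i ≡ a * coeff p i
  coeff-scale a []      i       = ≡.sym (𝕂.zeroʳ a)
  coeff-scale a (b ∷ p) zero    = ≡.refl
  coeff-scale a (b ∷ p) (suc i) = coeff-scale a p i

  coeff-neg : ∀ p i → coeff (negP p) i ≡ - coeff p i
  coeff-neg p i = ≡.trans (coeff-scale (- 1#) p i) (𝕂.-1*x≈-x _)

  coeff-∷* : ∀ a p q i → coeff ((a ∷ p) *P q) i ≡ a * coeff q i + coeff (0# ∷ (p *P q)) i
  coeff-∷* a p q i = ≡.trans (coeff-+ (scale a q) _ i) (≡.cong (_+ _) (coeff-scale a q i))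

  private
    ≐-refl : ∀ {p} → p ≐ p
    ≐-refl = coefficientwise λ i → ≡.refl

    ≐-sym : ∀ {p q} → p ≐ q → q ≐ p
    ≐-sym h = coefficientwise λ i → ≡.sym (at h i)

    ≐-trans : ∀ {p q r} → p ≐ q → q ≐ r → p ≐ r
    ≐-trans h k = coefficientwise λ i → ≡.trans (at h i) (at k i)

    tail-≐ : ∀ {a b p q} → a ∷ p ≐ b ∷ q → p ≐ q
    tail-≐ h = coefficientwise λ i → at h (suc i)

    tail-zero : ∀ {a p} → a ∷ p ≐ [] → p ≐ []
    tail-zero h = coefficientwise λ i → at h (suc i)

    shift-cong : ∀ {p q} → p ≐ q → ∀ i → coeff (0# ∷ p) i ≡ coeff (0# ∷ q) i
    shift-cong h zero    = ≡.refl
    shift-cong h (suc i) = at h i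

    shift-+ : ∀ p q i → coeff (0# ∷ (p +P q)) i ≡ coeff (0# ∷ p) i + coeff (0# ∷ q) i
    shift-+ p q zero    = ≡.sym (𝕂.+-identityˡ _)
    shift-+ p q (suc i) = coeff-+ p q i

    shift-scale : ∀ a p i → coeff (0# ∷ scale a p) i ≡ a * coeff (0# ∷ p) i
    shift-scale a p zero    = ≡.sym (𝕂.zeroʳ a)
    shift-scale a p (suc i) = coeff-scale a p i

    shift-zero : ∀ {p} → p ≐ [] → ∀ i → coeff (0# ∷ p) i ≡ 0#
    shift-zero h zero    = ≡.refl
    shift-zero h (suc i) = at h i

    zero-* : ∀ {p} q → p ≐ [] → p *P q ≐ []
    zero-* {[]}    q h = ≐-refl
    zero-* {a ∷ p} q h = coefficientwise λ i → begin
      coeff ((a ∷ p) *P q) i                     ≡⟨ coeff-∷* a p q i ⟩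
      a * coeff q i + coeff (0# ∷ (p *P q)) i
        ≡⟨ ≡.cong₂ (λ x y → x * coeff q i + y) (at h 0) (shift-zero (zero-* q (tail-zero h)) i) ⟩
      0# * coeff q i + 0#                        ≡⟨ ≡.trans (𝕂.+-identityʳ _) (𝕂.zeroˡ _) ⟩
      0#                                         ∎
      where open ≡.≡-Reasoning

    *-cong : ∀ {p p′ q q′} → p ≐ p′ → q ≐ q′ → p *P q ≐ p′ *P q′
    *-cong {[]} {p′} {q} {q′} h k = ≐-sym (zero-* q′ (≐-sym h))
    *-cong {a ∷ p} {[]} {q} {q′} h k = zero-* q h
    *-cong {a ∷ p} {b ∷ p′} {q} {q′} h k = coefficientwise λ i → begin
      coeff ((a ∷ p) *P q) i                       ≡⟨ coeff-∷* a p q i ⟩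
      a * coeff q i + coeff (0# ∷ (p *P q)) i
        ≡⟨ ≡.cong₂ _+_ (≡.cong₂ _*_ (at h 0) (at k i)) (shift-cong (*-cong (tail-≐ h) k) i) ⟩
      b * coeff q′ i + coeff (0# ∷ (p′ *P q′)) i   ≡⟨ coeff-∷* b p′ q′ i ⟨
      coeff ((b ∷ p′) *P q′) i                     ∎
      where open ≡.≡-Reasoning

    distribʳ : ∀ r p q → (p +P q) *P r ≐ p *P r +P q *P r
    distribʳ r []      q       = ≐-refl
    distribʳ r (a ∷ p) []      = coefficientwise λ i → ≡.sym
      (≡.trans (coeff-+ ((a ∷ p) *P r) [] i) (𝕂.+-identityʳ _))
    distribʳ r (a ∷ p) (b ∷ q) = coefficientwise λ i → begin
      coeff (((a + b) ∷ (p +P q)) *P r) i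
        ≡⟨ coeff-∷* (a + b) (p +P q) r i ⟩
      (a + b) * coeff r i + coeff (0# ∷ ((p +P q) *P r)) i
        ≡⟨ ≡.cong (_ +_) (≡.trans (shift-cong (distribʳ r p q) i) (shift-+ (p *P r) (q *P r) i)) ⟩
      (a + b) * coeff r i + (coeff (0# ∷ (p *P r)) i + coeff (0# ∷ (q *P r)) i)
        ≡⟨ solve 5 (λ a b c x y → (a :+ b) :* c :+ (x :+ y) := (a :* c :+ x) :+ (b :* c :+ y)) ≡.refl
             a b (coeff r i) _ _ ⟩
      (a * coeff r i + coeff (0# ∷ (p *P r)) i) + (b * coeff r i + coeff (0# ∷ (q *P r)) i)
        ≡⟨ ≡.cong₂ _+_ (coeff-∷* a p r i) (coeff-∷* b q r i) ⟨
      coeff ((a ∷ p) *P r) i + coeff ((b ∷ q) *P r) i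
        ≡⟨ coeff-+ ((a ∷ p) *P r) ((b ∷ q) *P r) i ⟨
      coeff ((a ∷ p) *P r +P (b ∷ q) *P r) i ∎
      where open ≡.≡-Reasoning

    *-zeroʳ : ∀ p → p *P [] ≐ []
    *-zeroʳ []      = ≐-refl
    *-zeroʳ (a ∷ p) = coefficientwise (shift-zero (*-zeroʳ p))

    -- The mirror image of `coeff-∷*`: `_*P_` recurses on its left factor, and commutativity also
    -- needs the recursion on the right one.
    *-∷ : ∀ p b q i → coeff (p *P (b ∷ q)) i ≡ b * coeff p i + coeff (0# ∷ (p *P q)) i
    *-∷ [] b q zero    = ≡.sym (≡.trans (𝕂.+-identityʳ _) (𝕂.zeroʳ b))
    *-∷ [] b q (suc i) = ≡.sym (≡.trans (𝕂.+-identityʳ _) (𝕂.zeroʳ b))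
    *-∷ (a ∷ p) b q zero = ≡.trans (coeff-∷* a p (b ∷ q) zero) (≡.cong (_+ 0#) (𝕂.*-comm a b))
    *-∷ (a ∷ p) b q (suc i) = begin
      coeff ((a ∷ p) *P (b ∷ q)) (suc i)
        ≡⟨ coeff-∷* a p (b ∷ q) (suc i) ⟩
      a * coeff q i + coeff (p *P (b ∷ q)) i
        ≡⟨ ≡.cong (a * coeff q i +_) (*-∷ p b q i) ⟩
      a * coeff q i + (b * coeff p i + coeff (0# ∷ (p *P q)) i)
        ≡⟨ solve 3 (λ x y z → x :+ (y :+ z) := y :+ (x :+ z)) ≡.refl (a * coeff q i) _ _ ⟩
      b * coeff p i + (a * coeff q i + coeff (0# ∷ (p *P q)) i)
        ≡⟨ ≡.cong (b * coeff p i +_) (coeff-∷* a p q i) ⟨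
      b * coeff p i + coeff ((a ∷ p) *P q) i ∎
      where open ≡.≡-Reasoning

    *-comm : ∀ p q → p *P q ≐ q *P p
    *-comm []      q = ≐-sym (*-zeroʳ q)
    *-comm (a ∷ p) q = coefficientwise λ i → ≡.trans (coeff-∷* a p q i)
      (≡.trans (≡.cong (_ +_) (shift-cong (*-comm p q) i)) (≡.sym (*-∷ q a p i)))

    scale-* : ∀ a p q → scale a p *P q ≐ scale a (p *P q)
    scale-* a []      q = ≐-refl
    scale-* a (b ∷ p) q = coefficientwise λ i → begin
      coeff (((a * b) ∷ scale a p) *P q) i
        ≡⟨ coeff-∷* (a * b) (scale a p) q i ⟩
      a * b * coeff q i + coeff (0# ∷ (scale a p *P q)) i
        ≡⟨ ≡.cong (_ +_) (≡.trans (shift-cong (scale-* a p q) i) (shift-scale a (p *P q) i)) ⟩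
      a * b * coeff q i + a * coeff (0# ∷ (p *P q)) i
        ≡⟨ solve 4 (λ a b x y → a :* b :* x :+ a :* y := a :* (b :* x :+ y)) ≡.refl a b (coeff q i) _ ⟩
      a * (b * coeff q i + coeff (0# ∷ (p *P q)) i)
        ≡⟨ ≡.cong (a *_) (coeff-∷* b p q i) ⟨
      a * coeff ((b ∷ p) *P q) i
        ≡⟨ coeff-scale a ((b ∷ p) *P q) i ⟨
      coeff (scale a ((b ∷ p) *P q)) i ∎
      where open ≡.≡-Reasoning

    shift-* : ∀ p q i → coeff ((0# ∷ p) *P q) i ≡ coeff (0# ∷ (p *P q)) i
    shift-* p q i = ≡.trans (coeff-∷* 0# p q i) (≡.trans (≡.cong (_+ coeff (0# ∷ (p *P q)) i) (𝕂.zeroˡ _)) (𝕂.+-identityˡ _))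

    *-assoc : ∀ p q r → (p *P q) *P r ≐ p *P (q *P r)
    *-assoc []      q r = ≐-refl
    *-assoc (a ∷ p) q r = coefficientwise λ i → begin
      coeff ((scale a q +P (0# ∷ (p *P q))) *P r) i
        ≡⟨ at (distribʳ r (scale a q) (0# ∷ (p *P q))) i ⟩
      coeff (scale a q *P r +P (0# ∷ (p *P q)) *P r) i
        ≡⟨ coeff-+ (scale a q *P r) ((0# ∷ (p *P q)) *P r) i ⟩
      coeff (scale a q *P r) i + coeff ((0# ∷ (p *P q)) *P r) i
        ≡⟨ ≡.cong₂ _+_ (≡.trans (at (scale-* a q r) i) (coeff-scale a (q *P r) i))
             (≡.trans (shift-* (p *P q) r i) (shift-cong (*-assoc p q r) i)) ⟩
      a * coeff (q *P r) i + coeff (0# ∷ (p *P (q *P r))) i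
        ≡⟨ coeff-∷* a p (q *P r) i ⟨
      coeff ((a ∷ p) *P (q *P r)) i ∎
      where open ≡.≡-Reasoning

    *-identityˡ : ∀ p → const 1# *P p ≐ p
    *-identityˡ p = coefficientwise λ i → ≡.trans (coeff-∷* 1# [] p i)
      (≡.trans (≡.cong₂ _+_ (𝕂.*-identityˡ _) (shift-zero ≐-refl i)) (𝕂.+-identityʳ _))

    +-cong : ∀ {p p′ q q′} → p ≐ p′ → q ≐ q′ → p +P q ≐ p′ +P q′
    +-cong {p} {p′} {q} {q′} h k = coefficientwise λ i →
      ≡.trans (coeff-+ p q i) (≡.trans (≡.cong₂ _+_ (at h i) (at k i)) (≡.sym (coeff-+ p′ q′ i)))

    +-assoc : ∀ p q r → (p +P q) +P r ≐ p +P (q +P r)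
    +-assoc p q r = coefficientwise λ i → begin
      coeff ((p +P q) +P r) i                 ≡⟨ coeff-+ (p +P q) r i ⟩
      coeff (p +P q) i + coeff r i            ≡⟨ ≡.cong (_+ _) (coeff-+ p q i) ⟩
      (coeff p i + coeff q i) + coeff r i     ≡⟨ 𝕂.+-assoc _ _ _ ⟩
      coeff p i + (coeff q i + coeff r i)     ≡⟨ ≡.cong (_ +_) (coeff-+ q r i) ⟨
      coeff p i + coeff (q +P r) i            ≡⟨ coeff-+ p (q +P r) i ⟨
      coeff (p +P (q +P r)) i                 ∎
      where open ≡.≡-Reasoning

    +-comm : ∀ p q → p +P q ≐ q +P p
    +-comm p q = coefficientwise λ i →
      ≡.trans (coeff-+ p q i) (≡.trans (𝕂.+-comm _ _) (≡.sym (coeff-+ q p i)))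

    -‿cong : ∀ {p q} → p ≐ q → negP p ≐ negP q
    -‿cong {p} {q} h = coefficientwise λ i →
      ≡.trans (coeff-neg p i) (≡.trans (≡.cong -_ (at h i)) (≡.sym (coeff-neg q i)))

    -‿inverseˡ : ∀ p → negP p +P p ≐ []
    -‿inverseˡ p = coefficientwise λ i → ≡.trans (coeff-+ (negP p) p i)
      (≡.trans (≡.cong (_+ coeff p i) (coeff-neg p i)) (𝕂.-‿inverseˡ _))

  polynomials : CommutativeRing 0ℓ 0ℓ
  polynomials = record
    { Carrier = Pol ; _≈_ = _≐_ ; _+_ = _+P_ ; _*_ = _*P_ ; -_ = negP ; 0# = [] ; 1# = const 1#
    ; isCommutativeRing = record
      { isRing = record
        { +-isAbelianGroup = record
          { isGroup = record
            { isMonoid = record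
              { isSemigroup = record
                { isMagma = record
                  { isEquivalence = record { refl = ≐-refl ; sym = ≐-sym ; trans = ≐-trans }
                  ; ∙-cong = +-cong }
                ; assoc = +-assoc }
              ; identity = (λ p → ≐-refl) , (λ p → +-comm p []) }
            ; inverse = -‿inverseˡ , (λ p → ≐-trans (+-comm p (negP p)) (-‿inverseˡ p))
            ; ⁻¹-cong = -‿cong }
          ; comm = +-comm }
        ; *-cong = *-cong
        ; *-assoc = *-assoc
        ; *-identity = *-identityˡ , (λ p → ≐-trans (*-comm p (const 1#)) (*-identityˡ p))
        ; distrib = (λ r p q → ≐-trans (*-comm r (p +P q)) (≐-trans (distribʳ r p q)
                       (+-cong (*-comm p r) (*-comm q r))))
                  , distribʳ }
      ; *-comm = *-comm } }

  module ℙ where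
    open CommutativeRing polynomials public
    open Algebra.Properties.Ring ring public
    open Algebra.Properties.Semiring.Exp semiring public
    open Algebra.Properties.Semiring.Mult semiring public renaming (_×_ to _·_)
    open FiniteSum commutativeSemiring public
    open Determinant polynomials public
    open Multipartite polynomials public
  module ℙ-Solver = Solver polynomials

  -- The number d is a formal degree: a may be 0. This lets sums and determinants be treated
  -- termwise, an off-diagonal entry having formal degree 1 and top coefficient 0.
  record Leading (p : Pol) (d : ℕ) (a : A) : Set where
    constructor leading
    field
      top    : coeff p d ≡ a
      beyond : ∀ i → d ℕ.< i → coeff p i ≡ 0#
  open Leading

  leading-cong : ∀ {p q d a} → p ≐ q → Leading p d a → Leading q d a
  leading-cong h (leading t b) =
    leading (≡.trans (≡.sym (at h _)) t) (λ i l → ≡.trans (≡.sym (at h i)) (b i l))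

  leading-zero : ∀ d → Leading [] d 0#
  leading-zero d = leading ≡.refl (λ i l → ≡.refl)

  leading-+ : ∀ {p q d a b} → Leading p d a → Leading q d b → Leading (p +P q) d (a + b)
  leading-+ {p} {q} {d} (leading t b) (leading t′ b′) = leading
    (≡.trans (coeff-+ p q d) (≡.cong₂ _+_ t t′))
    (λ i l → ≡.trans (coeff-+ p q i) (≡.trans (≡.cong₂ _+_ (b i l) (b′ i l)) (𝕂.+-identityʳ 0#)))

  leading-neg : ∀ {p d a} → Leading p d a → Leading (negP p) d (- a)
  leading-neg {p} {d} (leading t b) = leading
    (≡.trans (coeff-neg p d) (≡.cong -_ t))
    (λ i l → ≡.trans (coeff-neg p i) (≡.trans (≡.cong -_ (b i l)) 𝕂.-0#≈0#))

  leading-* : ∀ {p q d e a b} → Leading p d a → Leading q e b → Leading (p *P q) (d ℕ.+ e) (a * b)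
  leading-* {[]} {q} {a = a} {b} (leading t _) _ = leading
    (≡.sym (≡.trans (≡.cong (_* b) (≡.sym t)) (𝕂.zeroˡ b))) (λ i l → ≡.refl)
  leading-* {x ∷ p} {q} {zero} {e} {a} {b} (leading t f) (leading t′ f′) = leading
    (≡.trans (coeff≡ e) (≡.cong₂ _*_ t t′))
    (λ i l → ≡.trans (coeff≡ i) (≡.trans (≡.cong (x *_) (f′ i l)) (𝕂.zeroʳ x)))
    where
    p≐0 : p ≐ []
    p≐0 = coefficientwise (λ i → f (suc i) (s≤s z≤n))
    coeff≡ : ∀ i → coeff ((x ∷ p) *P q) i ≡ x * coeff q i
    coeff≡ i = ≡.trans (coeff-∷* x p q i)
      (≡.trans (≡.cong (x * coeff q i +_) (shift-zero (zero-* q p≐0) i)) (𝕂.+-identityʳ _))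
  leading-* {x ∷ p} {q} {suc d} {e} {a} {b} (leading t f) l′@(leading t′ f′) = leading
    (≡.trans (coeff-suc (d ℕ.+ e) (s≤s (ℕₚ.m≤n+m e d))) (top IH))
    (λ { (suc i) (s≤s l) → ≡.trans (coeff-suc i (s≤s (ℕₚ.≤-trans (ℕₚ.m≤n+m e d) (ℕₚ.<⇒≤ l)))) (beyond IH i l) })
    where
    IH : Leading (p *P q) (d ℕ.+ e) (a * b)
    IH = leading-* {p} (leading t (λ i l → f (suc i) (s≤s l))) l′
    coeff-suc : ∀ i → e ℕ.< suc i → coeff ((x ∷ p) *P q) (suc i) ≡ coeff (p *P q) i
    coeff-suc i l = ≡.trans (coeff-∷* x p q (suc i))
      (≡.trans (≡.cong (_+ coeff (p *P q) i) (≡.trans (≡.cong (x *_) (f′ (suc i) l)) (𝕂.zeroʳ x))) (𝕂.+-identityˡ _))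

  leading-∑ : ∀ {n d} {f : Fin n → Pol} {a : Fin n → A} → (∀ j → Leading (f j) d (a j)) →
    Leading (ℙ.∑ f) d (𝕂.∑ a)
  leading-∑ {zero}  {d} h = leading-cong (ℙ.sym ℙ.∑-empty) (≡.subst (Leading [] d) (≡.sym 𝕂.∑-empty) (leading-zero d))
  leading-∑ {suc n} {d} {f} h = leading-cong (ℙ.sym ℙ.∑-suc)
    (≡.subst (Leading _ d) (≡.sym 𝕂.∑-suc) (leading-+ (h zero) (leading-∑ (λ j → h (suc j)))))

  leading-const : ∀ a → Leading (const a) 0 a
  leading-const a = leading ≡.refl (λ { (suc i) l → ≡.refl })

  leading-sign : ∀ {n} (j : Fin n) → Leading (ℙ.sign j) 0 (𝕂.sign j)
  leading-sign zero    = leading-const 1#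
  leading-sign (suc j) = leading-neg (leading-sign j)

  -- The same Laplace expansion runs on both sides, every minor contributing its formal top
  -- coefficient. For a characteristic matrix the linear coefficients form the identity, so monicity
  -- comes down to `det-δ`.
  leading-det : ∀ {n} (w : Vec (ℙ.Row (Fin n)) n) (l : Vec (𝕂.Row (Fin n)) n) →
    (∀ i k → Leading (lookup w i k) 1 (lookup l i k)) → Leading (ℙ.det w) n (𝕂.det l)
  leading-det []      []      h = leading-const 1#
  leading-det {suc n} (r ∷ w) (s ∷ l) h = leading-∑ (λ j → leading-* (leading-sign j)
    (leading-* (h zero j) (leading-det (map (λ v → removeAt v j) w) (map (λ v → removeAt v j) l)
      (λ i k → ≡.subst₂ (λ u v → Leading (u k) 1 (v k)) (≡.sym (lookup-map i (λ v → removeAt v j) w))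
        (≡.sym (lookup-map i (λ v → removeAt v j) l)) (h (suc i) (punchIn j k))))))

  leading-length : ∀ p → Leading p (length p) 0#
  leading-length []      = leading-zero 0
  leading-length (a ∷ p) with leading-length p
  ... | leading t b = leading t (λ { (suc i) (s≤s l) → b i l })

  Regular : Pol → Set
  Regular p = ∀ q → p *P q ≐ [] → q ≐ []

  NonZeroDivisor : A → Set
  NonZeroDivisor a = ∀ x → a * x ≡ 0# → x ≡ 0#

  -- Descent on a degree bound e for q, beginning at its length: in degree d + e the product has
  -- coefficient a times the coefficient of q in degree e, so the latter vanishes and e drops. Only
  -- a has to be a nonzerodivisor, and the scalars need not form a domain.
  leading⇒regular : ∀ {p d a} → Leading p d a → NonZeroDivisor a → Regular p
  leading⇒regular {p} {d} {a} l a-nzd q pq≐0 = descend (length q) (beyond (leading-length q))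
    where
    top≡0 : ∀ e → (∀ i → e ℕ.< i → coeff q i ≡ 0#) → coeff q e ≡ 0#
    top≡0 e b = a-nzd _ (≡.trans (≡.sym (top (leading-* l (leading {q} ≡.refl b)))) (at pq≐0 (d ℕ.+ e)))
    descend : ∀ e → (∀ i → e ℕ.< i → coeff q i ≡ 0#) → q ≐ []
    descend e b with top≡0 e b
    descend zero    b | eq = coefficientwise λ { zero → eq ; (suc i) → b (suc i) (s≤s z≤n) }
    descend (suc e) b | eq = descend e λ i e<i → case i e<i (ℕₚ.m≤n⇒m<n∨m≡n e<i)
      where
      case : ∀ i → e ℕ.< i → suc e ℕ.< i ⊎ suc e ≡ i → coeff q i ≡ 0#
      case i _ (inj₁ l)      = b i l
      case i _ (inj₂ ≡.refl) = eq

  regular-* : ∀ {p q} → Regular p → Regular q → Regular (p *P q)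
  regular-* {p} {q} hp hq r eq = hq r (hp (q *P r) (ℙ.trans (ℙ.sym (ℙ.*-assoc p q r)) eq))

  regular-cong : ∀ {p q} → p ≐ q → Regular p → Regular q
  regular-cong h hp r eq = hp r (ℙ.trans (ℙ.*-congʳ h) eq)

  regular-^ : ∀ {p} → Regular p → ∀ n → Regular (p ℙ.^ n)
  regular-^ {p} hp zero    r eq = ℙ.trans (ℙ.sym (ℙ.*-identityˡ r)) eq
  regular-^ {p} hp (suc n) = regular-* {p} {p ℙ.^ n} hp (regular-^ {p} hp n)

  leading-linear : ∀ a → Leading (X +P negP (const a)) 1 1#
  leading-linear a = leading ≡.refl λ { (suc (suc i)) (s≤s (s≤s l)) → ≡.refl }

  leading-^P : ∀ {p} → Leading p 1 1# → ∀ n → Leading (p ^P n) n 1#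
  leading-^P l zero    = leading-const 1#
  leading-^P {p} l (suc n) = ≡.subst (Leading (p ^P suc n) (suc n)) (𝕂.*-identityˡ 1#) (leading-* l (leading-^P l n))

  linear-regular : ∀ a → Regular (X +P negP (const a))
  linear-regular a = leading⇒regular (leading-linear a) (λ x eq → ≡.trans (≡.sym (𝕂.*-identityˡ x)) eq)

  cancel : ∀ {p} → Regular p → ∀ {q r} → p *P q ≐ p *P r → q ≐ r
  cancel {p} hp {q} {r} eq = ℙ.x∙y⁻¹≈ε⇒x≈y q r (hp _ (ℙ.trans (ℙ.x[y-z]≈xy-xz p q r) (ℙ.x≈y⇒x∙y⁻¹≈ε eq)))

  -- p + q is regular because its leading coefficient is 2.
  square-injective : NonZeroDivisor (1# + 1#) → ∀ {p q d} → Leading p d 1# → Leading q d 1# →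
    p *P p ≐ q *P q → p ≐ q
  square-injective two {p} {q} hp hq eq = ℙ.x∙y⁻¹≈ε⇒x≈y p q
    (leading⇒regular (leading-+ hp hq) two (p +P negP q)
      (ℙ.trans (S.solve 2 (λ p q → (p S.:+ q) S.:* (p S.:- q) S.:= p S.:* p S.:- q S.:* q) ℙ.refl p q)
        (ℙ.x≈y⇒x∙y⁻¹≈ε eq)))
    where module S = ℙ-Solver

  const-* : ∀ a b → const (a * b) ≐ const a *P const b
  const-* a b = coefficientwise λ { zero → ≡.sym (𝕂.+-identityʳ _) ; (suc i) → ≡.refl }

  const-negate : ∀ a → const (- a) ≐ negP (const a)
  const-negate a = coefficientwise λ { zero → ≡.sym (𝕂.-1*x≈-x a) ; (suc i) → ≡.refl }

  const-0 : const 0# ≐ []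
  const-0 = coefficientwise λ { zero → ≡.refl ; (suc i) → ≡.refl }

  const-⟪⟫ : ∀ n → const (𝕂.⟪ n ⟫) ≐ ℙ.⟪ n ⟫
  const-⟪⟫ zero    = const-0
  const-⟪⟫ (suc n) = ℙ.+-congˡ {ℙ.1#} (const-⟪⟫ n)

  ^P≡^ : ∀ p n → p ^P n ≡ p ℙ.^ n
  ^P≡^ p zero    = ≡.refl
  ^P≡^ p (suc n) = ≡.cong (p *P_) (^P≡^ p n)

  -- The two Laplace determinants and the characteristic polynomial

  private
    sign-inject₁ : ∀ {n} (i : Fin n) → 𝕂.sign (inject₁ i) ≡ 𝕂.sign i
    sign-inject₁ zero    = ≡.refl
    sign-inject₁ (suc i) = ≡.cong -_ (sign-inject₁ i)

    scale≐sign* : ∀ {n} (j : Fin n) q → scale (𝕂.sign j) q ≐ ℙ.sign j *P q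
    scale≐sign* j q = ℙ.trans {j = const (𝕂.sign j) *P q} (coefficientwise λ i → ≡.trans (coeff-scale (𝕂.sign j) q i)
        (≡.sym (≡.trans (coeff-∷* (𝕂.sign j) [] q i)
          (≡.trans (≡.cong (𝕂.sign j * coeff q i +_) (shift-zero ℙ.refl i)) (𝕂.+-identityʳ _)))))
      (ℙ.*-congʳ {q} (const-sign j))
      where
      const-sign : ∀ {n} (j : Fin n) → const (𝕂.sign j) ≐ ℙ.sign j
      const-sign zero    = ℙ.refl
      const-sign (suc j) = ℙ.trans {j = negP (const (𝕂.sign j))}
        (coefficientwise λ { zero → ≡.sym (𝕂.-1*x≈-x _) ; (suc i) → ≡.refl })
        (ℙ.-‿cong (const-sign j))

    sumFin-cong : ∀ {n} {f g : Fin n → Pol} → (∀ j → f j ≐ g j) → sumFin f ≐ ℙ.∑ g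
    sumFin-cong {zero}  h = ℙ.sym ℙ.∑-empty
    sumFin-cong {suc n} h = ℙ.trans (ℙ.+-cong (h zero) (sumFin-cong (λ j → h (suc j)))) (ℙ.sym ℙ.∑-suc)

    -- The sign function of Defs.det is local to it and has no name outside; it
    -- is recovered here by unification.
    extract-sign : ∀ {n p q} {s : Fin n → A} {f : Fin n → Pol} →
      q ≡ p +P sumFin (λ i → scale (- s i) (f i)) → Fin n → A
    extract-sign {s = s} _ = s

    det-sign : ∀ {n} (M : Fin (suc n) → Fin (suc n) → Pol) → Fin n → A
    det-sign {n} M = extract-sign {q = det (suc n) M} ≡.refl

    det-sign≡sign : ∀ {n} (M : Fin (suc n) → Fin (suc n) → Pol) i → det-sign M i ≡ 𝕂.sign i
    det-sign≡sign {suc n} M = <-weakInduction (λ i → det-sign M i ≡ 𝕂.sign i) ≡.refl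
      (λ i eq → ≡.trans (step i) (≡.cong -_ (≡.trans eq (sign-inject₁ i))))
      where
      step : ∀ i → det-sign M (suc i) ≡ - det-sign M (inject₁ i)
      -- The hidden sign depends on `toℕ` alone; after the rewriting, `suc i` and `inject₁ i` have
      -- consecutive numerals and one unfolding of the sign remains.
      step i rewrite toℕ-inject₁ i = ≡.refl

  det≐ : ∀ n (M : Fin n → Fin n → Pol) → det n M ≐ ℙ.⟦ M ⟧
  det≐ zero    M = ℙ.refl
  det≐ (suc n) M = ℙ.trans
    (ℙ.+-cong (ℙ.trans (scale≐sign* {suc n} zero _) (ℙ.*-congˡ {const 1#} (minor zero)))
      (sumFin-cong λ i → ℙ.trans
        (ℙ.reflexive (≡.cong (λ a → scale (- a) (M zero (suc i) *P det n (λ j k → M (suc j) (punchIn (suc i) k))))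
          (det-sign≡sign M i)))
        (ℙ.trans (scale≐sign* {suc n} (suc i) _) (ℙ.*-congˡ {ℙ.sign (suc i)} (minor (suc i))))))
    (ℙ.sym ℙ.∑-suc)
    where
    minor : ∀ j → M zero j *P det n (λ i k → M (suc i) (punchIn j k)) ≐
      M zero j *P ℙ.det (map (λ v → removeAt v j) (tabulate (M ∘ suc)))
    minor j = ℙ.*-congˡ {M zero j} (ℙ.trans (det≐ n (λ i k → M (suc i) (punchIn j k)))
      (ℙ.reflexive (≡.cong ℙ.det (tabulate-∘ (λ v → removeAt v j) (M ∘ suc)))))

  charMatrix : ∀ {n} → (Fin n → Fin n → A) → ℙ.Matrix n
  charMatrix B i j = X *P ℙ.δ i j +P negP (const (B i j))

  charPoly≐ : ∀ n (B : Fin n → Fin n → A) → charPoly n B ≐ ℙ.⟦ charMatrix B ⟧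
  charPoly≐ n B = ℙ.trans (det≐ n _) (ℙ.det-cong {n} λ i j → ℙ.+-congʳ {negP (const (B i j))} (diagonal i j))
    where
    diagonal : ∀ i j → (if ⌊ i ≟ᶠ j ⌋ then X else []) ≐ X *P ℙ.δ i j
    diagonal i j with i ≟ᶠ j
    ... | yes ≡.refl = ℙ.sym (ℙ.trans (ℙ.*-congˡ {X} (ℙ.δ-refl i)) (ℙ.*-identityʳ X))
    ... | no  i≢j    = ℙ.sym (ℙ.trans (ℙ.*-congˡ {X} (ℙ.δ-≢ i≢j)) (ℙ.zeroʳ X))

  charPoly-monic : ∀ n (B : Fin n → Fin n → A) → Leading (charPoly n B) n 1#
  charPoly-monic n B = leading-cong (ℙ.sym (charPoly≐ n B)) (≡.subst (Leading _ n) (𝕂.det-δ n)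
    (leading-det (tabulate (charMatrix B)) (tabulate 𝕂.δ) λ i k →
      ≡.subst₂ (λ r s → Leading (r k) 1 (s k)) (≡.sym (lookup∘tabulate (charMatrix B) i))
        (≡.sym (lookup∘tabulate 𝕂.δ i)) (entry i k)))
    where
    leading-δ : ∀ {n} (i j : Fin n) → Leading (ℙ.δ i j) 0 (𝕂.δ i j)
    leading-δ zero    zero    = leading-const 1#
    leading-δ zero    (suc j) = leading-zero 0
    leading-δ (suc i) zero    = leading-zero 0
    leading-δ (suc i) (suc j) = leading-δ i j

    leading-X : Leading X 1 1#
    leading-X = leading ≡.refl λ { (suc (suc i)) (s≤s (s≤s l)) → ≡.refl }

    entry : ∀ i k → Leading (charMatrix B i k) 1 (𝕂.δ i k)
    entry i k = ≡.subst (Leading (charMatrix B i k) 1)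
      (solve 1 (λ x → :1 :* x :+ :- :0 := x) ≡.refl (𝕂.δ i k))
      (leading-+ (leading-* leading-X (leading-δ i k))
        (leading-neg {const (B i k)} {1} {0#} (leading ≡.refl λ { (suc i) l → ≡.refl })))

-- Characteristic polynomials of multipartite type

module Spectra {A : Set} (K : RawCR A)
  (K-isCommutativeRing : IsCommutativeRing _≡_ (RawCR._+_ K) (RawCR._*_ K) (RawCR.-_ K) (RawCR.0# K) (RawCR.1# K))
  where
  open Poly K renaming (_+P_ to infixl 6 _+P_; _*P_ to infixl 7 _*P_; _^P_ to infixr 8 _^P_)
  open Polynomials K K-isCommutativeRing
  open 𝕂 using (0#; 1#) renaming (_+_ to _⊕_; _*_ to _⊗_; -_ to ⊖_)
  open ℙ using (_^_; ⟪_⟫; ⟦_⟧; δ)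
  open ℙ-Solver
  open Relation.Binary.Reasoning.Setoid ℙ.setoid
  open Counting using (bit; count; distinct)

  factor : A → Pol
  factor a = X +P negP (const a)

  factor-0 : ∀ {a} → a ≡ 0# → factor a ≐ X
  factor-0 ≡.refl = ℙ.trans (ℙ.+-congˡ {X} (ℙ.trans (ℙ.-‿cong const-0) ℙ.-0#≈0#)) (ℙ.+-identityʳ X)

  X-regular : Regular X
  X-regular = regular-cong (factor-0 ≡.refl) (linear-regular 0#)

  X^-split : ∀ {k n} → k ℕ.≤ n → ∀ p → p ^ n ≐ p ^ k *P p ^ (n ℕ.∸ k)
  X^-split {k} {n} k≤n p = ℙ.trans (ℙ.reflexive (≡.cong (p ^_) (≡.sym (ℕₚ.m+[n∸m]≡n k≤n)))) (ℙ.^-homo-* p k (n ℕ.∸ k))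

  ^P-cong : ∀ {p q} n → p ≐ q → p ^P n ≐ q ^ n
  ^P-cong {p} n h = ℙ.trans (ℙ.reflexive (^P≡^ p n)) (ℙ.^-congˡ n h)

  ⟪⟫-* : ∀ a b → ⟪ a ℕ.* b ⟫ ≐ ⟪ a ⟫ *P ⟪ b ⟫
  ⟪⟫-* = ℙ.×1-homo-*

  ⟪⟫-+ : ∀ a b → ⟪ a ℕ.+ b ⟫ ≐ ⟪ a ⟫ +P ⟪ b ⟫
  ⟪⟫-+ = ℙ.×-homo-+ ℙ.1#

  const-factor : ∀ {a p} → const a ≐ p → factor a ≐ X +P negP p
  const-factor h = ℙ.+-congˡ {X} (ℙ.-‿cong h)

  module _ {n c k m : ℕ} (class : Fin n → Fin c) (fibre : ∀ j → count (λ x → class x ≟ᶠ j) ≡ m)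
    (size : n ≡ c ℕ.* m) (c≤n : c ℕ.≤ n) (c≡1+k : c ≡ suc k) where

    ⟪n⟫ : ⟪ n ⟫ ≐ ⟪ c ⟫ *P ⟪ m ⟫
    ⟪n⟫ = ℙ.trans (ℙ.reflexive (≡.cong ⟪_⟫ size)) (⟪⟫-* c m)

    ^-suc : ∀ p → p ^ c ≐ p *P p ^ k
    ^-suc p = ℙ.reflexive (≡.cong (p ^_) c≡1+k)

    -- This is `multipartite-det` for α = X and β = - 1, where γ = X + m and γ + n β = X - (n - m).
    -- One of the c factors γ and c of the n factors X are cancelled against the regular prefactor,
    -- which leaves the multiplicities k = c - 1 and n - c.
    multipartite-spectrum : ∀ (B : Fin n → Fin n → A) → (∀ x y → const (B x y) ≐ ⟪ distinct class x y ⟫) →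
      ∀ {λ₁ λ₂ λ₃} → λ₁ ≡ 𝕂.⟪ n ⟫ ⊕ (⊖ 𝕂.⟪ m ⟫) → λ₂ ≡ ⊖ 𝕂.⟪ m ⟫ → λ₃ ≡ 0# →
      HasSpectrum n B ((λ₁ , 1) ∷ (λ₂ , k) ∷ (λ₃ , n ℕ.∸ c) ∷ [])
    multipartite-spectrum B B≐ {λ₁} {λ₂} {λ₃} eq₁ eq₂ eq₃ = at (cancel {γ *P X ^ c}
      (regular-* {γ} {X ^ c} (regular-cong factor₂ (linear-regular λ₂)) (regular-^ {X} X-regular c)) (begin
        γ *P X ^ c *P charPoly n B
          ≈⟨ ℙ.*-congˡ {γ *P X ^ c} (ℙ.trans (charPoly≐ n B) (ℙ.det-cong {n} entries)) ⟩
        γ *P X ^ c *P ⟦ (λ x y → X *P δ x y +P β *P ⟪ distinct class x y ⟫) ⟧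
          ≈⟨ ℙ.multipartite-det class fibre X β ⟩
        X ^ n *P (γ ^ c *P (γ +P ⟪ c ⟫ *P (⟪ m ⟫ *P β)))
          ≈⟨ ℙ.*-cong (X^-split c≤n X) (ℙ.*-cong (^-suc γ) (ℙ.sym factor₁)) ⟩
        X ^ c *P X ^ e *P (γ *P γ ^ k *P factor λ₁)
          ≈⟨ solve 5 (λ x y g h f → x :* y :* (g :* h :* f) := g :* x :* (f :* :1 :* (h :* (y :* :1)))) ℙ.refl
               (X ^ c) (X ^ e) γ (γ ^ k) (factor λ₁) ⟩
        γ *P X ^ c *P (factor λ₁ ^ 1 *P (γ ^ k *P (X ^ e *P const 1#)))
          ≈⟨ ℙ.*-congˡ {γ *P X ^ c} (ℙ.*-cong (^P-cong {factor λ₁} 1 ℙ.refl) (ℙ.*-cong (^P-cong k factor₂)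
               (ℙ.*-congʳ {const 1#} (^P-cong e (factor-0 eq₃))))) ⟨
        γ *P X ^ c *P (factor λ₁ ^P 1 *P (factor λ₂ ^P k *P (factor λ₃ ^P e *P const 1#))) ∎))
      where
      e = n ℕ.∸ c
      β γ : Pol
      β = negP (const 1#)
      γ = X +P negP (⟪ m ⟫ *P β)
      entries : ∀ x y → X *P δ x y +P negP (const (B x y)) ≐ X *P δ x y +P β *P ⟪ distinct class x y ⟫
      entries x y = ℙ.+-congˡ {X *P δ x y} (ℙ.trans (ℙ.-‿cong (B≐ x y)) (ℙ.sym (ℙ.-1*x≈-x _)))
      factor₂ : factor λ₂ ≐ γ
      factor₂ = ℙ.trans (const-factor (ℙ.trans (ℙ.reflexive (≡.cong const eq₂)) const-neg))
        (solve 2 (λ x m → x :+ :- (:- m) := x :+ :- (m :* :- :1)) ℙ.refl X ⟪ m ⟫)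
        where
        const-neg : const (⊖ 𝕂.⟪ m ⟫) ≐ negP ⟪ m ⟫
        const-neg = ℙ.trans (const-negate 𝕂.⟪ m ⟫) (ℙ.-‿cong (const-⟪⟫ m))
      factor₁ : factor λ₁ ≐ γ +P ⟪ c ⟫ *P (⟪ m ⟫ *P β)
      factor₁ = ℙ.trans (const-factor (ℙ.trans (ℙ.reflexive (≡.cong const eq₁))
          (ℙ.+-cong (ℙ.trans (const-⟪⟫ n) ⟪n⟫) (ℙ.trans (const-negate 𝕂.⟪ m ⟫) (ℙ.-‿cong (const-⟪⟫ m))))))
        (solve 3 (λ x m k → x :+ :- (k :* m :+ :- m) := x :+ :- (m :* :- :1) :+ k :* (m :* :- :1)) ℙ.refl
          X ⟪ m ⟫ ⟪ c ⟫)

    -- S is the edge relation of a graph that is isomorphic, via relabel, to its complement N in the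
    -- complete multipartite graph on the classes.
    module _ {S N : Fin n → Fin n → Set} (S? : ∀ x y → Dec (S x y)) (N? : ∀ x y → Dec (N x y))
      (complementary : ∀ x y → bit (S? x y) ℕ.+ bit (N? x y) ≡ distinct class x y)
      (κ : ℕ) (walks : ∀ x y → count (λ z → S? x z ×-dec N? z y) ≡ κ ℕ.* distinct class x y)
      (relabel : Fin n → Fin n) (relabel-injective : ∀ {x y} → relabel x ≡ relabel y → x ≡ y)
      (relabelled : ∀ x y → bit (N? x y) ≡ bit (S? (relabel x) (relabel y)))
      (degree : n ≡ 4 ℕ.* κ ℕ.+ m) (2-nonzerodivisor : NonZeroDivisor (1# ⊕ 1#))
      where

      private
        P P′ : ℙ.Matrix n
        P  x y = X *P δ x y +P negP ⟪ bit (S? x y) ⟫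
        P′ x y = X *P δ x y +P negP ⟪ bit (N? x y) ⟫

        α β γ : Pol
        α = X *P X
        β = ⟪ κ ⟫ +P negP X
        γ = α +P negP (⟪ m ⟫ *P β)

        P′≐P : ⟦ P′ ⟧ ≐ ⟦ P ⟧
        P′≐P = ℙ.trans (ℙ.det-cong {n} λ x y → ℙ.+-cong
            (ℙ.*-congˡ {X} (ℙ.sym (ℙ.δ-injective relabel relabel-injective x y)))
            (ℙ.-‿cong (ℙ.reflexive (≡.cong ⟪_⟫ (relabelled x y)))))
          (ℙ.det-relabel P relabel relabel-injective)

        product-entry : ∀ x y → (P ℙ.⊡ P′) x y ≐ α *P δ x y +P β *P ⟪ distinct class x y ⟫
        product-entry x y = begin
          ℙ.∑ (λ z → P x z *P P′ z y)
            -- The product is sorted into a part with δ x z, a part with δ z y and the two-step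
            -- walks: the first two sums collapse, and the third is the hypothesis `walks`.
            ≈⟨ ℙ.∑-cong (λ z → solve 5 (λ t d e s u →
                 (t :* d :+ :- s) :* (t :* e :+ :- u) :=
                 d :* (t :* (t :* e :+ :- u)) :+ (:- (t :* s) :* e :+ s :* u)) ℙ.refl
                 X (δ x z) (δ z y) ⟪ bit (S? x z) ⟫ ⟪ bit (N? z y) ⟫) ⟩
          ℙ.∑ (λ z → δ x z *P f z +P (g z *P δ z y +P ⟪ bit (S? x z) ⟫ *P ⟪ bit (N? z y) ⟫))
            ≈⟨ ℙ.trans (ℙ.∑-+ _ _) (ℙ.+-congˡ (ℙ.∑-+ _ _)) ⟩
          ℙ.∑ (λ z → δ x z *P f z) +P (ℙ.∑ (λ z → g z *P δ z y) +P ℙ.∑ (λ z → ⟪ bit (S? x z) ⟫ *P ⟪ bit (N? z y) ⟫))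
            ≈⟨ ℙ.+-cong (ℙ.sum-δ x f) (ℙ.+-cong (ℙ.sum-δʳ y g) two-step) ⟩
          f x +P (g y +P ⟪ κ ⟫ *P ⟪ distinct class x y ⟫)
            ≈⟨ ℙ.+-congˡ {f x} (ℙ.+-congˡ {g y} (ℙ.*-congˡ {⟪ κ ⟫} s+u)) ⟨
          f x +P (g y +P ⟪ κ ⟫ *P (⟪ bit (S? x y) ⟫ +P ⟪ bit (N? x y) ⟫))
            ≈⟨ solve 5 (λ t d s u k → t :* (t :* d :+ :- u) :+ (:- (t :* s) :+ k :* (s :+ u)) :=
                 t :* t :* d :+ (k :+ :- t) :* (s :+ u)) ℙ.refl
                 X (δ x y) ⟪ bit (S? x y) ⟫ ⟪ bit (N? x y) ⟫ ⟪ κ ⟫ ⟩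
          α *P δ x y +P β *P (⟪ bit (S? x y) ⟫ +P ⟪ bit (N? x y) ⟫)
            ≈⟨ ℙ.+-congˡ {α *P δ x y} (ℙ.*-congˡ {β} s+u) ⟩
          α *P δ x y +P β *P ⟪ distinct class x y ⟫ ∎
          where
          f g : Fin n → Pol
          f z = X *P (X *P δ z y +P negP ⟪ bit (N? z y) ⟫)
          g z = negP (X *P ⟪ bit (S? x z) ⟫)
          s+u : ⟪ bit (S? x y) ⟫ +P ⟪ bit (N? x y) ⟫ ≐ ⟪ distinct class x y ⟫
          s+u = ℙ.trans (ℙ.sym (⟪⟫-+ (bit (S? x y)) (bit (N? x y)))) (ℙ.reflexive (≡.cong ⟪_⟫ (complementary x y)))
          two-step : ℙ.∑ (λ z → ⟪ bit (S? x z) ⟫ *P ⟪ bit (N? z y) ⟫) ≐ ⟪ κ ⟫ *P ⟪ distinct class x y ⟫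
          two-step = begin
            ℙ.∑ (λ z → ⟪ bit (S? x z) ⟫ *P ⟪ bit (N? z y) ⟫)
              ≈⟨ ℙ.∑-cong (λ z → ℙ.trans (ℙ.sym (⟪⟫-* (bit (S? x z)) (bit (N? z y))))
                   (ℙ.reflexive (≡.cong ⟪_⟫ (Counting.bit-× (S? x z) (N? z y))))) ⟩
            ℙ.∑ (λ z → ⟪ bit (S? x z ×-dec N? z y) ⟫)
              ≈⟨ ℙ.⟪⟫-∑ (λ z → bit (S? x z ×-dec N? z y)) ⟨
            ⟪ count (λ z → S? x z ×-dec N? z y) ⟫
              ≈⟨ ℙ.trans (ℙ.reflexive (≡.cong ⟪_⟫ (walks x y))) (⟪⟫-* κ (distinct class x y)) ⟩
            ⟪ κ ⟫ *P ⟪ distinct class x y ⟫ ∎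

        squared : γ *P α ^ c *P (⟦ P ⟧ *P ⟦ P ⟧) ≐ α ^ n *P (γ ^ c *P (γ +P ⟪ c ⟫ *P (⟪ m ⟫ *P β)))
        squared = begin
          γ *P α ^ c *P (⟦ P ⟧ *P ⟦ P ⟧)
            ≈⟨ ℙ.*-congˡ {γ *P α ^ c} (ℙ.*-congˡ {⟦ P ⟧} P′≐P) ⟨
          γ *P α ^ c *P (⟦ P ⟧ *P ⟦ P′ ⟧)
            ≈⟨ ℙ.*-congˡ {γ *P α ^ c} (ℙ.trans (ℙ.sym (ℙ.det-* P P′)) (ℙ.det-cong {n} product-entry)) ⟩
          γ *P α ^ c *P ⟦ (λ x y → α *P δ x y +P β *P ⟪ distinct class x y ⟫) ⟧
            ≈⟨ ℙ.multipartite-det class fibre α β ⟩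
          α ^ n *P (γ ^ c *P (γ +P ⟪ c ⟫ *P (⟪ m ⟫ *P β))) ∎

      -- Every factor on the right of `squared` is, after cancellation, a square. The sum and the
      -- product of θ and τ give γ = X² + m X - m κ = (X - θ) (X - τ), whose exponent k = h + h is
      -- even. The factor γ + n β = X² + (n - m) (κ - X) equals (X - 2 κ)² exactly because n - m = 4
      -- κ, and α^(n - c) is a square since α = X².
      conference-spectrum : ∀ (B : Fin n → Fin n → A) → (∀ x y → const (B x y) ≐ ⟪ bit (S? x y) ⟫) →
        ∀ {h} → k ≡ h ℕ.+ h → ∀ {λ₁ θ τ λ₀} → λ₁ ≡ 𝕂.⟪ κ ℕ.+ κ ⟫ →
        θ ⊕ τ ≡ ⊖ 𝕂.⟪ m ⟫ → θ ⊗ τ ≡ ⊖ 𝕂.⟪ m ℕ.* κ ⟫ → λ₀ ≡ 0# →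
        HasSpectrum n B ((λ₁ , 1) ∷ (θ , h) ∷ (τ , h) ∷ (λ₀ , n ℕ.∸ c) ∷ [])
      conference-spectrum B B≐ {h} k≡h+h {λ₁} {θ} {τ} {λ₀} eq₁ sum-eq product-eq eq₀ = at
        (square-injective 2-nonzerodivisor (charPoly-monic n B) target-monic
          (cancel {γ *P α ^ c}
            (regular-* {γ} {α ^ c}
              (regular-cong {factor θ *P factor τ} quadratic
                (regular-* {factor θ} {factor τ} (linear-regular θ) (linear-regular τ)))
              (regular-^ {α} (regular-* {X} {X} X-regular X-regular) c))
            (begin
              γ *P α ^ c *P (charPoly n B *P charPoly n B)
                ≈⟨ ℙ.*-congˡ {γ *P α ^ c} (ℙ.*-cong charPoly≐P charPoly≐P) ⟩
              γ *P α ^ c *P (⟦ P ⟧ *P ⟦ P ⟧)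
                ≈⟨ squared ⟩
              α ^ n *P (γ ^ c *P (γ +P ⟪ c ⟫ *P (⟪ m ⟫ *P β)))
                ≈⟨ ℙ.*-cong (X^-split c≤n α) (ℙ.*-cong (ℙ.trans (^-suc γ) (ℙ.*-congˡ {γ} γ^k)) leading-factor) ⟩
              α ^ c *P α ^ e *P (γ *P (θ^ *P τ^ *P (θ^ *P τ^)) *P (factor λ₁ *P factor λ₁))
                ≈⟨ ℙ.*-congʳ {γ *P (θ^ *P τ^ *P (θ^ *P τ^)) *P (factor λ₁ *P factor λ₁)}
                     (ℙ.*-congˡ {α ^ c} (product-^ X X e)) ⟩
              α ^ c *P (X ^ e *P X ^ e) *P (γ *P (θ^ *P τ^ *P (θ^ *P τ^)) *P (factor λ₁ *P factor λ₁))
                ≈⟨ solve 6 (λ a x g t u f → a :* (x :* x) :* (g :* (t :* u :* (t :* u)) :* (f :* f)) :=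
                     g :* a :* (f :* :1 :* (t :* (u :* (x :* :1))) :* (f :* :1 :* (t :* (u :* (x :* :1)))))) ℙ.refl
                     (α ^ c) (X ^ e) γ θ^ τ^ (factor λ₁) ⟩
              γ *P α ^ c *P (target′ *P target′)
                ≈⟨ ℙ.*-congˡ {γ *P α ^ c} (ℙ.*-cong target≐ target≐) ⟨
              γ *P α ^ c *P (target *P target) ∎)))
        where
        e = n ℕ.∸ c
        θ^ τ^ target target′ : Pol
        θ^ = factor θ ^ h
        τ^ = factor τ ^ h
        target  = factor λ₁ ^P 1 *P (factor θ ^P h *P (factor τ ^P h *P (factor λ₀ ^P e *P const 1#)))
        target′ = factor λ₁ ^ 1 *P (θ^ *P (τ^ *P (X ^ e *P const 1#)))

        target≐ : target ≐ target′
        target≐ = ℙ.*-cong (^P-cong {factor λ₁} 1 ℙ.refl) (ℙ.*-cong (^P-cong h ℙ.refl) (ℙ.*-cong (^P-cong h ℙ.refl)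
          (ℙ.*-congʳ {const 1#} (^P-cong e (factor-0 eq₀)))))

        charPoly≐P : charPoly n B ≐ ⟦ P ⟧
        charPoly≐P = ℙ.trans (charPoly≐ n B)
          (ℙ.det-cong {n} λ x y → ℙ.+-congˡ {X *P δ x y} (ℙ.-‿cong (B≐ x y)))

        product-^ : ∀ p q j → (p *P q) ^ j ≐ p ^ j *P q ^ j
        product-^ p q zero    = ℙ.sym (ℙ.*-identityˡ (const 1#))
        product-^ p q (suc j) = ℙ.trans (ℙ.*-congˡ {p *P q} (product-^ p q j))
          (solve 4 (λ p q r s → p :* q :* (r :* s) := p :* r :* (q :* s)) ℙ.refl p q (p ^ j) (q ^ j))

        quadratic : factor θ *P factor τ ≐ γ
        quadratic = begin
          factor θ *P factor τ
            ≈⟨ solve 3 (λ x s t → (x :+ :- s) :* (x :+ :- t) := x :* x :+ (:- ((s :+ t) :* x) :+ s :* t)) ℙ.refl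
                 X (const θ) (const τ) ⟩
          α +P (negP ((const θ +P const τ) *P X) +P const θ *P const τ)
            ≈⟨ ℙ.+-congˡ {α} (ℙ.+-cong (ℙ.-‿cong (ℙ.*-congʳ {X} θ+τ)) θτ) ⟩
          α +P (negP (negP ⟪ m ⟫ *P X) +P negP (⟪ m ⟫ *P ⟪ κ ⟫))
            ≈⟨ solve 3 (λ x m k → x :* x :+ (:- (:- m :* x) :+ :- (m :* k)) := x :* x :+ :- (m :* (k :+ :- x))) ℙ.refl
                 X ⟪ m ⟫ ⟪ κ ⟫ ⟩
          γ ∎
          where
          θ+τ : const θ +P const τ ≐ negP ⟪ m ⟫
          θ+τ = ℙ.trans (ℙ.reflexive (≡.cong const sum-eq)) (ℙ.trans (const-negate 𝕂.⟪ m ⟫) (ℙ.-‿cong (const-⟪⟫ m)))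
          θτ : const θ *P const τ ≐ negP (⟪ m ⟫ *P ⟪ κ ⟫)
          θτ = ℙ.trans (ℙ.sym (const-* θ τ)) (ℙ.trans (ℙ.reflexive (≡.cong const product-eq))
            (ℙ.trans (const-negate 𝕂.⟪ m ℕ.* κ ⟫) (ℙ.-‿cong (ℙ.trans (const-⟪⟫ (m ℕ.* κ)) (⟪⟫-* m κ)))))

        γ^k : γ ^ k ≐ θ^ *P τ^ *P (θ^ *P τ^)
        γ^k = begin
          γ ^ k              ≡⟨ ≡.cong (γ ^_) k≡h+h ⟩
          γ ^ (h ℕ.+ h)      ≈⟨ ℙ.^-homo-* γ h h ⟩
          γ ^ h *P γ ^ h     ≈⟨ ℙ.*-cong γ^h γ^h ⟩
          θ^ *P τ^ *P (θ^ *P τ^) ∎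
          where
          γ^h : γ ^ h ≐ θ^ *P τ^
          γ^h = ℙ.trans (ℙ.^-congˡ h (ℙ.sym quadratic)) (product-^ (factor θ) (factor τ) h)

        leading-factor : γ +P ⟪ c ⟫ *P (⟪ m ⟫ *P β) ≐ factor λ₁ *P factor λ₁
        leading-factor = begin
          γ +P ⟪ c ⟫ *P (⟪ m ⟫ *P β)
            ≈⟨ ℙ.+-congˡ {γ} (ℙ.trans (ℙ.sym (ℙ.*-assoc ⟪ c ⟫ ⟪ m ⟫ β)) (ℙ.*-congʳ {β} (ℙ.trans (ℙ.sym ⟪n⟫) ⟪degree⟫))) ⟩
          γ +P (⟪ κ ⟫ +P ⟪ κ ⟫ +P (⟪ κ ⟫ +P ⟪ κ ⟫) +P ⟪ m ⟫) *P β
            ≈⟨ solve 3 (λ x m k → x :* x :+ :- (m :* (k :+ :- x)) :+ (k :+ k :+ (k :+ k) :+ m) :* (k :+ :- x) :=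
                 (x :+ :- (k :+ k)) :* (x :+ :- (k :+ k))) ℙ.refl X ⟪ m ⟫ ⟪ κ ⟫ ⟩
          (X +P negP (⟪ κ ⟫ +P ⟪ κ ⟫)) *P (X +P negP (⟪ κ ⟫ +P ⟪ κ ⟫))
            ≈⟨ ℙ.*-cong factor₁ factor₁ ⟨
          factor λ₁ *P factor λ₁ ∎
          where
          ⟪degree⟫ : ⟪ n ⟫ ≐ ⟪ κ ⟫ +P ⟪ κ ⟫ +P (⟪ κ ⟫ +P ⟪ κ ⟫) +P ⟪ m ⟫
          ⟪degree⟫ = begin
            ⟪ n ⟫                        ≡⟨ ≡.cong ⟪_⟫ degree ⟩
            ⟪ 4 ℕ.* κ ℕ.+ m ⟫            ≈⟨ ⟪⟫-+ (4 ℕ.* κ) m ⟩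
            ⟪ 4 ℕ.* κ ⟫ +P ⟪ m ⟫         ≈⟨ ℙ.+-congʳ {⟪ m ⟫} (⟪⟫-* 4 κ) ⟩
            ⟪ 4 ⟫ *P ⟪ κ ⟫ +P ⟪ m ⟫
              ≈⟨ solve 2 (λ k m → (:1 :+ (:1 :+ (:1 :+ (:1 :+ :0)))) :* k :+ m := k :+ k :+ (k :+ k) :+ m)
                   ℙ.refl ⟪ κ ⟫ ⟪ m ⟫ ⟩
            ⟪ κ ⟫ +P ⟪ κ ⟫ +P (⟪ κ ⟫ +P ⟪ κ ⟫) +P ⟪ m ⟫ ∎
          factor₁ : factor λ₁ ≐ X +P negP (⟪ κ ⟫ +P ⟪ κ ⟫)
          factor₁ = const-factor (ℙ.trans (ℙ.reflexive (≡.cong const eq₁)) (ℙ.trans (const-⟪⟫ (κ ℕ.+ κ)) (⟪⟫-+ κ κ)))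

        -- `square-injective` wants the same degree on both sides, and this is the only place where
        -- the multiplicities are added up: 1 + h + h + (n - c) = n.
        target-monic : Leading target n 1#
        target-monic = ≡.subst₂ (Leading target) degree-sum (𝕂-product)
          (leading-* (leading-^P (leading-linear λ₁) 1) (leading-* (leading-^P (leading-linear θ) h)
            (leading-* (leading-^P (leading-linear τ) h) (leading-* (leading-^P (leading-linear λ₀) e) (leading-const 1#)))))
          where
          degree-sum : 1 ℕ.+ (h ℕ.+ (h ℕ.+ (e ℕ.+ 0))) ≡ n
          degree-sum = ≡.trans (≡.cong suc (≡.trans (≡.sym (ℕₚ.+-assoc h h (e ℕ.+ 0)))
            (≡.cong₂ ℕ._+_ (≡.sym k≡h+h) (ℕₚ.+-identityʳ e))))
            (≡.trans (≡.cong (ℕ._+ e) (≡.sym c≡1+k)) (ℕₚ.m+[n∸m]≡n c≤n))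
          𝕂-product : 1# ⊗ (1# ⊗ (1# ⊗ (1# ⊗ 1#))) ≡ 1#
          𝕂-product = ≡.trans (𝕂.*-identityˡ _) (≡.trans (𝕂.*-identityˡ _)
            (≡.trans (𝕂.*-identityˡ _) (𝕂.*-identityˡ 1#)))

-- Finite local rings

open ≡ using (refl; sym; trans; cong; cong₂; subst; module ≡-Reasoning)
open Counting

-- If y were missed, punching it out of the codomain would inject `Fin (suc n)` into `Fin n`.
injective⇒surjective : ∀ {n} (f : Fin n → Fin n) → (∀ {x y} → f x ≡ f y → x ≡ y) → ∀ y → ∃ λ x → f x ≡ y
injective⇒surjective {suc n} f inj y with any? (λ x → f x ≟ᶠ y)
... | yes h = h
... | no ¬h = contradiction
  (injective⇒≤ {f = λ x → punchOut (avoids x)} (λ {x} {z} eq → inj (punchOut-injective (avoids x) (avoids z) eq)))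
  ℕₚ.1+n≰n
  where
  avoids : ∀ x → y ≢ f x
  avoids x eq = ¬h (x , sym eq)

record Quotient {n} (_~_ : Fin n → Fin n → Set) : Set where
  field
    classes   : ℕ
    class     : Fin n → Fin classes
    rep       : Fin classes → Fin n
    class-rep : ∀ i → class (rep i) ≡ i
    sound     : ∀ {x y} → x ~ y → class x ≡ class y
    complete  : ∀ {x y} → class x ≡ class y → x ~ y

-- Recursion on n: the point `zero` either joins the class of some `suc y` related to it or opens a
-- new class, with itself as representative.
quotient : ∀ {n} (_~_ : Fin n → Fin n → Set) → (∀ x y → Dec (x ~ y)) →
  (∀ {x} → x ~ x) → (∀ {x y} → x ~ y → y ~ x) → (∀ {x y z} → x ~ y → y ~ z → x ~ z) → Quotient _~_
quotient {zero} _~_ dec rfl sm tr = record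
  { classes = 0 ; class = λ () ; rep = λ () ; class-rep = λ ()
  ; sound = λ {x} → contradiction x (λ ()) ; complete = λ {x} → contradiction x (λ ()) }
quotient {suc n} _~_ dec rfl sm tr with quotient (λ x y → suc x ~ suc y) (λ x y → dec (suc x) (suc y)) rfl sm tr
                                   | any? (λ y → dec zero (suc y))
... | Q | yes (y , 0~y) = record
  { classes = classes ; class = c ; rep = suc ∘ rep ; class-rep = class-rep
  ; sound = λ {x} {y} → c-sound x y ; complete = λ {x} {y} → c-complete x y }
  where
  open Quotient Q
  c : Fin (suc n) → Fin classes
  c zero    = class y
  c (suc x) = class x
  c-sound : ∀ x z → x ~ z → c x ≡ c z
  c-sound zero    zero    h = refl
  c-sound zero    (suc z) h = sound (tr (sm 0~y) h)
  c-sound (suc x) zero    h = sound (tr h 0~y)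
  c-sound (suc x) (suc z) h = sound h
  c-complete : ∀ x z → c x ≡ c z → x ~ z
  c-complete zero    zero    h = rfl
  c-complete zero    (suc z) h = tr 0~y (complete h)
  c-complete (suc x) zero    h = tr (complete h) (sm 0~y)
  c-complete (suc x) (suc z) h = complete h
... | Q | no ¬0~ = record
  { classes = suc classes ; class = c ; rep = r
  ; class-rep = λ { zero → refl ; (suc i) → cong suc (class-rep i) }
  ; sound = λ {x} {y} → c-sound x y ; complete = λ {x} {y} → c-complete x y }
  where
  open Quotient Q
  c : Fin (suc n) → Fin (suc classes)
  c zero    = zero
  c (suc x) = suc (class x)
  r : Fin (suc classes) → Fin (suc n)
  r zero    = zero
  r (suc i) = suc (rep i)
  c-sound : ∀ x z → x ~ z → c x ≡ c z
  c-sound zero    zero    h = refl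
  c-sound zero    (suc z) h = contradiction (z , h) ¬0~
  c-sound (suc x) zero    h = contradiction (x , sm h) ¬0~
  c-sound (suc x) (suc z) h = cong suc (sound h)
  c-complete : ∀ x z → c x ≡ c z → x ~ z
  c-complete zero    zero    h = rfl
  c-complete (suc x) (suc z) h = complete (suc-injective h)

comprehension : ∀ {n} {P : Fin n → Set} → (∀ x → Dec (P x)) → Subset n
comprehension P? = tabulate (λ x → ⌊ P? x ⌋)

∈-comprehension⁺ : ∀ {n} {P : Fin n → Set} (P? : ∀ x → Dec (P x)) {x} → P x → x ∈ comprehension P?
∈-comprehension⁺ P? {x} p = lookup⇒[]= x _ (trans (lookup∘tabulate _ x) (is-true (P? x)))
  where
  is-true : ∀ d → ⌊ d ⌋ ≡ true
  is-true (yes _) = refl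
  is-true (no ¬p) = contradiction p ¬p

∈-comprehension⁻ : ∀ {n} {P : Fin n → Set} (P? : ∀ x → Dec (P x)) {x} → x ∈ comprehension P? → P x
∈-comprehension⁻ P? {x} x∈ with P? x | trans (sym (lookup∘tabulate (λ x → ⌊ P? x ⌋) x)) ([]=⇒lookup x∈)
... | yes p | _ = p
... | no _  | ()

∣∣≡count : ∀ {n} (p : Subset n) → ∣ p ∣ ≡ count (λ x → x ∈? p)
∣∣≡count []      = sym ∑-empty
∣∣≡count (true ∷ p)  = trans (cong suc (trans (∣∣≡count p)
  (count-cong (λ x → x ∈? p) (λ x → suc x ∈? (true ∷ p)) (λ x → there) (λ x → drop-there)))) (sym ∑-suc)
∣∣≡count (false ∷ p) = trans (trans (∣∣≡count p)
  (count-cong (λ x → x ∈? p) (λ x → suc x ∈? (false ∷ p)) (λ x → there) (λ x → drop-there))) (sym ∑-suc)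

-- Ideals of a finite ring

module Ideals (R : FiniteCommRing) where
  open FiniteCommRing R renaming (_+_ to infixl 6 _+_; _*_ to infixl 7 _*_; -_ to infix 8 -_)

  commutativeRing : CommutativeRing 0ℓ 0ℓ
  commutativeRing = record { isCommutativeRing = isCommRing }

  open CommutativeRing commutativeRing public
    using (+-identityˡ; +-identityʳ; *-identityˡ; zeroʳ; *-comm; *-assoc; +-comm; -‿inverseʳ)
  open Solver commutativeRing public

  -- The ideal I + R y.
  extension : Subset size → Fin size → Subset size
  extension I y = comprehension (λ z → any? (λ r → any? (λ s → (s ∈? I) ×-dec (z ≟ᶠ (s + (r * y))))))

  module _ {I : Subset size} (I-ideal : IsIdeal R I) (y : Fin size) where
    open IsIdeal I-ideal
    private
      intro : ∀ r s → s ∈ I → (s + (r * y)) ∈ extension I y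
      intro r s s∈ = ∈-comprehension⁺ _ (r , s , s∈ , refl)

      elim : ∀ {z} → z ∈ extension I y → ∃ λ r → ∃ λ s → s ∈ I × z ≡ s + (r * y)
      elim = ∈-comprehension⁻ _

    extension-ideal : IsIdeal R (extension I y)
    extension-ideal = record
      { 0∈ = subst (_∈ extension I y) (solve 1 (λ y → :0 :+ :0 :* y := :0) refl y) (intro 0# 0# 0∈)
      ; +-cl = λ a∈ b∈ → add (elim a∈) (elim b∈)
      ; *-cl = λ t a∈ → mul t (elim a∈)
      }
      where
      add : ∀ {a b} → (∃ λ r → ∃ λ s → s ∈ I × a ≡ s + (r * y)) → (∃ λ r → ∃ λ s → s ∈ I × b ≡ s + (r * y)) →
        (a + b) ∈ extension I y
      add (r , s , s∈ , refl) (r′ , s′ , s′∈ , refl) = subst (_∈ extension I y)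
        (solve 5 (λ r s r′ s′ y → s :+ s′ :+ (r :+ r′) :* y := s :+ r :* y :+ (s′ :+ r′ :* y)) refl r s r′ s′ y)
        (intro (r + r′) (s + s′) (+-cl s∈ s′∈))
      mul : ∀ {a} t → (∃ λ r → ∃ λ s → s ∈ I × a ≡ s + (r * y)) → (t * a) ∈ extension I y
      mul t (r , s , s∈ , refl) = subst (_∈ extension I y)
        (solve 4 (λ t r s y → t :* s :+ t :* r :* y := t :* (s :+ r :* y)) refl t r s y)
        (intro (t * r) (t * s) (*-cl t s∈))

    ⊆-extension : I ⊆ extension I y
    ⊆-extension {s} s∈ = subst (_∈ extension I y) (solve 2 (λ s y → s :+ :0 :* y := s) refl s y) (intro 0# s s∈)

    ∈-extension : y ∈ extension I y
    ∈-extension = subst (_∈ extension I y) (solve 1 (λ y → :0 :+ :1 :* y := y) refl y) (intro 1# 0# 0∈)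

    extension-least : ∀ {J} → IsIdeal R J → I ⊆ J → y ∈ J → extension I y ⊆ J
    extension-least {J} J-ideal I⊆J y∈J z∈ with elim z∈
    ... | r , s , s∈ , refl = IsIdeal.+-cl J-ideal (I⊆J s∈) (IsIdeal.*-cl J-ideal r y∈J)

  -- Well-founded induction on strict inclusion: adjoin elements as long as some I + R y with y
  -- outside I is proper. When none is left, an ideal J that is not inside I contains such an I + R
  -- y, and with it 1.
  maximal-above : ∀ I → IsIdeal R I → 1# ∉ I → ∃ λ N → IsMaximalIdeal R N × I ⊆ N
  maximal-above I = search I (⊃-wellFounded I)
    where
    search : ∀ I → Acc _⊃_ I → IsIdeal R I → 1# ∉ I → ∃ λ N → IsMaximalIdeal R N × I ⊆ N
    search I (acc larger) I-ideal 1∉I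
      with any? (λ y → ¬? (y ∈? I) ×-dec ¬? (1# ∈? extension I y))
    ... | yes (y , y∉I , 1∉) =
      let N , N-max , ⊆N = search (extension I y) (larger (⊆-extension I-ideal y , y , ∈-extension I-ideal y , y∉I))
                             (extension-ideal I-ideal y) 1∉
      in N , N-max , λ x∈I → ⊆N (⊆-extension I-ideal y x∈I)
    ... | no none = I , record { ideal = I-ideal ; proper = 1∉I ; maximal = maximal } , λ x∈ → x∈
      where
      maximal : ∀ J → IsIdeal R J → I ⊆ J → J ⊆ I ⊎ 1# ∈ J
      maximal J J-ideal I⊆J with any? (λ y → (y ∈? J) ×-dec ¬? (y ∈? I))
      ... | no ¬∃ = inj₁ λ {x} x∈J → decidable-stable (x ∈? I) (λ x∉I → ¬∃ (x , x∈J , x∉I))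
      ... | yes (y , y∈J , y∉I) = inj₂ (extension-least I-ideal y J-ideal I⊆J y∈J
              (decidable-stable (1# ∈? extension I y) (λ 1∉ → none (y , y∉I , 1∉))))

  zero-ideal : Subset size
  zero-ideal = comprehension (_≟ᶠ 0#)

  zero-ideal-ideal : IsIdeal R zero-ideal
  zero-ideal-ideal = record
    { 0∈ = intro refl
    ; +-cl = λ a∈ b∈ → intro (trans (cong₂ _+_ (elim a∈) (elim b∈)) (+-identityʳ 0#))
    ; *-cl = λ r a∈ → intro (trans (cong (r *_) (elim a∈)) (zeroʳ r)) }
    where
    intro : ∀ {x} → x ≡ 0# → x ∈ zero-ideal
    intro = ∈-comprehension⁺ _
    elim : ∀ {x} → x ∈ zero-ideal → x ≡ 0#
    elim = ∈-comprehension⁻ _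

-- Units and cosets of the maximal ideal

module Local (R : FiniteCommRing) (M : Subset (FiniteCommRing.size R)) (local : IsLocalWith R M) where
  open FiniteCommRing R renaming (_+_ to infixl 6 _+_; _*_ to infixl 7 _*_; -_ to infix 8 -_)
  open Ideals R public
  open IsMaximalIdeal (proj₁ local)
  open IsIdeal ideal renaming (0∈ to 0∈M; +-cl to +-M; *-cl to *-M) public

  Unit : Fin size → Set
  Unit = IsUnit R

  Unit? : ∀ u → Dec (Unit u)
  Unit? = isUnit? R

  -- A nonunit generates a proper ideal; this lies in some maximal ideal, which by locality is M.
  ∉M⇒unit : ∀ {x} → x ∉ M → Unit x
  ∉M⇒unit {x} x∉M with Unit? x
  ... | yes u = u
  ... | no ¬u with maximal-above (extension zero-ideal x) (extension-ideal zero-ideal-ideal x) 1∉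
    where
    1∉ : 1# ∉ extension zero-ideal x
    1∉ 1∈ with ∈-comprehension⁻ _ 1∈
    ... | r , s , s∈ , 1≡ = ¬u (r , trans (*-comm x r) (sym (trans 1≡
            (trans (cong (_+ (r * x)) (∈-comprehension⁻ (_≟ᶠ 0#) s∈)) (+-identityˡ _)))))
  ... | N , N-max , ⊆N = contradiction
    (subst (x ∈_) (proj₂ local N N-max) (⊆N (∈-extension zero-ideal-ideal x))) x∉M

  unit⇒∉M : ∀ {x} → Unit x → x ∉ M
  unit⇒∉M {x} (v , eq) x∈M = proper (subst (_∈ M) (trans (*-comm v x) eq) (*-M v x∈M))

  neg-M : ∀ {x} → x ∈ M → (- x) ∈ M
  neg-M {x} x∈ = subst (_∈ M) (solve 1 (λ x → :- :1 :* x := :- x) refl x) (*-M (- 1#) x∈)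

  unit-* : ∀ {x y} → Unit x → Unit y → Unit (x * y)
  unit-* {x} {y} (v , p) (w , q) = v * w , trans
    (solve 4 (λ x y v w → x :* y :* (v :* w) := x :* v :* (y :* w)) refl x y v w)
    (trans (cong₂ _*_ p q) (*-identityˡ 1#))

  unit-1 : Unit 1#
  unit-1 = 1# , *-identityˡ 1#

  unit-neg : ∀ {x} → Unit x → Unit (- x)
  unit-neg {x} (v , p) = - v , trans (solve 2 (λ x v → :- x :* :- v := x :* v) refl x v) p

  unit-factor : ∀ {x y} → Unit (x * y) → Unit y
  unit-factor {x} {y} (v , p) = x * v , trans (solve 3 (λ x y v → y :* (x :* v) := x :* y :* v) refl x y v) p

  unit-+M : ∀ {x a} → Unit x → a ∈ M → Unit (x + a)
  unit-+M {x} {a} u a∈ = ∉M⇒unit λ x+a∈ → unit⇒∉M u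
    (subst (_∈ M) (solve 2 (λ x a → x :+ a :+ :- a := x) refl x a) (+-M x+a∈ (neg-M a∈)))

  unit-cancel : ∀ {u x y} → Unit u → u * x ≡ u * y → x ≡ y
  unit-cancel {u} {x} {y} (v , p) eq = trans (lemma x) (trans (cong (v *_) eq) (sym (lemma y)))
    where
    lemma : ∀ x → x ≡ v * (u * x)
    lemma x = trans (sym (*-identityˡ x)) (trans (cong (_* x) (sym p))
      (solve 3 (λ u v x → u :* v :* x := v :* (u :* x)) refl u v x))

  unit-annihilates : ∀ {u x} → Unit u → u * x ≡ 0# → x ≡ 0#
  unit-annihilates {u} unit eq = unit-cancel unit (trans eq (sym (zeroʳ u)))

  difference≡0 : ∀ {x y} → x + - y ≡ 0# → x ≡ y
  difference≡0 {x} {y} h = trans (solve 2 (λ x y → x := (x :+ :- y) :+ y) refl x y)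
    (trans (cong (_+ y) h) (+-identityˡ y))

  translate-count : ∀ {P : Fin size → Set} (P? : ∀ x → Dec (P x)) y → count (λ x → P? (x + - y)) ≡ count P?
  translate-count P? y = count-bijection P? (λ x → x + - y) (λ x → x + y)
    (λ x → solve 2 (λ x y → x :+ y :+ :- y := x) refl x y)
    (λ x → solve 2 (λ x y → x :+ :- y :+ y := x) refl x y)

  m : ℕ
  m = ∣ M ∣

  m≡count : m ≡ count (λ x → x ∈? M)
  m≡count = ∣∣≡count M

  m≢0 : m ≢ 0
  m≢0 eq = count≡0⇒none (λ x → x ∈? M) (trans (sym m≡count) eq) 0# 0∈M

  opaque
    cosets : Quotient (λ x y → (x + - y) ∈ M)
    cosets = quotient _ (λ x y → (x + - y) ∈? M)
      (λ {x} → subst (_∈ M) (sym (-‿inverseʳ x)) 0∈M)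
      (λ {x} {y} h → subst (_∈ M) (solve 2 (λ x y → :- (x :+ :- y) := y :+ :- x) refl x y) (neg-M h))
      (λ {x} {y} {z} h k → subst (_∈ M)
        (solve 3 (λ x y z → x :+ :- y :+ (y :+ :- z) := x :+ :- z) refl x y z) (+-M h k))

  open Quotient cosets public

  class-count : ∀ j → count (λ x → class x ≟ᶠ j) ≡ m
  class-count j = begin
    count (λ x → class x ≟ᶠ j)
      ≡⟨ count-cong (λ x → class x ≟ᶠ j) (λ x → (x + - rep j) ∈? M)
           (λ x h → complete (trans h (sym (class-rep j)))) (λ x h → trans (sound h) (class-rep j)) ⟩
    count (λ x → (x + - rep j) ∈? M)   ≡⟨ translate-count (λ x → x ∈? M) (rep j) ⟩
    count (λ x → x ∈? M)                 ≡⟨ m≡count ⟨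
    m                                    ∎
    where open ≡.≡-Reasoning

  size≡classes*m : size ≡ classes ℕ.* m
  size≡classes*m = begin
    size
      ≡⟨ ℕₚ.*-identityʳ size ⟨
    size ℕ.* 1
      ≡⟨ ∑-const-* size 1 ⟨
    count {size} (λ _ → yes tt)
      ≡⟨ count-fibres (λ _ → yes tt) class ⟩
    ∑ (λ j → count (λ x → yes tt ×-dec (class x ≟ᶠ j)))
      ≡⟨ ∑-cong (λ j → trans (count-cong (λ x → yes tt ×-dec (class x ≟ᶠ j)) (λ x → class x ≟ᶠ j)
           (λ x → proj₂) (λ x h → tt , h)) (class-count j)) ⟩
    ∑ {classes} (λ _ → m)
      ≡⟨ ∑-const-* classes m ⟩
    classes ℕ.* m ∎
    where
    open ≡.≡-Reasoning

  units+m≡size : count Unit? ℕ.+ m ≡ size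
  units+m≡size = begin
    count Unit? ℕ.+ m                      ≡⟨ cong (count Unit? ℕ.+_) m≡count ⟩
    count Unit? ℕ.+ count (λ x → x ∈? M)   ≡⟨ ∑-+ _ _ ⟨
    ∑ (λ x → bit (Unit? x) ℕ.+ bit (x ∈? M))
      ≡⟨ ∑-cong partition ⟩
    ∑ {size} (λ _ → 1)                     ≡⟨ ∑-const-* size 1 ⟩
    size ℕ.* 1                             ≡⟨ ℕₚ.*-identityʳ size ⟩
    size                                   ∎
    where
    open ≡.≡-Reasoning
    partition : ∀ x → bit (Unit? x) ℕ.+ bit (x ∈? M) ≡ 1
    partition x with x ∈? M
    ... | yes x∈ = cong (ℕ._+ 1) (bit-no (Unit? x) (λ u → unit⇒∉M u x∈))
    ... | no x∉  = cong (ℕ._+ 0) (bit-yes (Unit? x) (∉M⇒unit x∉))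

  shift : Fin classes → Fin classes
  shift i = class (rep i + 1#)

  -- If 2 ∈ M, translation by 1 pairs up the cosets.
  shift-involutive : (1# + 1#) ∈ M → ∀ i → shift (shift i) ≡ i
  shift-involutive 2∈M i = trans (sound related) (class-rep i)
    where
    cancel-shift : ∀ r s → s + (- (r + 1#)) + (1# + 1#) ≡ s + 1# + - r
    cancel-shift = solve 2 (λ r s → s :+ :- (r :+ :1) :+ (:1 :+ :1) := s :+ :1 :+ :- r) refl
    related : (rep (shift i) + 1# + - rep i) ∈ M
    related = subst (_∈ M) (cancel-shift (rep i) (rep (shift i))) (+-M (complete (class-rep (shift i))) 2∈M)

  shift-moves : ∀ i → shift i ≢ i
  shift-moves i fixed = proper (subst (_∈ M) (cancel-rep (rep i)) (complete (trans fixed (sym (class-rep i)))))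
    where
    cancel-rep : ∀ r → r + 1# + - r ≡ 1#
    cancel-rep = solve 1 (λ r → r :+ :1 :+ :- r := :1) refl

  -- Otherwise `shift` would be an involution of the cosets without fixed points, and their number
  -- would be even.
  odd⇒2∉M : ∀ k → classes ≡ suc (2 ℕ.* k) → (1# + 1#) ∉ M
  odd⇒2∉M k odd 2∈M = ℕₚ.even≢odd (proj₁ pairs) k (begin
    2 ℕ.* proj₁ pairs              ≡⟨ cong (proj₁ pairs ℕ.+_) (ℕₚ.+-identityʳ (proj₁ pairs)) ⟩
    proj₁ pairs ℕ.+ proj₁ pairs    ≡⟨ cong (ℕ._+ (proj₁ pairs ℕ.+ proj₁ pairs))
                                       (count-none (λ i → yes tt ×-dec (shift i ≟ᶠ i)) (λ i h → shift-moves i (proj₂ h))) ⟨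
    count (λ i → yes tt ×-dec (shift i ≟ᶠ i)) ℕ.+ (proj₁ pairs ℕ.+ proj₁ pairs)
                                   ≡⟨ proj₂ pairs ⟨
    count {classes} (λ _ → yes tt) ≡⟨ ∑-const-* classes 1 ⟩
    classes ℕ.* 1                  ≡⟨ ℕₚ.*-identityʳ classes ⟩
    classes                        ≡⟨ odd ⟩
    suc (2 ℕ.* k)                  ∎)
    where
    open ≡.≡-Reasoning
    pairs = count-involution {classes} (λ _ → yes tt) shift (shift-involutive 2∈M) (λ _ _ → tt)

-- Squares among the units

private
  even-cofactor : ∀ k m → 2 ℕ.* (2 ℕ.* (k ℕ.* m)) ℕ.+ m ≡ (1 ℕ.+ k ℕ.* 4) ℕ.* m
  even-cofactor = solve-∀

  drop-one : ∀ k m → (3 ℕ.+ k ℕ.* 4) ℕ.* m ≡ (2 ℕ.+ k ℕ.* 4) ℕ.* m ℕ.+ m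
  drop-one = solve-∀

  -- The number (q - 1) m for q = 4 k + 3 and m = 2 j + 1, shown to be twice an odd number.
  odd-cofactor : ∀ k j → (2 ℕ.+ k ℕ.* 4) ℕ.* suc (2 ℕ.* j) ≡ 2 ℕ.* suc (2 ℕ.* (k ℕ.+ j ℕ.* (k ℕ.* 2 ℕ.+ 1)))
  odd-cofactor = solve-∀

  double-product : ∀ a k → a ℕ.* (k ℕ.+ k) ≡ k ℕ.* (a ℕ.+ a)
  double-product = solve-∀

module Squares (R : FiniteCommRing) (M : Subset (FiniteCommRing.size R)) (local : IsLocalWith R M)
  (2∉M : FiniteCommRing._+_ R (FiniteCommRing.1# R) (FiniteCommRing.1# R) ∉ M) where
  open FiniteCommRing R renaming (_+_ to infixl 6 _+_; _*_ to infixl 7 _*_; -_ to infix 8 -_)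
  open Local R M local public

  2-unit : Unit (1# + 1#)
  2-unit = ∉M⇒unit 2∉M

  double : ∀ x → (1# + 1#) * x ≡ x + x
  double = solve 1 (λ x → (:1 :+ :1) :* x := x :+ x) refl

  double-injective : ∀ {x} → x + x ≡ 0# → x ≡ 0#
  double-injective {x} eq = unit-annihilates 2-unit (trans (double x) eq)

  unit≢neg : ∀ {u} → Unit u → u ≢ - u
  unit≢neg {u} unit eq = unit⇒∉M unit (subst (_∈ M) (sym (double-injective
    (trans (cong (u +_) eq) (-‿inverseʳ u)))) 0∈M)

  -- One of x - u and x + u is a unit, since their difference 2u is not in M.
  same-square : ∀ {u x} → Unit u → x * x ≡ u * u → x ≡ u ⊎ x ≡ - u
  same-square {u} {x} unit eq = by-cases ((x + - u) ∈? M)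
    where
    product≡0 : (x + - u) * (x + u) ≡ 0#
    product≡0 = trans (solve 2 (λ x u → (x :+ :- u) :* (x :+ u) := x :* x :+ :- (u :* u)) refl x u)
      (trans (cong (_+ - (u * u)) eq) (-‿inverseʳ _))
    by-cases : Dec ((x + - u) ∈ M) → x ≡ u ⊎ x ≡ - u
    by-cases (no x-u∉M) = inj₂ (trans (solve 2 (λ x u → x := x :+ u :+ :- u) refl x u)
      (trans (cong (_+ - u) (unit-annihilates (∉M⇒unit x-u∉M) product≡0)) (+-identityˡ _)))
    by-cases (yes x-u∈M) = inj₁ (difference≡0 (unit-annihilates sum-unit
      (trans (*-comm (x + u) (x + - u)) product≡0)))
      where
      sum-unit : Unit (x + u)
      sum-unit = subst Unit (solve 2 (λ x u → (:1 :+ :1) :* u :+ (x :+ :- u) := x :+ u) refl x u)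
        (unit-+M (unit-* 2-unit unit) x-u∈M)

  Square : Fin size → Set
  Square x = ∃ λ u → Unit u × x ≡ u * u

  Square? : ∀ x → Dec (Square x)
  Square? x = any? (λ u → Unit? u ×-dec (x ≟ᶠ (u * u)))

  square⇒unit : ∀ {x} → Square x → Unit x
  square⇒unit (u , unit , refl) = unit-* unit unit

  square-* : ∀ {x y} → Square x → Square y → Square (x * y)
  square-* (u , u-unit , refl) (v , v-unit , refl) = u * v , unit-* u-unit v-unit ,
    solve 2 (λ u v → u :* u :* (v :* v) := u :* v :* (u :* v)) refl u v

  square-1 : Square 1#
  square-1 = 1# , unit-1 , sym (*-identityˡ 1#)

  square-self : ∀ {u} → Unit u → Square (u * u)
  square-self {u} unit = u , unit , refl

  square-inverse : ∀ {x y} → x * y ≡ 1# → Square x → Square y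
  square-inverse {x} {y} eq (u , unit , refl) = subst Square
    -- The root of y is u y: from u² y = 1 follows (u y)² = y.
    (trans (solve 2 (λ u y → u :* y :* (u :* y) := u :* u :* y :* y) refl u y)
           (trans (cong (_* y) eq) (*-identityˡ y)))
    (square-self (unit-* unit (unit-factor (subst Unit (sym eq) unit-1))))

  square-cancel : ∀ {x y} → Square x → Square (x * y) → Square y
  square-cancel {x} {y} (u , unit@(v , uv≡1) , refl) sq = subst Square
    (trans (solve 3 (λ u v y → v :* v :* (u :* u :* y) := u :* v :* (u :* v) :* y) refl u v y)
      (trans (cong (_* y) (trans (cong₂ _*_ uv≡1 uv≡1) (*-identityˡ 1#))) (*-identityˡ y)))
    (square-* (square-self (unit-factor {u} (subst Unit (sym uv≡1) unit-1))) sq)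

  -- Squaring 1 + x is, on M, the injective map x ↦ 2x + x² followed by 1 + _.
  1+M-square : ∀ {a} → a ∈ M → Square (1# + a)
  1+M-square {a} a∈M = root (injective⇒surjective f (λ {x} {y} → f-injective x y) a)
    where
    -- Extended by the identity outside M to an injection of the whole ring. The two pieces cannot
    -- collide, as the first maps M into M, and for the same reason a preimage of a lies in M.
    f-by : ∀ x → Dec (x ∈ M) → Fin size
    f-by x (yes _) = x + x + x * x
    f-by x (no _)  = x
    f : Fin size → Fin size
    f x = f-by x (x ∈? M)
    f∈M : ∀ {x} → x ∈ M → x + x + x * x ∈ M
    f∈M {x} x∈ = +-M (+-M x∈ x∈) (*-M x x∈)
    f-injective-by : ∀ x y d e → f-by x d ≡ f-by y e → x ≡ y
    f-injective-by x y (no _)   (no _)   eq = eq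
    f-injective-by x y (yes x∈) (no y∉)  eq = contradiction (subst (_∈ M) eq (f∈M x∈)) y∉
    f-injective-by x y (no x∉)  (yes y∈) eq = contradiction (subst (_∈ M) (sym eq) (f∈M y∈)) x∉
    -- The difference of the values factors as (2 + x + y) (x - y), and 2 + x + y is a unit because
    -- x + y ∈ M.
    f-injective-by x y (yes x∈) (yes y∈) eq = difference≡0 (unit-annihilates
      (unit-+M 2-unit (+-M x∈ y∈))
      (trans (solve 2 (λ x y → (:1 :+ :1 :+ (x :+ y)) :* (x :+ :- y) :=
                x :+ x :+ x :* x :+ :- (y :+ y :+ y :* y)) refl x y)
             (trans (cong (_+ - (y + y + y * y)) eq) (-‿inverseʳ _))))
    f-injective : ∀ x y → f x ≡ f y → x ≡ y
    f-injective x y = f-injective-by x y (x ∈? M) (y ∈? M)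
    root-by : ∀ x d → f-by x d ≡ a → Square (1# + a)
    root-by x (no x∉) refl = contradiction a∈M x∉
    root-by x (yes x∈) refl = 1# + x , unit-+M unit-1 x∈ ,
      solve 1 (λ x → :1 :+ (x :+ x :+ x :* x) := (:1 :+ x) :* (:1 :+ x)) refl x
    root : (∃ λ x → f x ≡ a) → Square (1# + a)
    root (x , eq) = root-by x (x ∈? M) eq

  -- With v the inverse of u, u² + a = u² (1 + v² a), and v² a ∈ M. So being a square is a property
  -- of the coset.
  square-+M : ∀ {x a} → Square x → a ∈ M → Square (x + a)
  square-+M {x} {a} (u , unit@(v , uv≡1) , refl) a∈M = subst Square
    (trans (solve 3 (λ u v a → u :* u :* (:1 :+ v :* v :* a) := u :* u :+ u :* v :* (u :* v) :* a) refl u v a)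
      (cong (u * u +_) (trans (cong (_* a) (trans (cong₂ _*_ uv≡1 uv≡1) (*-identityˡ 1#))) (*-identityˡ a))))
    (square-* (square-self unit) (1+M-square (*-M (v * v) a∈M)))

  Nonsquare : Fin size → Set
  Nonsquare x = Unit x × ¬ Square x

  Nonsquare? : ∀ x → Dec (Nonsquare x)
  Nonsquare? x = Unit? x ×-dec ¬? (Square? x)

  squares nonsquares : ℕ
  squares    = count Square?
  nonsquares = count Nonsquare?

  units≡squares+nonsquares : count Unit? ≡ squares ℕ.+ nonsquares
  units≡squares+nonsquares = trans (count-split Unit? Square?)
    (cong (ℕ._+ nonsquares) (count-cong (λ x → Unit? x ×-dec Square? x) Square?
      (λ x → proj₂) (λ x sq → square⇒unit sq , sq)))

  roots-count : ∀ y → count (λ x → Unit? x ×-dec (x * x ≟ᶠ y)) ≡ bit (Square? y) ℕ.+ bit (Square? y)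
  roots-count y = by-cases (Square? y)
    where
    root? = λ x → Unit? x ×-dec (x * x ≟ᶠ y)
    by-cases : (d : Dec (Square y)) → count root? ≡ bit d ℕ.+ bit d
    by-cases (no ¬sq) = count-none root? (λ { x (unit , refl) → ¬sq (square-self unit) })
    by-cases (yes (u , unit , refl)) = trans (count-split root? (λ x → u ≟ᶠ x)) (cong₂ ℕ._+_
      (trans (count-cong (λ x → root? x ×-dec (u ≟ᶠ x)) (λ x → u ≟ᶠ x) (λ x → proj₂)
        (λ { x refl → (unit , refl) , refl })) (count-≡ u))
      (trans (count-cong (λ x → root? x ×-dec ¬? (u ≟ᶠ x)) (λ x → - u ≟ᶠ x) other-root
        (λ { x refl → (unit-neg unit , solve 1 (λ u → :- u :* :- u := u :* u) refl u) , unit≢neg unit }))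
        (count-≡ (- u))))
      where
      other-root : ∀ x → (Unit x × x * x ≡ u * u) × u ≢ x → - u ≡ x
      other-root x ((_ , eq) , u≢x) = resolve (same-square unit eq)
        where
        resolve : x ≡ u ⊎ x ≡ - u → - u ≡ x
        resolve (inj₁ x≡u)  = contradiction (sym x≡u) u≢x
        resolve (inj₂ x≡-u) = sym x≡-u

  units≡squares+squares : count Unit? ≡ squares ℕ.+ squares
  units≡squares+squares = begin
    count Unit?
      ≡⟨ count-fibres Unit? (λ x → x * x) ⟩
    ∑ (λ y → count (λ x → Unit? x ×-dec (x * x ≟ᶠ y)))
      ≡⟨ ∑-cong roots-count ⟩
    ∑ (λ y → bit (Square? y) ℕ.+ bit (Square? y))
      ≡⟨ ∑-+ _ _ ⟩
    squares ℕ.+ squares ∎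
    where open ≡.≡-Reasoning

  nonsquares≡squares : nonsquares ≡ squares
  nonsquares≡squares = ℕₚ.+-cancelˡ-≡ squares _ _
    (trans (sym units≡squares+nonsquares) units≡squares+squares)

  squares≢0 : squares ≢ 0
  squares≢0 eq = count≡0⇒none Square? eq 1# square-1

  nonsquare-exists : ∃ Nonsquare
  nonsquare-exists = decidable-stable (any? Nonsquare?) λ none →
    squares≢0 (trans (sym nonsquares≡squares) (count-none Nonsquare? (λ x n → none (x , n))))

  square*nonsquare : ∀ {x y} → Square x → Nonsquare y → Nonsquare (x * y)
  square*nonsquare sq (unit , ¬sq) = unit-* (square⇒unit sq) unit , ¬sq ∘ square-cancel sq

  -- x ↦ g⁻¹ x maps the nonsquares to the squares, because there are equally many of both.
  nonsquare*nonsquare : ∀ {g h} → Nonsquare g → Nonsquare h → Square (g * h)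
  nonsquare*nonsquare {g} {h} g-non@(g-unit@(g′ , gg′≡1) , ¬g-sq) h-non =
    subst Square (trans (solve 3 (λ g g′ h → g :* g :* (g′ :* h) := g :* g′ :* (g :* h)) refl g g′ h)
        (trans (cong (_* (g * h)) gg′≡1) (*-identityˡ _)))
      (square-* (square-self g-unit)
        -- If g′ x is a square, then x = g (g′ x) is a nonsquare; equal counts reverse the
        -- inclusion, so g′ h is a square, and g h = g² (g′ h).
        (count-antisym (λ x → Square? (g′ * x)) Nonsquare?
          (λ x sq → subst Nonsquare (g′g-cancel x) (subst Nonsquare (*-comm (g′ * x) g) (square*nonsquare sq g-non)))
          (trans (count-bijection Square? (g′ *_) (g *_) (λ x → trans (sym (*-assoc g′ g x))
              (trans (cong (_* x) (trans (*-comm g′ g) gg′≡1)) (*-identityˡ x))) g′g-cancel)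
            (sym nonsquares≡squares)) h h-non))
    where
    g′g-cancel : ∀ x → g * (g′ * x) ≡ x
    g′g-cancel x = trans (sym (*-assoc g g′ x)) (trans (cong (_* x) gg′≡1) (*-identityˡ x))

  -- Negation pairs up the elements of M other than 0, since - x = x gives 2 x = 0 and 2 is a unit.
  m-odd : ∃ λ k → m ≡ suc (2 ℕ.* k)
  m-odd = proj₁ pairs , (begin
    m
      ≡⟨ m≡count ⟩
    count (λ x → x ∈? M)
      ≡⟨ proj₂ pairs ⟩
    count (λ x → (x ∈? M) ×-dec (- x ≟ᶠ x)) ℕ.+ (proj₁ pairs ℕ.+ proj₁ pairs)
      ≡⟨ cong₂ ℕ._+_ (trans (count-cong (λ x → (x ∈? M) ×-dec (- x ≟ᶠ x)) (λ x → 0# ≟ᶠ x)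
           (λ x (_ , eq) → sym (double-injective (trans (cong (_+ x) (sym eq)) (trans (+-comm (- x) x) (-‿inverseʳ x)))))
           (λ { x refl → 0∈M , solve 0 (:- :0 := :0) refl })) (count-≡ 0#))
           (cong (proj₁ pairs ℕ.+_) (sym (ℕₚ.+-identityʳ _))) ⟩
    suc (2 ℕ.* proj₁ pairs) ∎)
    where
    open ≡.≡-Reasoning
    pairs = count-involution (λ x → x ∈? M) -_ (solve 1 (λ x → :- (:- x) := x) refl) (λ x → neg-M)

  -- When - 1 is a square, negation acts on the squares, and it fixes no unit.
  squares-even : Square (- 1#) → ∃ λ k → squares ≡ 2 ℕ.* k
  squares-even sq = proj₁ pairs , trans (proj₂ pairs) (cong₂ ℕ._+_
    (count-none (λ x → Square? x ×-dec (- x ≟ᶠ x)) (λ x (s , eq) → unit≢neg (square⇒unit s) (sym eq)))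
    (cong (proj₁ pairs ℕ.+_) (sym (ℕₚ.+-identityʳ _))))
    where
    pairs = count-involution Square? -_ (solve 1 (λ x → :- (:- x) := x) refl)
      (λ x s → subst Square (solve 1 (λ x → :- :1 :* x := :- x) refl x) (square-* sq s))

  -- Inversion continued by the identity to the nonunits, so as to be a total involution. The
  -- decision is an argument in order that two nested decisions can be matched independently.
  invert-by : ∀ x → Dec (Unit x) → Fin size
  invert-by x (yes (v , _)) = v
  invert-by x (no _)        = x

  invert : Fin size → Fin size
  invert x = invert-by x (Unit? x)

  invert-involutive : ∀ x → invert (invert x) ≡ x
  invert-involutive x = by x (Unit? x) (Unit? _)
    where
    by : ∀ x d (e : Dec (Unit (invert-by x d))) → invert-by (invert-by x d) e ≡ x
    by x (yes (v , xv≡1)) (yes (w , vw≡1)) = unit-cancel (x , trans (*-comm v x) xv≡1)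
      (trans vw≡1 (trans (sym xv≡1) (*-comm x v)))
    by x (yes (v , xv≡1)) (no ¬v) = contradiction (x , trans (*-comm v x) xv≡1) ¬v
    by x (no ¬x) (yes x-unit) = contradiction x-unit ¬x
    by x (no ¬x) (no _) = refl

  x*invert : ∀ {x} → Unit x → x * invert x ≡ 1#
  x*invert {x} unit = by (Unit? x)
    where
    by : ∀ d → x * invert-by x d ≡ 1#
    by (yes (v , eq)) = eq
    by (no ¬unit)     = contradiction unit ¬unit

  -- Inversion fixes only 1 and - 1, and - 1 is not a square.
  squares-odd : ¬ Square (- 1#) → ∃ λ k → squares ≡ suc (2 ℕ.* k)
  squares-odd ¬sq = proj₁ pairs , trans (proj₂ pairs) (cong₂ ℕ._+_
    (trans (count-cong (λ x → Square? x ×-dec (invert x ≟ᶠ x)) (λ x → 1# ≟ᶠ x) fixed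
      (λ { x refl → square-1 , trans (sym (*-identityˡ (invert 1#))) (x*invert unit-1) })) (count-≡ 1#))
    (cong (proj₁ pairs ℕ.+_) (sym (ℕₚ.+-identityʳ _))))
    where
    pairs = count-involution Square? invert invert-involutive
      (λ x s → square-inverse (x*invert (square⇒unit s)) s)
    fixed : ∀ x → Square x × invert x ≡ x → 1# ≡ x
    fixed x (s , eq) = resolve (same-square unit-1
      (trans (subst (λ y → x * y ≡ 1#) eq (x*invert (square⇒unit s))) (sym (*-identityˡ 1#))))
      where
      resolve : x ≡ 1# ⊎ x ≡ - 1# → 1# ≡ x
      resolve (inj₁ h) = sym h
      resolve (inj₂ h) = contradiction (subst Square h s) ¬sq

  -- The number of ways to write d as a square plus a nonsquare. Its value at 1 is the constant κ.
  sums : Fin size → ℕ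
  sums d = count (λ z → Square? z ×-dec Nonsquare? (d + - z))

  -- For d in M the element d - z lies in the coset of - z, which is a square along with z.
  sums-on-M : ∀ {d} → Square (- 1#) → d ∈ M → sums d ≡ 0
  sums-on-M {d} -1-sq d∈M = count-none (λ z → Square? z ×-dec Nonsquare? (d + - z))
    (λ z (z-sq , _ , ¬sq) → ¬sq (subst Square (+-comm (- z) d)
      (square-+M (subst Square (solve 1 (λ z → :- :1 :* z := :- z) refl z) (square-* -1-sq z-sq)) d∈M)))

  -- Multiplication by a square preserves the two classes, by a nonsquare exchanges them.
  sums-unit : ∀ {d} → Unit d → sums d ≡ sums 1#
  sums-unit {d} d-unit@(d′ , dd′≡1) = by-cases (Square? d)
    where
    open ≡.≡-Reasoning
    d-cancel : ∀ x → d * (d′ * x) ≡ x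
    d-cancel x = trans (sym (*-assoc d d′ x)) (trans (cong (_* x) dd′≡1) (*-identityˡ x))
    d′-cancel : ∀ x → d′ * (d * x) ≡ x
    d′-cancel x = trans (sym (*-assoc d′ d x)) (trans (cong (_* x) (trans (*-comm d′ d) dd′≡1)) (*-identityˡ x))
    d′-unit : Unit d′
    d′-unit = d , trans (*-comm d′ d) dd′≡1
    rescale : ∀ z → d + - (d * z) ≡ d * (1# + - z)
    rescale z = solve 2 (λ d z → d :+ :- (d :* z) := d :* (:1 :+ :- z)) refl d z

    stretched : sums d ≡ count (λ z → Square? (d * z) ×-dec Nonsquare? (d + - (d * z)))
    stretched = sym (count-bijection (λ z → Square? z ×-dec Nonsquare? (d + - z)) (d *_) (d′ *_) d-cancel d′-cancel)

    by-cases : Dec (Square d) → sums d ≡ sums 1#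
    by-cases (yes d-sq) = trans stretched (count-cong
      (λ z → Square? (d * z) ×-dec Nonsquare? (d + - (d * z)))
      (λ z → Square? z ×-dec Nonsquare? (1# + - z))
      (λ z (s , n) → square-cancel d-sq s ,
        subst Nonsquare (trans (cong (d′ *_) (rescale z)) (d′-cancel _)) (square*nonsquare d′-sq n))
      (λ z (s , n) → square-* d-sq s , subst Nonsquare (sym (rescale z)) (square*nonsquare d-sq n)))
      where
      d′-sq : Square d′
      d′-sq = square-inverse dd′≡1 d-sq
    by-cases (no ¬d-sq) = begin
      sums d
        ≡⟨ stretched ⟩
      count (λ z → Square? (d * z) ×-dec Nonsquare? (d + - (d * z)))
        ≡⟨ count-cong (λ z → Square? (d * z) ×-dec Nonsquare? (d + - (d * z)))
             -- Multiplication by d exchanges squares and nonsquares, so now z is the nonsquare and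
             -- 1 - z the square; the reflection of z to 1 - z restores the order of the summands.
             (λ z → Square? (1# + - z) ×-dec Nonsquare? (1# + - (1# + - z)))
             (λ z (s , n) → subst Square (trans (cong (d′ *_) (rescale z)) (d′-cancel _)) (nonsquare*nonsquare d′-non n) ,
               subst Nonsquare (trans (trans (*-comm (d * z) d′) (d′-cancel z)) (flip-twice z)) (square*nonsquare s d′-non))
             (λ z (s , n) → nonsquare*nonsquare d-non (subst Nonsquare (sym (flip-twice z)) n) ,
               subst Nonsquare (trans (*-comm _ d) (sym (rescale z))) (square*nonsquare s d-non)) ⟩
      count (λ z → Square? (1# + - z) ×-dec Nonsquare? (1# + - (1# + - z)))
        ≡⟨ count-bijection (λ z → Square? z ×-dec Nonsquare? (1# + - z)) (λ z → 1# + - z) (λ z → 1# + - z)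
             (λ z → sym (flip-twice z)) (λ z → sym (flip-twice z)) ⟩
      sums 1# ∎
      where
      flip-twice : ∀ z → z ≡ 1# + - (1# + - z)
      flip-twice = solve 1 (λ z → z := :1 :+ :- (:1 :+ :- z)) refl
      d-non : Nonsquare d
      d-non = d-unit , ¬d-sq
      d′-non : Nonsquare d′
      d′-non = d′-unit , λ s → ¬d-sq (square-inverse (trans (*-comm d′ d) dd′≡1) s)

  -- Both sides count the pairs of a square and a nonsquare, the left one grouped by their sum.
  sums-total : ∑ sums ≡ squares ℕ.* nonsquares
  sums-total = begin
    ∑ (λ d → ∑ (λ z → bit (Square? z ×-dec Nonsquare? (d + - z))))
      ≡⟨ ∑-comm _ ⟩
    ∑ (λ z → ∑ (λ d → bit (Square? z ×-dec Nonsquare? (d + - z))))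
      ≡⟨ ∑-cong (λ z → trans (∑-cong (λ d → sym (bit-× (Square? z) (Nonsquare? (d + - z)))))
           (sym (*-∑ (bit (Square? z)) (λ d → bit (Nonsquare? (d + - z)))))) ⟩
    ∑ (λ z → bit (Square? z) ℕ.* count (λ d → Nonsquare? (d + - z)))
      ≡⟨ ∑-cong (λ z → cong (bit (Square? z) ℕ.*_) (translate-count Nonsquare? z)) ⟩
    ∑ (λ z → bit (Square? z) ℕ.* nonsquares)
      ≡⟨ ∑-* nonsquares (λ z → bit (Square? z)) ⟨
    squares ℕ.* nonsquares ∎
    where open ≡.≡-Reasoning

  sums≡ : Square (- 1#) → ∀ d → sums d ≡ sums 1# ℕ.* bit (Unit? d)
  sums≡ -1-sq d = by-cases (Unit? d)
    where
    by-cases : (u : Dec (Unit d)) → sums d ≡ sums 1# ℕ.* bit u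
    by-cases (yes u) = trans (sums-unit u) (sym (ℕₚ.*-identityʳ _))
    by-cases (no ¬u) = trans (sums-on-M -1-sq (decidable-stable (d ∈? M) (¬u ∘ ∉M⇒unit))) (sym (ℕₚ.*-zeroʳ (sums 1#)))

  -- In `sums-total` only the units contribute, each of them κ, and there are 2 s units for s
  -- squares: κ (2 s) = s s. Together with 2 s = |R| - m this is the value 4 κ = |R| - m.
  sums+sums≡squares : Square (- 1#) → sums 1# ℕ.+ sums 1# ≡ squares
  sums+sums≡squares -1-sq = ℕₚ.*-cancelˡ-≡ _ _ squares ⦃ ℕ.≢-nonZero squares≢0 ⦄ (begin
    squares ℕ.* (sums 1# ℕ.+ sums 1#)
      ≡⟨ double-product squares (sums 1#) ⟩
    sums 1# ℕ.* (squares ℕ.+ squares)      ≡⟨ cong (sums 1# ℕ.*_) units≡squares+squares ⟨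
    sums 1# ℕ.* count Unit?                ≡⟨ *-∑ (sums 1#) (λ d → bit (Unit? d)) ⟩
    ∑ (λ d → sums 1# ℕ.* bit (Unit? d))    ≡⟨ ∑-cong (sums≡ -1-sq) ⟨
    ∑ sums                                 ≡⟨ sums-total ⟩
    squares ℕ.* nonsquares                 ≡⟨ cong (squares ℕ.*_) nonsquares≡squares ⟩
    squares ℕ.* squares                    ∎)
    where open ≡.≡-Reasoning

  -- Twice the number of squares is (q - 1) m = 4 k m, so that number is even, whereas it would be
  -- odd if - 1 were not a square.
  classes≡4k+1⇒-1-square : ∀ k → classes ≡ 1 ℕ.+ k ℕ.* 4 → Square (- 1#)
  classes≡4k+1⇒-1-square k eq = decidable-stable (Square? (- 1#)) λ ¬sq →
    ℕₚ.even≢odd (k ℕ.* m) (proj₁ (squares-odd ¬sq)) (trans (ℕₚ.*-cancelˡ-≡ _ _ 2 (begin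
      2 ℕ.* (2 ℕ.* (k ℕ.* m))
        ≡⟨ ℕₚ.+-cancelʳ-≡ m _ _ (begin
             2 ℕ.* (2 ℕ.* (k ℕ.* m)) ℕ.+ m
               ≡⟨ even-cofactor k m ⟩
             (1 ℕ.+ k ℕ.* 4) ℕ.* m          ≡⟨ cong (ℕ._* m) eq ⟨
             classes ℕ.* m                  ≡⟨ size≡classes*m ⟨
             size                           ≡⟨ units+m≡size ⟨
             count Unit? ℕ.+ m              ≡⟨ cong (ℕ._+ m) units≡squares+squares ⟩
             (squares ℕ.+ squares) ℕ.+ m    ∎) ⟩
      squares ℕ.+ squares                   ≡⟨ cong (squares ℕ.+_) (ℕₚ.+-identityʳ squares) ⟨
      2 ℕ.* squares                         ∎)) (proj₂ (squares-odd ¬sq)))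
    where open ≡.≡-Reasoning

  -- Twice the number of squares is (q - 1) m = 2 (2 k + 1) m, and m is odd; so that number is odd,
  -- whereas it would be even if - 1 were a square.
  classes≡4k+3⇒-1-nonsquare : ∀ k → classes ≡ 3 ℕ.+ k ℕ.* 4 → ¬ Square (- 1#)
  classes≡4k+3⇒-1-nonsquare k eq sq = ℕₚ.even≢odd (proj₁ (squares-even sq)) (k ℕ.+ j ℕ.* (k ℕ.* 2 ℕ.+ 1))
    (trans (sym (proj₂ (squares-even sq))) (ℕₚ.*-cancelˡ-≡ _ _ 2 (begin
      2 ℕ.* squares
        ≡⟨ cong (squares ℕ.+_) (ℕₚ.+-identityʳ squares) ⟩
      squares ℕ.+ squares
        ≡⟨ ℕₚ.+-cancelʳ-≡ m _ _ (begin
             (squares ℕ.+ squares) ℕ.+ m    ≡⟨ cong (ℕ._+ m) units≡squares+squares ⟨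
             count Unit? ℕ.+ m              ≡⟨ units+m≡size ⟩
             size                           ≡⟨ size≡classes*m ⟩
             classes ℕ.* m                  ≡⟨ cong (ℕ._* m) eq ⟩
             (3 ℕ.+ k ℕ.* 4) ℕ.* m
               ≡⟨ drop-one k m ⟩
             (2 ℕ.+ k ℕ.* 4) ℕ.* m ℕ.+ m    ∎) ⟩
      (2 ℕ.+ k ℕ.* 4) ℕ.* m
        ≡⟨ cong ((2 ℕ.+ k ℕ.* 4) ℕ.*_) (proj₂ m-odd) ⟩
      (2 ℕ.+ k ℕ.* 4) ℕ.* suc (2 ℕ.* j)
        ≡⟨ odd-cofactor k j ⟩
      2 ℕ.* suc (2 ℕ.* (k ℕ.+ j ℕ.* (k ℕ.* 2 ℕ.+ 1))) ∎)))
    where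
    open ≡.≡-Reasoning
    j = proj₁ m-odd

-- Arithmetic in ℚ and ℚ(√d)

open import Data.Integer as ℤ using (+_; -_; _-_)
import Data.Integer.Properties as ℤₚ
open import Data.Nat using (_*_; _∸_; _%_; _/_)
open import Data.Rational as ℚ using (ℚ; 0ℚ; 1ℚ; ½; fromℚᵘ) renaming (_/_ to _/ℚ_)
import Data.Rational.Properties as ℚₚ
open import Data.Rational.Unnormalised as ℚᵘ using (mkℚᵘ; *≡*)
import Data.Rational.Unnormalised.Properties as ℚᵘₚ

module Rationals where
  open Solver ℚₚ.+-*-commutativeRing
  open Multipartite ℚₚ.+-*-commutativeRing using (⟪_⟫)
  open ≡-Reasoning

  -- A normalised fraction i / n involves a gcd that does not compute for variable i, so sums of
  -- fractions are compared through their unnormalised representatives.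
  fromℚᵘ-+ : ∀ p q → fromℚᵘ (p ℚᵘ.+ q) ≡ fromℚᵘ p ℚ.+ fromℚᵘ q
  fromℚᵘ-+ p q = ℚₚ.toℚᵘ-injective (ℚᵘₚ.≃-trans (ℚₚ.toℚᵘ-fromℚᵘ (p ℚᵘ.+ q))
    (ℚᵘₚ.≃-sym (ℚᵘₚ.≃-trans (ℚₚ.toℚᵘ-homo-+ (fromℚᵘ p) (fromℚᵘ q))
      (ℚᵘₚ.+-cong (ℚₚ.toℚᵘ-fromℚᵘ p) (ℚₚ.toℚᵘ-fromℚᵘ q)))))

  /1-+ : ∀ i j → (i ℤ.+ j) /ℚ 1 ≡ i /ℚ 1 ℚ.+ j /ℚ 1
  /1-+ i j = trans (ℚₚ.fromℚᵘ-cong {mkℚᵘ (i ℤ.+ j) 0} {mkℚᵘ i 0 ℚᵘ.+ mkℚᵘ j 0}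
      (*≡* (cong (ℤ._* + 1) (sym (cong₂ ℤ._+_ (ℤₚ.*-identityʳ i) (ℤₚ.*-identityʳ j))))))
    (fromℚᵘ-+ (mkℚᵘ i 0) (mkℚᵘ j 0))

  /2-double : ∀ i → i /ℚ 2 ℚ.+ i /ℚ 2 ≡ i /ℚ 1
  /2-double i = trans (sym (fromℚᵘ-+ (mkℚᵘ i 1) (mkℚᵘ i 1)))
    (ℚₚ.fromℚᵘ-cong {mkℚᵘ i 1 ℚᵘ.+ mkℚᵘ i 1} {mkℚᵘ i 0} (*≡* (begin
      (i ℤ.* + 2 ℤ.+ i ℤ.* + 2) ℤ.* + 1   ≡⟨ ℤₚ.*-identityʳ _ ⟩
      i ℤ.* + 2 ℤ.+ i ℤ.* + 2             ≡⟨ ℤₚ.*-distribˡ-+ i (+ 2) (+ 2) ⟨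
      i ℤ.* + 4                           ∎)))

  /1-neg : ∀ i → (- i) /ℚ 1 ≡ ℚ.- (i /ℚ 1)
  /1-neg i = begin
    (- i) /ℚ 1
      ≡⟨ solve 2 (λ x y → x := (x :+ y) :+ :- y) refl ((- i) /ℚ 1) (i /ℚ 1) ⟩
    (- i) /ℚ 1 ℚ.+ i /ℚ 1 ℚ.+ ℚ.- (i /ℚ 1)
      ≡⟨ cong (ℚ._+ ℚ.- (i /ℚ 1)) (trans (sym (/1-+ (- i) i)) (cong (_/ℚ 1) (ℤₚ.+-inverseˡ i))) ⟩
    0ℚ ℚ.+ ℚ.- (i /ℚ 1)
      ≡⟨ ℚₚ.+-identityˡ _ ⟩
    ℚ.- (i /ℚ 1) ∎

  /1-⟪⟫ : ∀ n → (+ n) /ℚ 1 ≡ ⟪ n ⟫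
  /1-⟪⟫ zero    = refl
  /1-⟪⟫ (suc n) = trans (/1-+ (+ 1) (+ n)) (cong (1ℚ ℚ.+_) (/1-⟪⟫ n))

  /1-difference : ∀ a b → (+ a - + b) /ℚ 1 ≡ ⟪ a ⟫ ℚ.+ ℚ.- ⟪ b ⟫
  /1-difference a b = trans (/1-+ (+ a) (- (+ b)))
    (cong₂ ℚ._+_ (/1-⟪⟫ a) (trans (/1-neg (+ b)) (cong ℚ.-_ (/1-⟪⟫ b))))

  double-injective : ∀ {x y} → x ℚ.+ x ≡ y ℚ.+ y → x ≡ y
  double-injective {x} {y} eq = trans (sym (halve x)) (trans (cong (½ ℚ.*_) eq) (halve y))
    where
    halve : ∀ x → ½ ℚ.* (x ℚ.+ x) ≡ x
    halve x = trans (ℚₚ.*-distribˡ-+ ½ x x) (trans (sym (ℚₚ.*-distribʳ-+ x ½ ½)) (ℚₚ.*-identityˡ x))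

  /2-neg : ∀ i → (- i) /ℚ 2 ≡ ℚ.- (i /ℚ 2)
  /2-neg i = double-injective (begin
    (- i) /ℚ 2 ℚ.+ (- i) /ℚ 2             ≡⟨ /2-double (- i) ⟩
    (- i) /ℚ 1                            ≡⟨ /1-neg i ⟩
    ℚ.- (i /ℚ 1)                          ≡⟨ cong ℚ.-_ (/2-double i) ⟨
    ℚ.- (i /ℚ 2 ℚ.+ i /ℚ 2)               ≡⟨ solve 1 (λ x → :- (x :+ x) := :- x :+ :- x) refl (i /ℚ 2) ⟩
    ℚ.- (i /ℚ 2) ℚ.+ ℚ.- (i /ℚ 2)         ∎)

  2-nonzerodivisor : ∀ x → (1ℚ ℚ.+ 1ℚ) ℚ.* x ≡ 0ℚ → x ≡ 0ℚ
  2-nonzerodivisor x eq = double-injective (trans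
    (solve 1 (λ x → x :+ x := (:1 :+ :1) :* x) refl x) eq)

module QuadraticRationals (d : ℕ) where
  open RawCR (ℚ√-raw d) using () renaming (_+_ to _⊕_; _*_ to _⊗_; -_ to ⊖_; 0# to 𝟘; 1# to 𝟙)
  open Solver ℚₚ.+-*-commutativeRing
  private
    Δ : ℚ
    Δ = (+ d) /ℚ 1

  isCommutativeRing : IsCommutativeRing _≡_ _⊕_ _⊗_ ⊖_ 𝟘 𝟙
  isCommutativeRing = record
    { isRing = record
      { +-isAbelianGroup = record
        { isGroup = record
          { isMonoid = record
            { isSemigroup = record
              { isMagma = record
                { isEquivalence = ≡.isEquivalence ; ∙-cong = cong₂ _⊕_ }
              ; assoc = λ { (a + b √) (a′ + b′ √) (a″ + b″ √) →
                  cong₂ _+_√ (ℚₚ.+-assoc a a′ a″) (ℚₚ.+-assoc b b′ b″) } }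
            ; identity = (λ { (a + b √) → cong₂ _+_√ (ℚₚ.+-identityˡ a) (ℚₚ.+-identityˡ b) })
                       , (λ { (a + b √) → cong₂ _+_√ (ℚₚ.+-identityʳ a) (ℚₚ.+-identityʳ b) }) }
          ; inverse = (λ { (a + b √) → cong₂ _+_√ (ℚₚ.+-inverseˡ a) (ℚₚ.+-inverseˡ b) })
                    , (λ { (a + b √) → cong₂ _+_√ (ℚₚ.+-inverseʳ a) (ℚₚ.+-inverseʳ b) })
          ; ⁻¹-cong = cong ⊖_ }
        ; comm = λ { (a + b √) (a′ + b′ √) → cong₂ _+_√ (ℚₚ.+-comm a a′) (ℚₚ.+-comm b b′) } }
      ; *-cong = cong₂ _⊗_
      ; *-assoc = λ { (a + b √) (a′ + b′ √) (a″ + b″ √) → cong₂ _+_√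
          (solve 7 (λ a b c e f g t →
             (a :* c :+ b :* e :* t) :* f :+ (a :* e :+ b :* c) :* g :* t :=
             a :* (c :* f :+ e :* g :* t) :+ b :* (c :* g :+ e :* f) :* t) refl a b a′ b′ a″ b″ Δ)
          (solve 7 (λ a b c e f g t →
             (a :* c :+ b :* e :* t) :* g :+ (a :* e :+ b :* c) :* f :=
             a :* (c :* g :+ e :* f) :+ b :* (c :* f :+ e :* g :* t)) refl a b a′ b′ a″ b″ Δ) }
      ; *-identity = (λ { (a + b √) → cong₂ _+_√
          (solve 3 (λ a b t → :1 :* a :+ :0 :* b :* t := a) refl a b Δ)
          (solve 2 (λ a b → :1 :* b :+ :0 :* a := b) refl a b) })
        , (λ { (a + b √) → cong₂ _+_√
          (solve 3 (λ a b t → a :* :1 :+ b :* :0 :* t := a) refl a b Δ)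
          (solve 2 (λ a b → a :* :0 :+ b :* :1 := b) refl a b) })
      ; distrib = (λ { (f + g √) (a + b √) (c + e √) → cong₂ _+_√
          (solve 7 (λ a b c e f g t → f :* (a :+ c) :+ g :* (b :+ e) :* t :=
             (f :* a :+ g :* b :* t) :+ (f :* c :+ g :* e :* t)) refl a b c e f g Δ)
          (solve 6 (λ a b c e f g → f :* (b :+ e) :+ g :* (a :+ c) :=
             (f :* b :+ g :* a) :+ (f :* e :+ g :* c)) refl a b c e f g) })
        , (λ { (f + g √) (a + b √) (c + e √) → cong₂ _+_√
          (solve 7 (λ a b c e f g t → (a :+ c) :* f :+ (b :+ e) :* g :* t :=
             (a :* f :+ b :* g :* t) :+ (c :* f :+ e :* g :* t)) refl a b c e f g Δ)
          (solve 6 (λ a b c e f g → (a :+ c) :* g :+ (b :+ e) :* f :=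
             (a :* g :+ b :* f) :+ (c :* g :+ e :* f)) refl a b c e f g) }) }
    ; *-comm = λ { (a + b √) (c + e √) → cong₂ _+_√
        (solve 5 (λ a b c e t → a :* c :+ b :* e :* t := c :* a :+ e :* b :* t) refl a b c e Δ)
        (solve 4 (λ a b c e → a :* e :+ b :* c := c :* b :+ e :* a) refl a b c e) } }

  commutativeRing : CommutativeRing 0ℓ 0ℓ
  commutativeRing = record { isCommutativeRing = isCommutativeRing }

  private
    module ℚ-cast = Multipartite ℚₚ.+-*-commutativeRing
    module Mult = Algebra.Properties.Semiring.Mult (CommutativeRing.semiring ℚₚ.+-*-commutativeRing)
    module Cast = Multipartite commutativeRing

  ⟪⟫≡ : ∀ n → Cast.⟪ n ⟫ ≡ ℚ-cast.⟪ n ⟫ + 0ℚ √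
  ⟪⟫≡ zero    = refl
  ⟪⟫≡ (suc n) = cong (𝟙 ⊕_) (⟪⟫≡ n)

  -- For a square d this ring has zero divisors, but 2 = 2 + 0 √d acts on the two coordinates
  -- separately.
  2-nonzerodivisor : ∀ x → (𝟙 ⊕ 𝟙) ⊗ x ≡ 𝟘 → x ≡ 𝟘
  2-nonzerodivisor (a + b √) eq = cong₂ _+_√
    (Rationals.2-nonzerodivisor a (trans
      (solve 3 (λ a b t → (:1 :+ :1) :* a := (:1 :+ :1) :* a :+ (:0 :+ :0) :* b :* t) refl a b Δ) (cong ℚ√.re eq)))
    (Rationals.2-nonzerodivisor b (trans
      (solve 2 (λ a b → (:1 :+ :1) :* b := (:1 :+ :1) :* b :+ (:0 :+ :0) :* a) refl a b) (cong ℚ√.im eq)))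

  module _ (m κ : ℕ) (eq : d * m ≡ 4 * κ ℕ.+ m) where
    private
      open ≡-Reasoning
      u w M κ′ : ℚ
      u  = (+ m) /ℚ 2
      w  = (- (+ m)) /ℚ 2
      M  = ℚ-cast.⟪ m ⟫
      κ′ = ℚ-cast.⟪ κ ⟫
      θ τ : ℚ√
      θ = w + u √
      τ = w + w √

      u+u≡M : u ℚ.+ u ≡ M
      u+u≡M = trans (Rationals./2-double (+ m)) (Rationals./1-⟪⟫ m)

      -u : w ≡ ℚ.- u
      -u = Rationals./2-neg (+ m)

      homo-+ : ∀ a b → ℚ-cast.⟪ a ℕ.+ b ⟫ ≡ ℚ-cast.⟪ a ⟫ ℚ.+ ℚ-cast.⟪ b ⟫
      homo-+ = Mult.×-homo-+ 1ℚ

      homo-* : ∀ a b → ℚ-cast.⟪ a * b ⟫ ≡ ℚ-cast.⟪ a ⟫ ℚ.* ℚ-cast.⟪ b ⟫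
      homo-* = Mult.×1-homo-*

      degree : ∀ n → ℚ-cast.⟪ 4 * κ ℕ.+ n ⟫ ≡ ((κ′ ℚ.+ κ′) ℚ.+ (κ′ ℚ.+ κ′)) ℚ.+ ℚ-cast.⟪ n ⟫
      degree n = trans (homo-+ (4 * κ) n) (cong (ℚ._+ ℚ-cast.⟪ n ⟫) (trans (homo-* 4 κ)
        (solve 1 (λ k → (:1 :+ (:1 :+ (:1 :+ (:1 :+ :0)))) :* k := k :+ k :+ (k :+ k)) refl κ′)))

      -- The relation `eq` between d, m and κ, halved.
      Δu : Δ ℚ.* u ≡ κ′ ℚ.+ κ′ ℚ.+ u
      Δu = Rationals.double-injective (begin
        Δ ℚ.* u ℚ.+ Δ ℚ.* u
          ≡⟨ solve 2 (λ t u → t :* u :+ t :* u := t :* (u :+ u)) refl Δ u ⟩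
        Δ ℚ.* (u ℚ.+ u)
          ≡⟨ cong₂ ℚ._*_ (Rationals./1-⟪⟫ d) u+u≡M ⟩
        ℚ-cast.⟪ d ⟫ ℚ.* M
          ≡⟨ homo-* d m ⟨
        ℚ-cast.⟪ d * m ⟫
          ≡⟨ trans (cong ℚ-cast.⟪_⟫ eq) (degree m) ⟩
        ((κ′ ℚ.+ κ′) ℚ.+ (κ′ ℚ.+ κ′)) ℚ.+ M
          ≡⟨ cong (((κ′ ℚ.+ κ′) ℚ.+ (κ′ ℚ.+ κ′)) ℚ.+_) u+u≡M ⟨
        ((κ′ ℚ.+ κ′) ℚ.+ (κ′ ℚ.+ κ′)) ℚ.+ (u ℚ.+ u)
          ≡⟨ solve 2 (λ k u → k :+ k :+ (k :+ k) :+ (u :+ u) := k :+ k :+ u :+ (k :+ k :+ u)) refl κ′ u ⟩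
        κ′ ℚ.+ κ′ ℚ.+ u ℚ.+ (κ′ ℚ.+ κ′ ℚ.+ u) ∎)

    valency : ∀ {n} → n ≡ 4 * κ ℕ.+ m → ((+ n - + m) /ℚ 2) + 0ℚ √ ≡ Cast.⟪ κ ℕ.+ κ ⟫
    valency {n} n≡ = trans (cong (_+ 0ℚ √) (Rationals.double-injective (begin
      (+ n - + m) /ℚ 2 ℚ.+ (+ n - + m) /ℚ 2
        ≡⟨ trans (Rationals./2-double (+ n - + m)) (Rationals./1-difference n m) ⟩
      ℚ-cast.⟪ n ⟫ ℚ.+ ℚ.- M
        ≡⟨ cong (ℚ._+ ℚ.- M) (trans (cong ℚ-cast.⟪_⟫ n≡) (degree m)) ⟩
      ((κ′ ℚ.+ κ′) ℚ.+ (κ′ ℚ.+ κ′)) ℚ.+ M ℚ.+ ℚ.- M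
        ≡⟨ solve 2 (λ k m → k :+ k :+ (k :+ k) :+ m :+ :- m := k :+ k :+ (k :+ k)) refl κ′ M ⟩
      (κ′ ℚ.+ κ′) ℚ.+ (κ′ ℚ.+ κ′)
        ≡⟨ cong₂ ℚ._+_ (homo-+ κ κ) (homo-+ κ κ) ⟨
      ℚ-cast.⟪ κ ℕ.+ κ ⟫ ℚ.+ ℚ-cast.⟪ κ ℕ.+ κ ⟫ ∎))) (sym (⟪⟫≡ (κ ℕ.+ κ)))

    eigenvalue-sum : θ ⊕ τ ≡ ⊖ Cast.⟪ m ⟫
    eigenvalue-sum = trans (cong₂ _+_√
      (trans (cong₂ ℚ._+_ -u -u) (trans (solve 1 (λ u → :- u :+ :- u := :- (u :+ u)) refl u) (cong ℚ.-_ u+u≡M)))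
      (trans (cong (u ℚ.+_) -u) (ℚₚ.+-inverseʳ u)))
      (sym (cong ⊖_ (⟪⟫≡ m)))

    -- With u = m / 2 the rational part is u² - d u² = u (u - d u), and `Δu` turns it into - 2 u κ =
    -- - m κ; the coefficients of √d cancel.
    eigenvalue-product : θ ⊗ τ ≡ ⊖ Cast.⟪ m * κ ⟫
    eigenvalue-product = trans (cong₂ _+_√
      (begin
        w ℚ.* w ℚ.+ u ℚ.* w ℚ.* Δ
          ≡⟨ cong₂ (λ x y → x ℚ.* y ℚ.+ u ℚ.* x ℚ.* Δ) -u -u ⟩
        ℚ.- u ℚ.* ℚ.- u ℚ.+ u ℚ.* ℚ.- u ℚ.* Δ
          ≡⟨ solve 2 (λ u t → :- u :* :- u :+ u :* :- u :* t := u :* (u :+ :- (t :* u))) refl u Δ ⟩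
        u ℚ.* (u ℚ.+ ℚ.- (Δ ℚ.* u))
          ≡⟨ cong (λ x → u ℚ.* (u ℚ.+ ℚ.- x)) Δu ⟩
        u ℚ.* (u ℚ.+ ℚ.- (κ′ ℚ.+ κ′ ℚ.+ u))
          ≡⟨ solve 2 (λ u k → u :* (u :+ :- (k :+ k :+ u)) := :- ((u :+ u) :* k)) refl u κ′ ⟩
        ℚ.- ((u ℚ.+ u) ℚ.* κ′)
          ≡⟨ cong ℚ.-_ (trans (cong (ℚ._* κ′) u+u≡M) (sym (homo-* m κ))) ⟩
        ℚ.- ℚ-cast.⟪ m * κ ⟫ ∎)
      (trans (cong₂ (λ x y → x ℚ.* y ℚ.+ u ℚ.* x) -u -u)
        (solve 1 (λ u → :- u :* :- u :+ u :* :- u := :0) refl u)))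
      (sym (cong ⊖_ (⟪⟫≡ (m * κ))))

-- Adjacency in terms of squares

private
  quadruple : ∀ k → k ℕ.+ k ℕ.+ (k ℕ.+ k) ≡ 4 * k
  quadruple = solve-∀

  k*2≡k+k : ∀ k → k * 2 ≡ k ℕ.+ k
  k*2≡k+k = solve-∀

  k*4-even : ∀ k → k * 4 ≡ (k ℕ.+ k) * 2
  k*4-even = solve-∀

  1+k*4-odd : ∀ k → 1 ℕ.+ k * 4 ≡ suc (2 * (k ℕ.+ k))
  1+k*4-odd = solve-∀

  3+k*4-odd : ∀ k → 3 ℕ.+ k * 4 ≡ suc (2 * suc (k ℕ.+ k))
  3+k*4-odd = solve-∀

module Adjacency (R : FiniteCommRing) (M : Subset (FiniteCommRing.size R)) (local : IsLocalWith R M)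
  (2∉M : FiniteCommRing._+_ R (FiniteCommRing.1# R) (FiniteCommRing.1# R) ∉ M) where
  open FiniteCommRing R using (size; 1#) renaming (_+_ to infixl 6 _+ᴿ_; _*_ to infixl 7 _*ᴿ_; -_ to infix 8 -ᴿ_)
  open Squares R M local 2∉M
  open Counting using (distinct; bit; bit-cong; bit-yes; bit-no; count; count-cong; count-bijection)

  unit-distinct : ∀ x y → bit (Unit? (x +ᴿ -ᴿ y)) ≡ distinct class x y
  unit-distinct x y = bit-cong (Unit? (x +ᴿ -ᴿ y)) (¬? (class x ≟ᶠ class y))
    (λ unit same → unit⇒∉M unit (complete same)) (λ different → ∉M⇒unit (different ∘ sound))

  negated-square : ∀ u → (-ᴿ 1#) *ᴿ (u *ᴿ u) ≡ -ᴿ (u *ᴿ u)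
  negated-square = solve 1 (λ u → :- :1 :* (u :* u) := :- (u :* u)) refl

  adjacent-distinct : ¬ Square (-ᴿ 1#) → ∀ x y → bit (inT? R (x +ᴿ -ᴿ y)) ≡ distinct class x y
  adjacent-distinct ¬sq x y = trans (bit-cong (inT? R d) (Unit? d) InT⇒unit (unit⇒InT (Square? d))) (unit-distinct x y)
    where
    d = x +ᴿ -ᴿ y
    InT⇒unit : InT R d → Unit d
    InT⇒unit (u , unit , inj₁ eq) = subst Unit (sym eq) (unit-* unit unit)
    InT⇒unit (u , unit , inj₂ eq) = subst Unit (sym eq) (unit-neg (unit-* unit unit))
    unit⇒InT : Dec (Square d) → Unit d → InT R d
    unit⇒InT (yes (u , unit , eq)) _ = u , unit , inj₁ eq
    unit⇒InT (no d-nonsquare) d-unit =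
      -- Since - 1 and d are both nonsquares, their product - d is a square.
      negative (nonsquare*nonsquare (unit-neg unit-1 , ¬sq) (d-unit , d-nonsquare))
      where
      double-negation : ∀ d → d ≡ -ᴿ (-ᴿ 1# *ᴿ d)
      double-negation = solve 1 (λ d → d := :- (:- :1 :* d)) refl
      negative : Square (-ᴿ 1# *ᴿ d) → InT R d
      negative (u , unit , eq) = u , unit , inj₂ (trans (double-negation d) (cong -ᴿ_ eq))

  module _ (-1-square : Square (-ᴿ 1#)) where
    S? : ∀ x y → Dec (Square (x +ᴿ -ᴿ y))
    S? x y = Square? (x +ᴿ -ᴿ y)

    N? : ∀ x y → Dec (Nonsquare (x +ᴿ -ᴿ y))
    N? x y = Nonsquare? (x +ᴿ -ᴿ y)

    adjacent-square : ∀ x y → bit (inT? R (x +ᴿ -ᴿ y)) ≡ bit (S? x y)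
    adjacent-square x y = bit-cong (inT? R (x +ᴿ -ᴿ y)) (S? x y)
      (λ { (u , unit , inj₁ eq) → u , unit , eq
         ; (u , unit , inj₂ eq) → subst Square (trans (negated-square u) (sym eq))
             (square-* -1-square (square-self unit)) })
      (λ { (u , unit , eq) → u , unit , inj₁ eq })

    complementary : ∀ x y → bit (S? x y) ℕ.+ bit (N? x y) ≡ distinct class x y
    complementary x y = trans (by-cases (S? x y)) (unit-distinct x y)
      where
      d = x +ᴿ -ᴿ y
      by-cases : (s : Dec (Square d)) → bit s ℕ.+ bit (N? x y) ≡ bit (Unit? d)
      by-cases (yes s) = trans (cong suc (bit-no (N? x y) (λ n → proj₂ n s))) (sym (bit-yes (Unit? d) (square⇒unit s)))
      by-cases (no ¬s) = bit-cong (N? x y) (Unit? d) proj₁ (λ unit → unit , ¬s)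

    κ : ℕ
    κ = sums 1#

    walks : ∀ x y → count (λ z → S? x z ×-dec N? z y) ≡ κ * distinct class x y
    walks x y = begin
      count (λ z → S? x z ×-dec N? z y)
        -- Substituting z = x - w turns x - z into w and z - y into (x - y) - w, so the walks become
        -- the representations counted by `sums`.
        ≡⟨ count-bijection (λ z → S? x z ×-dec N? z y) reflect reflect
             (λ z → reflect-twice x z) (λ z → reflect-twice x z) ⟨
      count (λ w → S? x (reflect w) ×-dec N? (reflect w) y)
        ≡⟨ count-cong (λ w → S? x (reflect w) ×-dec N? (reflect w) y) (λ w → Square? w ×-dec Nonsquare? (d +ᴿ -ᴿ w))
             (λ w (s , n) → subst Square (reflect-twice x w) s , subst Nonsquare (swap-subtrahends x y w) n)
             (λ w (s , n) → subst Square (sym (reflect-twice x w)) s , subst Nonsquare (sym (swap-subtrahends x y w)) n) ⟩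
      sums d
        ≡⟨ sums≡ -1-square d ⟩
      κ * bit (Unit? d)
        ≡⟨ cong (κ *_) (unit-distinct x y) ⟩
      κ * distinct class x y ∎
      where
      open ≡-Reasoning
      d = x +ᴿ -ᴿ y
      reflect : Fin size → Fin size
      reflect w = x +ᴿ -ᴿ w
      reflect-twice : ∀ x w → x +ᴿ -ᴿ (x +ᴿ -ᴿ w) ≡ w
      reflect-twice = solve 2 (λ x w → x :+ :- (x :+ :- w) := w) refl
      swap-subtrahends : ∀ x y w → x +ᴿ -ᴿ w +ᴿ -ᴿ y ≡ x +ᴿ -ᴿ y +ᴿ -ᴿ w
      swap-subtrahends = solve 3 (λ x y w → x :+ :- w :+ :- y := x :+ :- y :+ :- w) refl

    g : Fin size
    g = proj₁ nonsquare-exists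

    relabel : Fin size → Fin size
    relabel x = g *ᴿ x

    relabel-injective : ∀ {x y} → relabel x ≡ relabel y → x ≡ y
    relabel-injective = unit-cancel (proj₁ (proj₂ nonsquare-exists))

    relabelled : ∀ x y → bit (N? x y) ≡ bit (S? (relabel x) (relabel y))
    relabelled x y = bit-cong (N? x y) (S? (g *ᴿ x) (g *ᴿ y))
      (λ n → subst Square (factor-out g x y) (nonsquare*nonsquare g-nonsquare n))
      (λ s → back (subst Square (sym (factor-out g x y)) s))
      where
      g-nonsquare : Nonsquare g
      g-nonsquare = proj₂ nonsquare-exists
      factor-out : ∀ g x y → g *ᴿ (x +ᴿ -ᴿ y) ≡ g *ᴿ x +ᴿ -ᴿ (g *ᴿ y)
      factor-out = solve 3 (λ g x y → g :* (x :+ :- y) := g :* x :+ :- (g :* y)) refl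
      back : ∀ {d} → Square (g *ᴿ d) → Nonsquare d
      back {d} s = unit-factor (square⇒unit s) , λ d-sq →
        proj₂ (square*nonsquare d-sq g-nonsquare) (subst Square (*-comm g d) s)

    size≡4κ+m : size ≡ 4 * κ ℕ.+ m
    size≡4κ+m = begin
      size                                  ≡⟨ units+m≡size ⟨
      count Unit? ℕ.+ m                     ≡⟨ cong (ℕ._+ m) units≡squares+squares ⟩
      squares ℕ.+ squares ℕ.+ m             ≡⟨ cong (λ s → s ℕ.+ s ℕ.+ m) (sums+sums≡squares -1-square) ⟨
      κ ℕ.+ κ ℕ.+ (κ ℕ.+ κ) ℕ.+ m           ≡⟨ cong (ℕ._+ m) (quadruple κ) ⟩
      4 * κ ℕ.+ m                           ∎
      where open ≡-Reasoning

-- The two spectra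

module _ (R : FiniteCommRing) (M : Subset (FiniteCommRing.size R)) (local : IsLocalWith R M) where
  open FiniteCommRing R using (size)
  open Local R M local using (m; m≢0; classes; class; class-count; size≡classes*m; odd⇒2∉M)
  open Counting using (bit; count)

  -- Cancels m from q m = |R| = `classes` m, which is possible as 0 ∈ M makes m nonzero.
  classes≡ : ∀ {q} → size ≡ q * ∣ M ∣ → classes ≡ q
  classes≡ {q} eq = ℕₚ.*-cancelʳ-≡ classes q m ⦃ ℕ.≢-nonZero m≢0 ⦄ (trans (sym size≡classes*m) eq)

  private
    k≤size : ∀ {k} → size ≡ k * m → k ℕ.≤ size
    k≤size {k} eq = subst (k ℕ.≤_) (sym eq) (ℕₚ.m≤m*n k m ⦃ ℕ.≢-nonZero m≢0 ⦄)

    const-indicator : ∀ {A : Set} (K : RawCR A)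
      (isCR : IsCommutativeRing _≡_ (RawCR._+_ K) (RawCR._*_ K) (RawCR.-_ K) (RawCR.0# K) (RawCR.1# K)) →
      let open Polynomials K isCR in
      ∀ {P : Set} (d : Dec P) → Poly.const K (if ⌊ d ⌋ then RawCR.1# K else RawCR.0# K) ≐ ℙ.⟪ bit d ⟫
    const-indicator K isCR (yes _) = Polynomials.ℙ.refl K isCR
    const-indicator K isCR (no _)  = Polynomials.const-0 K isCR

    adjacency-indicator : ∀ {A : Set} (K : RawCR A)
      (isCR : IsCommutativeRing _≡_ (RawCR._+_ K) (RawCR._*_ K) (RawCR.-_ K) (RawCR.0# K) (RawCR.1# K)) →
      let open Polynomials K isCR in
      ∀ x y {b} → bit (inT? R (FiniteCommRing._+_ R x (FiniteCommRing.-_ R y))) ≡ b →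
      Poly.const K (adjMatrix K R x y) ≐ ℙ.⟪ b ⟫
    adjacency-indicator K isCR x y eq = ℙ.trans
      (const-indicator K isCR (inT? R (FiniteCommRing._+_ R x (FiniteCommRing.-_ R y))))
      (ℙ.reflexive (cong ℙ.⟪_⟫ eq))
      where open Polynomials K isCR

    residue-form : ∀ q {r} → q % 4 ≡ r → q ≡ r ℕ.+ q / 4 * 4
    residue-form q eq = trans (m≡m%n+[m/n]*n q 4) (cong (ℕ._+ q / 4 * 4) eq)

  -- The scalar ring itself depends on q. With q a variable, matching the equation with `refl`
  -- replaces it by `classes` everywhere at once, and no transport between scalar rings arises.
  spectrum-1-mod-4 : ∀ {q} → classes ≡ q → q % 4 ≡ 1 → Poly.HasSpectrum (ℚ√-raw q) size (adjMatrix (ℚ√-raw q) R)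
    ( (((+ size - + m) /ℚ 2) + 0ℚ √ , 1)
    ∷ (((- (+ m)) /ℚ 2) + ((+ m) /ℚ 2) √ , (q ∸ 1) / 2)
    ∷ (((- (+ m)) /ℚ 2) + ((- (+ m)) /ℚ 2) √ , (q ∸ 1) / 2)
    ∷ ((0ℚ + 0ℚ √) , size ∸ q)
    ∷ [])
  spectrum-1-mod-4 refl mod = conference-spectrum class class-count size≡classes*m (k≤size size≡classes*m) classes≡suc
      (S? -1-square) (N? -1-square) (complementary -1-square) (κ -1-square) (walks -1-square)
      (relabel -1-square) (relabel-injective -1-square)
      (relabelled -1-square) (size≡4κ+m -1-square) (QuadraticRationals.2-nonzerodivisor classes)
      (adjMatrix (ℚ√-raw classes) R)
      (λ x y → adjacency-indicator (ℚ√-raw classes) isCR x y (adjacent-square -1-square x y))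
      {(classes ∸ 1) / 2} halves
      {θ = ((- (+ m)) /ℚ 2) + ((+ m) /ℚ 2) √} {((- (+ m)) /ℚ 2) + ((- (+ m)) /ℚ 2) √}
      (QuadraticRationals.valency classes m (κ -1-square) degree (size≡4κ+m -1-square))
      (QuadraticRationals.eigenvalue-sum classes m (κ -1-square) degree)
      (QuadraticRationals.eigenvalue-product classes m (κ -1-square) degree)
      refl
    where
    isCR = QuadraticRationals.isCommutativeRing classes
    open Spectra (ℚ√-raw classes) isCR
    j = classes / 4
    form : classes ≡ 1 ℕ.+ j * 4
    form = residue-form classes mod
    -- The number of cosets is 4 j + 1 = 2 (2 j) + 1, hence odd, and so 2 ∉ M.
    open Adjacency R M local (odd⇒2∉M (j ℕ.+ j) (trans form (1+k*4-odd j)))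
    open Squares R M local (odd⇒2∉M (j ℕ.+ j) (trans form (1+k*4-odd j))) using (classes≡4k+1⇒-1-square)
    -1-square = classes≡4k+1⇒-1-square j form
    classes≡suc : classes ≡ suc (classes ∸ 1)
    classes≡suc = trans form (cong (λ c → suc (c ∸ 1)) (sym form))
    degree : classes * m ≡ 4 * κ -1-square ℕ.+ m
    degree = trans (sym size≡classes*m) (size≡4κ+m -1-square)
    classes∸1 : classes ∸ 1 ≡ (j ℕ.+ j) * 2
    classes∸1 = trans (cong (_∸ 1) form) (k*4-even j)
    -- The truncating division in the multiplicity is exact, because q - 1 = 4 j.
    halves : classes ∸ 1 ≡ (classes ∸ 1) / 2 ℕ.+ (classes ∸ 1) / 2
    halves = trans classes∸1 (trans (k*2≡k+k (j ℕ.+ j)) (sym (cong (λ h → h ℕ.+ h)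
      (trans (cong (_/ 2) classes∸1) (m*n/n≡m (j ℕ.+ j) 2)))))

  spectrum-3-mod-4 : ∀ {q} → classes ≡ q → q % 4 ≡ 3 → Poly.HasSpectrum ℚ-raw size (adjMatrix ℚ-raw R)
    ( ((+ size - + m) /ℚ 1 , 1)
    ∷ ((- (+ m)) /ℚ 1 , q ∸ 1)
    ∷ (0ℚ , size ∸ q)
    ∷ [])
  spectrum-3-mod-4 refl mod = multipartite-spectrum class class-count size≡classes*m (k≤size size≡classes*m) classes≡suc
      (adjMatrix ℚ-raw R)
      (λ x y → adjacency-indicator ℚ-raw ℚₚ.+-*-isCommutativeRing x y
        (adjacent-distinct (classes≡4k+3⇒-1-nonsquare j form) x y))
      (Rationals./1-difference size m)
      (trans (Rationals./1-neg (+ m)) (cong ℚ.-_ (Rationals./1-⟪⟫ m)))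
      refl
    where
    open Spectra ℚ-raw ℚₚ.+-*-isCommutativeRing
    j = classes / 4
    form : classes ≡ 3 ℕ.+ j * 4
    form = residue-form classes mod
    -- Here the number of cosets is 4 j + 3 = 2 (2 j + 1) + 1.
    open Adjacency R M local (odd⇒2∉M (suc (j ℕ.+ j)) (trans form (3+k*4-odd j)))
    open Squares R M local (odd⇒2∉M (suc (j ℕ.+ j)) (trans form (3+k*4-odd j))) using (classes≡4k+3⇒-1-nonsquare)
    classes≡suc : classes ≡ suc (classes ∸ 1)
    classes≡suc = trans form (cong (λ c → suc (c ∸ 1)) (sym form))

theorem2p4 : (R : FiniteCommRing) (M : Subset (FiniteCommRing.size R)) →
    IsLocalWith R M →
    (q : ℕ) → FiniteCommRing.size R ≡ q * ∣ M ∣ →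
    (q % 4 ≡ 1 →
    Poly.HasSpectrum (ℚ√-raw q) (FiniteCommRing.size R) (adjMatrix (ℚ√-raw q) R)
    ( (((+ FiniteCommRing.size R - + ∣ M ∣) /ℚ 2) + 0ℚ √ , 1)
    ∷ (((- (+ ∣ M ∣)) /ℚ 2) + ((+ ∣ M ∣) /ℚ 2) √ , (q ∸ 1) / 2)
    ∷ (((- (+ ∣ M ∣)) /ℚ 2) + ((- (+ ∣ M ∣)) /ℚ 2) √ , (q ∸ 1) / 2)
    ∷ ((0ℚ + 0ℚ √) , FiniteCommRing.size R ∸ q)
    ∷ []))
    ×
    (q % 4 ≡ 3 →
    Poly.HasSpectrum ℚ-raw (FiniteCommRing.size R) (adjMatrix ℚ-raw R)
    ( ((+ FiniteCommRing.size R - + ∣ M ∣) /ℚ 1 , 1)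
    ∷ ((- (+ ∣ M ∣)) /ℚ 1 , q ∸ 1)
    ∷ (0ℚ , FiniteCommRing.size R ∸ q)
    ∷ []))
theorem2p4 R M local q size≡ =
  spectrum-1-mod-4 R M local q≡ , spectrum-3-mod-4 R M local q≡
  where
  q≡ : Local.classes R M local ≡ q
  q≡ = classes≡ R M local size≡
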